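{- Let $c>1$ be odd, let $n>c$ be odd, and suppose $c>\frac{n}{2}$. Then the nontrivial equivalence class of $S_n$ consisting of odd permutations has exactly $n\,C_{\frac{n-c-2}{2}}$ more elements than the nontrivial equivalence class consisting of even permutations, where $C_k=\frac{1}{k+1}\binom{2k}{k}$ is the $k$th Catalan number.
   Context: Permutations are written in one-line notation. Let $M\subseteq S_c$ be the set of cyclic shifts $a(a+1)\cdots c\,1\cdots(a-1)$, $a=1,\ldots,c$, of the identity $12\cdots c$. The equivalence on $S_n$ is the equivalence relation generated by declaring $\phi\equiv\psi$ whenever $\phi=aub$, $\psi=avb$ for words $a,b$ and contiguous factors $u,v$ of length $c$ whose order permutations (the permutations of $\{1,\ldots,c\}$ with the same relative order) both lie in $M$. A class is nontrivial if it has more than one element. A non-avoider is a permutation containing a contiguous factor of length $c$ with order permutation in $M$. Since $c$ is odd, every generating move preserves the parity of a permutation, and for $n>c$ the nontrivial classes of $S_n$ are exactly the set of odd non-avoiders and the set of even non-avoiders. -}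

module Defs where

open import Data.Nat using (ℕ; zero; suc; _+_; _*_; _∸_; _<_; _≤_; _<ᵇ_; _≤ᵇ_)
open import Data.Nat.DivMod using (_/_; _%_)
open import Data.Nat.Combinatorics using (_C_)
open import Data.Bool using (Bool; true; false; if_then_else_)
open import Data.List using (List; []; _∷_; _++_; length; map; applyUpTo; upTo; drop; take)
open import Data.List.Membership.Propositional using (_∈_)
open import Data.List.Relation.Binary.Permutation.Propositional using (_↭_)
open import Data.Product using (Σ; _×_; ∃)
open import Relation.Binary.PropositionalEquality using (_≡_)
open import Relation.Binary.Construct.Closure.Equivalence using (EqClosure)

idWord : ℕ → List ℕ
idWord n = applyUpTo suc n

IsPerm : ℕ → List ℕ → Set
IsPerm n w = w ↭ idWord n

countLe : ℕ → List ℕ → ℕ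
countLe x [] = 0
countLe x (y ∷ ys) = (if y ≤ᵇ x then 1 else 0) + countLe x ys

-- order permutation (standardisation) of a word with distinct entries:
-- each entry is replaced by its rank among the entries
ordPerm : List ℕ → List ℕ
ordPerm u = map (λ x → countLe x u) u

-- the cyclic shift a (a+1) ... c 1 ... (a-1), written with k = a - 1
cycShift : ℕ → ℕ → List ℕ
cycShift c k = drop k (idWord c) ++ take k (idWord c)

M : ℕ → List (List ℕ)
M c = map (cycShift c) (upTo c)

Move : ℕ → ℕ → List ℕ → List ℕ → Set
Move c n φ ψ =
  Σ (List ℕ) λ a → Σ (List ℕ) λ u → Σ (List ℕ) λ v → Σ (List ℕ) λ b →
    IsPerm n φ × IsPerm n ψ ×
    φ ≡ a ++ u ++ b × ψ ≡ a ++ v ++ b ×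
    length u ≡ c × length v ≡ c ×
    ordPerm u ∈ M c × ordPerm v ∈ M c

Equiv : ℕ → ℕ → List ℕ → List ℕ → Set
Equiv c n = EqClosure (Move c n)

ltCount : ℕ → List ℕ → ℕ
ltCount x [] = 0
ltCount x (y ∷ ys) = (if y <ᵇ x then 1 else 0) + ltCount x ys

inversions : List ℕ → ℕ
inversions [] = 0
inversions (x ∷ xs) = ltCount x xs + inversions xs

IsOdd : List ℕ → Set
IsOdd w = inversions w % 2 ≡ 1

IsEven : List ℕ → Set
IsEven w = inversions w % 2 ≡ 0

catalan : ℕ → ℕ
catalan k = ((2 * k) C k) / suc k

{-# OPTIONS --safe #-}

-- Call a word cyclically increasing if it is a rotation of an increasing word; a move rotates a
-- cyclically increasing window of length c.  Since c is odd, moves preserve the sign.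
--
-- Connectedness of the non-avoiders of a given sign: two moves turn a cyclically increasing word of
-- length c + 1 into its rotation by two places, and the same then holds for length c + 2.  From there,
-- induction on the length (fixing the first or the last letter) moves the least letter to the front, so
-- every non-avoider is equivalent to one of two words, which have opposite signs.
--
-- Signed count of the non-avoiders: let x be the last letter of w.  Exchanging the values x and x + 1
-- (cyclically) reverses the sign of w and keeps every cyclically increasing window that avoids the last
-- position; the same works for the first letter.  By inclusion-exclusion only the words in which the first
-- and the last window, but no other, are cyclically increasing contribute.  Because n < 2c these two
-- windows overlap, and such a word is a rotation of the identity (n choices) whose last 2(n - c) letters
-- are unshuffled along a lattice path that stays positive until it returns to 0 at its very end.  Summing
-- the signs of these paths, two steps at a time, leaves the ballot recursion for the Catalan number.

module Submission where

open import Defs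
open import Data.Bool as Bool using (Bool; true; false; if_then_else_)
open import Data.Integer as ℤ using (ℤ; 0ℤ; 1ℤ; -1ℤ)
import Data.Integer.Properties as ℤₚ
import Data.Integer.Tactic.RingSolver as ℤSolver
open import Data.List
  using (List; []; _∷_; _++_; length; map; [_]; applyUpTo; upTo; drop; take; filter; cartesianProduct;
    initLast; _∷ʳ′_)
open import Data.List.Membership.Propositional using (_∈_; _∉_)
import Data.List.Membership.DecPropositional as DecMembership
open import Data.List.Membership.Propositional.Properties
  using (∈-++⁺ˡ; ∈-++⁺ʳ; ∈-++⁻; ∈-∃++; ∈-map⁺; ∈-map⁻; ∈-filter⁺; ∈-filter⁻; ∈-upTo⁺; ∈-upTo⁻; ∈-applyUpTo⁺;
    ∈-applyUpTo⁻; ∈-cartesianProduct⁺; ∈-cartesianProduct⁻)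
open import Data.List.Membership.Propositional.Properties.WithK using (unique∧set⇒bag)
open import Data.List.Properties
  using (++-assoc; ++-identityʳ; length-++; length-map; length-take; length-drop; length-applyUpTo; map-++;
    map-cong; map-∘; map-id; take-map; drop-map; take++drop≡id; ∷-injective; ∷-injectiveˡ; ∷-injectiveʳ;
    ≡-dec)
open import Data.List.Relation.Binary.BagAndSetEquality using (∼bag⇒↭)
open import Data.List.Relation.Binary.Permutation.Propositional
  using (_↭_; refl; prep; swap; ↭-refl; ↭-sym; ↭-trans; ↭-swap; ↭⇒↭ₛ)
import Data.List.Relation.Binary.Permutation.Propositional.Properties as Permₚ
import Data.List.Relation.Binary.Permutation.Setoid.Properties as PermSetoidₚ
import Data.List.Relation.Binary.Sublist.Heterogeneous.Properties as HSub
open import Data.List.Relation.Binary.Sublist.Propositional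
  using (_⊆_; []; _∷_; _∷ʳ_; ⊆-refl; ⊆-trans; minimum; from∈)
import Data.List.Relation.Binary.Sublist.Propositional.Properties as Subₚ
open import Data.List.Relation.Unary.All as All using (All; []; _∷_)
import Data.List.Relation.Unary.All.Properties as Allₚ
open import Data.List.Relation.Unary.AllPairs as AllPairs using (AllPairs; []; _∷_)
import Data.List.Relation.Unary.AllPairs.Properties as AllPairsₚ
open import Data.List.Relation.Unary.Any using (here; there)
open import Data.List.Relation.Unary.Unique.Propositional using (Unique)
import Data.List.Relation.Unary.Unique.Propositional.Properties as Uniqueₚ
open import Data.Nat
open import Data.Nat.Combinatorics using (_C_; nCk+nC[k+1]≡[n+1]C[k+1]; nCk≡nC[n∸k]; nCn≡1; nC1≡n)
open import Data.Nat.DivMod using (_/_; _%_; [m+n]%n≡m%n; m*n/n≡m; /-congˡ)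
open import Data.Nat.Properties
open import Data.Nat.Tactic.RingSolver using (solve-∀)
open import Data.Product using (Σ; ∃; ∃₂; _×_; _,_; proj₁; proj₂)
open import Data.Sum using (_⊎_; inj₁; inj₂)
open import Function using (_∘_; id; mk⇔)
open import Function.Bundles using (_⇔_; Equivalence)
open import Level using (0ℓ)
open import Relation.Binary using (Rel; Asymmetric; IsEquivalence; tri<; tri≈; tri>)
open import Relation.Binary.Construct.Closure.Equivalence as EqC using (EqClosure)
open import Relation.Binary.Construct.Closure.ReflexiveTransitive using (ε; _◅_)
open import Relation.Binary.Construct.Closure.Symmetric using (fwd; bwd)
open import Relation.Binary.PropositionalEquality
  using (_≡_; _≢_; refl; sym; trans; cong; cong₂; subst; subst₂; setoid; module ≡-Reasoning)
import Relation.Binary.Reasoning.Setoid as SetoidReasoning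
open import Relation.Nullary using (¬_; contradiction; yes; no)
open import Relation.Nullary.Decidable using (_×-dec_; _⊎-dec_; ¬?; map′)
open import Relation.Unary using (Pred; Decidable)

-- Parities of lengths shape the argument. Rotating a word of odd length is an even permutation,
-- while rotating a word of even length by one place is odd. So in length c + 1 only rotations by an
-- even number of places can be reached, whereas in length c + 2 steps of two places generate all
-- rotations. Since c < n are both odd, n is at least c + 2, and the induction on the length starts
-- there. It has to carry both representatives along, because a prefix or suffix of a given word may
-- come out with either sign. In the count, put s = (n - c - 2)/2 and k = 2c - n. Then n - c = 2s +
-- 2 is even and k is odd: a block of n - c letters passes the overlap of the two windows without a
-- sign, and all n rotations of the identity are even. Hence the sign of an extremal word is that of
-- its path alone. The extremal words enter the sieve with a minus sign, which makes the odd class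
-- the larger one.

private variable
  A B : Set
  xs ys zs : List A

-- Lists, rotations and cyclically increasing words

++-split : ∀ (p r : List A) {q s} → p ++ q ≡ r ++ s →
           (∃ λ t → p ≡ r ++ t × s ≡ t ++ q) ⊎ (∃ λ t → r ≡ p ++ t × q ≡ t ++ s)
++-split []      r       eq = inj₂ (r , refl , eq)
++-split (x ∷ p) []      eq = inj₁ (x ∷ p , refl , sym eq)
++-split (x ∷ p) (y ∷ r) eq with ∷-injective eq
... | refl , eq′ with ++-split p r eq′
...   | inj₁ (t , refl , e) = inj₁ (t , refl , e)
...   | inj₂ (t , refl , e) = inj₂ (t , refl , e)

Rot : List A → List A → Set
Rot xs ys = ∃₂ λ p q → xs ≡ p ++ q × ys ≡ q ++ p

rot-refl : Rot xs xs
rot-refl {xs = xs} = [] , xs , refl , sym (++-identityʳ xs)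

rot-sym : Rot xs ys → Rot ys xs
rot-sym (p , q , e , f) = q , p , f , e

rot-trans : Rot xs ys → Rot ys zs → Rot xs zs
rot-trans (p , q , refl , f) (r , s , g , refl) with ++-split q r (trans (sym f) g)
... | inj₁ (t , refl , refl) = p ++ r , t , sym (++-assoc p r t) , ++-assoc t p r
... | inj₂ (t , refl , refl) = t , s ++ q , ++-assoc t s q , sym (++-assoc s q t)

rot-↭ : Rot xs ys → xs ↭ ys
rot-↭ (p , q , refl , refl) = Permₚ.++-comm p q

rot-map : (f : A → B) → Rot xs ys → Rot (map f xs) (map f ys)
rot-map f (p , q , refl , refl) = map f p , map f q , map-++ f p q , map-++ f q p

AllPairs-⊆ : ∀ {R : Rel A 0ℓ} → xs ⊆ ys → AllPairs R ys → AllPairs R xs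
AllPairs-⊆ []          []        = []
AllPairs-⊆ (y ∷ʳ τ)    (_ ∷ rs)  = AllPairs-⊆ τ rs
AllPairs-⊆ (refl ∷ τ)  (r ∷ rs)  = Subₚ.All-resp-⊆ τ r ∷ AllPairs-⊆ τ rs

⊆-++⁻ : ∀ (ys : List A) → xs ⊆ ys ++ zs → ∃₂ λ us vs → xs ≡ us ++ vs × us ⊆ ys × vs ⊆ zs
⊆-++⁻ []       τ = [] , _ , refl , [] , τ
⊆-++⁻ (y ∷ ys) (.y ∷ʳ τ) with ⊆-++⁻ ys τ
... | us , vs , refl , τ₁ , τ₂ = us , vs , refl , y ∷ʳ τ₁ , τ₂
⊆-++⁻ (y ∷ ys) (refl ∷ τ) with ⊆-++⁻ ys τ
... | us , vs , refl , τ₁ , τ₂ = y ∷ us , vs , refl , refl ∷ τ₁ , τ₂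

-- Each head precedes every other letter of its list, so asymmetry forces the two heads to agree.
-- Used both for `<` and for the order by `key`.
AllPairs-↭⇒≡ : ∀ {R : Rel A 0ℓ} → Asymmetric R → AllPairs R xs → AllPairs R ys → xs ↭ ys → xs ≡ ys
AllPairs-↭⇒≡ as [] _ σ = sym (Permₚ.↭-empty-inv (↭-sym σ))
AllPairs-↭⇒≡ as (_ ∷ _) [] σ = Permₚ.↭-empty-inv σ
AllPairs-↭⇒≡ {xs = x ∷ xs} {ys = y ∷ ys} as (r ∷ rs) (t ∷ ts) σ
  with Permₚ.∈-resp-↭ σ (here refl) | Permₚ.∈-resp-↭ (↭-sym σ) (here refl)
... | here refl | _ = cong (x ∷_) (AllPairs-↭⇒≡ as rs ts (Permₚ.drop-∷ σ))
... | there _ | here refl = cong (x ∷_) (AllPairs-↭⇒≡ as rs ts (Permₚ.drop-∷ σ))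
... | there x∈ys | there y∈xs = contradiction (All.lookup r y∈xs) (as (All.lookup t x∈ys))

Unique-↭ : xs ↭ ys → Unique xs → Unique ys
Unique-↭ = PermSetoidₚ.Unique-resp-↭ (setoid _) ∘ ↭⇒↭ₛ

++-Unique⁻ : ∀ (xs : List A) → Unique (xs ++ ys) → All (λ x → All (x ≢_) ys) xs
++-Unique⁻ []       _        = []
++-Unique⁻ (x ∷ xs) (r ∷ rs) = Allₚ.++⁻ʳ xs r ∷ ++-Unique⁻ xs rs

Sorted : List ℕ → Set
Sorted = AllPairs _<_

CI : List ℕ → Set
CI u = ∃ λ s → Sorted s × Rot s u

CI-rot : ∀ {u v} → CI u → Rot u v → CI v
CI-rot (s , ss , r) r′ = s , ss , rot-trans r r′

-- The cut of `v` also cuts the sublist, and the two pieces put back in order form a sublist of the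
-- sorted word. Many windows below are seen to be cyclically increasing in this way.
CI-⊆ : ∀ {u v} → u ⊆ v → CI v → CI u
CI-⊆ τ (_ , ss , p , q , refl , refl) with ⊆-++⁻ q τ
... | us , vs , refl , τ₁ , τ₂ = vs ++ us , AllPairs-⊆ (HSub.++⁺ τ₂ τ₁) ss , vs , us , refl , refl

sorted-insert : ∀ s {x} → Sorted s → x ∉ s → ∃₂ λ s₁ s₂ → s ≡ s₁ ++ s₂ × Sorted (s₁ ++ x ∷ s₂)
sorted-insert [] _ _ = [] , [] , refl , ([] ∷ [])
sorted-insert (y ∷ s) {x} (r ∷ rs) x∉ with <-cmp x y
... | tri< x<y _ _ = [] , y ∷ s , refl , ((x<y ∷ All.map (<-trans x<y) r) ∷ r ∷ rs)
... | tri≈ _ refl _ = contradiction (here refl) x∉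
... | tri> _ _ y<x with sorted-insert s rs (x∉ ∘ there)
...   | s₁ , s₂ , refl , ss =
        y ∷ s₁ , s₂ , refl ,
        (Permₚ.All-resp-↭ (↭-sym (Permₚ.shift x s₁ s₂)) (y<x ∷ r) ∷ ss)

-- Insert `x` into the sorted word and cut right after it. A window can thus be rotated until it
-- extends over the neighbouring letter.
CI-insertʳ : ∀ {u x} → CI u → x ∉ u → ∃ λ v → Rot u v × CI (v ++ [ x ])
CI-insertʳ {x = x} (s , ss , r) x∉ with sorted-insert s ss (x∉ ∘ Permₚ.∈-resp-↭ (rot-↭ r))
... | s₁ , s₂ , refl , ss′ =
  s₂ ++ s₁ , rot-trans (rot-sym r) (s₁ , s₂ , refl , refl) ,
  s₁ ++ x ∷ s₂ , ss′ , s₁ ++ [ x ] , s₂ , sym (++-assoc s₁ [ x ] s₂) , ++-assoc s₂ s₁ [ x ]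

CI-insertˡ : ∀ {u x} → CI u → x ∉ u → ∃ λ v → Rot u v × CI (x ∷ v)
CI-insertˡ {x = x} ci x∉ with CI-insertʳ ci x∉
... | v , r , ci′ = v , r , CI-rot ci′ (v , [ x ] , refl , refl)

-- Signs

sign : ℕ → ℤ
sign zero    = 1ℤ
sign (suc n) = ℤ.- sign n

sgn : List ℕ → ℤ
sgn w = sign (inversions w)

sign-+ : ∀ m n → sign (m + n) ≡ sign m ℤ.* sign n
sign-+ zero    n = sym (ℤₚ.*-identityˡ (sign n))
sign-+ (suc m) n = trans (cong ℤ.-_ (sign-+ m n)) (ℤₚ.neg-distribˡ-* (sign m) (sign n))

sign-even : ∀ n → sign (n + n) ≡ 1ℤ
sign-even zero    = refl
sign-even (suc n) = trans (cong (ℤ.-_ ∘ sign) (+-suc n n)) (trans (ℤₚ.neg-involutive _) (sign-even n))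

sign-*-evenˡ : ∀ m n → sign m ≡ 1ℤ → sign (m * n) ≡ 1ℤ
sign-*-evenˡ m zero    _ = cong sign (*-zeroʳ m)
sign-*-evenˡ m (suc n) e = trans (cong sign (*-suc m n))
  (trans (sign-+ m (m * n)) (cong₂ ℤ._*_ e (sign-*-evenˡ m n e)))

sign-*-evenʳ : ∀ m n → sign n ≡ 1ℤ → sign (m * n) ≡ 1ℤ
sign-*-evenʳ m n e = trans (cong sign (*-comm m n)) (sign-*-evenˡ n m e)

sign-dichotomy : ∀ n → sign n ≡ 1ℤ ⊎ sign n ≡ -1ℤ
sign-dichotomy zero = inj₁ refl
sign-dichotomy (suc n) with sign-dichotomy n
... | inj₁ e = inj₂ (cong ℤ.-_ e)
... | inj₂ e = inj₁ (cong ℤ.-_ e)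

sign-*-odd-sum : ∀ m n → sign (m + n) ≡ -1ℤ → sign (m * n) ≡ 1ℤ
sign-*-odd-sum m n e with sign-dichotomy m | sign-dichotomy n
... | inj₁ a | _      = sign-*-evenˡ m n a
... | inj₂ _ | inj₁ b = sign-*-evenʳ m n b
... | inj₂ a | inj₂ b with trans (sym e) (trans (sign-+ m n) (cong₂ ℤ._*_ a b))
...   | ()

sign-%2 : ∀ n → (n % 2 ≡ 0 → sign n ≡ 1ℤ) × (n % 2 ≡ 1 → sign n ≡ -1ℤ)
sign-%2 zero          = (λ _ → refl) , λ ()
sign-%2 (suc zero)    = (λ ()) , λ _ → refl
sign-%2 (suc (suc n)) with sign-%2 n
... | even , odd = trans (ℤₚ.neg-involutive _) ∘ even ∘ trans (sym eq) , trans (ℤₚ.neg-involutive _) ∘ odd ∘ trans (sym eq)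
  where
  eq : suc (suc n) % 2 ≡ n % 2
  eq = trans (cong (_% 2) (+-comm 2 n)) ([m+n]%n≡m%n n 2)

ltCount-swap : ∀ z a x y b → ltCount z (a ++ x ∷ y ∷ b) ≡ ltCount z (a ++ y ∷ x ∷ b)
ltCount-swap z [] x y b = begin
  i + (j + k) ≡⟨ +-assoc i j k ⟨
  i + j + k   ≡⟨ cong (_+ k) (+-comm i j) ⟩
  j + i + k   ≡⟨ +-assoc j i k ⟩
  j + (i + k) ∎
  where
  open ≡-Reasoning
  i = if x <ᵇ z then 1 else 0
  j = if y <ᵇ z then 1 else 0
  k = ltCount z b
ltCount-swap z (v ∷ a) x y b = cong (_ +_) (ltCount-swap z a x y b)

sgn-∷ : ∀ x w → sgn (x ∷ w) ≡ sign (ltCount x w) ℤ.* sgn w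
sgn-∷ x w = sign-+ (ltCount x w) (inversions w)

<ᵇ-≢ : ∀ x y → x ≢ y → ((x <ᵇ y) ≡ true × (y <ᵇ x) ≡ false) ⊎ ((x <ᵇ y) ≡ false × (y <ᵇ x) ≡ true)
<ᵇ-≢ zero    zero    x≢y = contradiction refl x≢y
<ᵇ-≢ zero    (suc y) _   = inj₁ (refl , refl)
<ᵇ-≢ (suc x) zero    _   = inj₂ (refl , refl)
<ᵇ-≢ (suc x) (suc y) x≢y = <ᵇ-≢ x y (x≢y ∘ cong suc)

sgn-swap : ∀ a x y b → x ≢ y → sgn (a ++ x ∷ y ∷ b) ≡ ℤ.- sgn (a ++ y ∷ x ∷ b)
sgn-swap [] x y b x≢y with x <ᵇ y | y <ᵇ x | <ᵇ-≢ x y x≢y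
... | _ | _ | inj₁ (refl , refl) = trans (cong sign eq) (sym (ℤₚ.neg-involutive _))
  where
  eq : ltCount x b + (ltCount y b + inversions b) ≡ ltCount y b + (ltCount x b + inversions b)
  eq = trans (sym (+-assoc (ltCount x b) _ _)) (trans (cong (_+ inversions b) (+-comm (ltCount x b) _)) (+-assoc (ltCount y b) _ _))
... | _ | _ | inj₂ (refl , refl) = cong (ℤ.-_ ∘ sign) eq
  where
  eq : ltCount x b + (ltCount y b + inversions b) ≡ ltCount y b + (ltCount x b + inversions b)
  eq = trans (sym (+-assoc (ltCount x b) _ _)) (trans (cong (_+ inversions b) (+-comm (ltCount x b) _)) (+-assoc (ltCount y b) _ _))
sgn-swap (z ∷ a) x y b x≢y = begin
  sgn (z ∷ a ++ x ∷ y ∷ b)                                  ≡⟨ sgn-∷ z (a ++ x ∷ y ∷ b) ⟩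
  sign (ltCount z (a ++ x ∷ y ∷ b)) ℤ.* sgn (a ++ x ∷ y ∷ b)   ≡⟨ cong₂ ℤ._*_ (cong sign (ltCount-swap z a x y b)) (sgn-swap a x y b x≢y) ⟩
  sign (ltCount z (a ++ y ∷ x ∷ b)) ℤ.* ℤ.- sgn (a ++ y ∷ x ∷ b) ≡⟨ ℤₚ.neg-distribʳ-* (sign (ltCount z (a ++ y ∷ x ∷ b))) _ ⟨
  ℤ.- (sign (ltCount z (a ++ y ∷ x ∷ b)) ℤ.* sgn (a ++ y ∷ x ∷ b)) ≡⟨ cong ℤ.-_ (sgn-∷ z (a ++ y ∷ x ∷ b)) ⟨
  ℤ.- sgn (z ∷ a ++ y ∷ x ∷ b)                              ∎
  where open ≡-Reasoning

sgn-move : ∀ a x b e → All (x ≢_) b → sgn (a ++ x ∷ b ++ e) ≡ sign (length b) ℤ.* sgn (a ++ b ++ x ∷ e)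
sgn-move a x []      e _ = sym (ℤₚ.*-identityˡ _)
sgn-move a x (y ∷ b) e (x≢y ∷ x≢b) = begin
  sgn (a ++ x ∷ y ∷ b ++ e)                              ≡⟨ sgn-swap a x y (b ++ e) x≢y ⟩
  ℤ.- sgn (a ++ y ∷ x ∷ b ++ e)                          ≡⟨ cong (ℤ.-_ ∘ sgn) (++-assoc a [ y ] (x ∷ b ++ e)) ⟨
  ℤ.- sgn ((a ++ [ y ]) ++ x ∷ b ++ e)                   ≡⟨ cong ℤ.-_ (sgn-move (a ++ [ y ]) x b e x≢b) ⟩
  ℤ.- (sign (length b) ℤ.* sgn ((a ++ [ y ]) ++ b ++ x ∷ e)) ≡⟨ ℤₚ.neg-distribˡ-* (sign (length b)) _ ⟩
  sign (length (y ∷ b)) ℤ.* sgn ((a ++ [ y ]) ++ b ++ x ∷ e) ≡⟨ cong (λ w → sign (length (y ∷ b)) ℤ.* sgn w) (++-assoc a [ y ] (b ++ x ∷ e)) ⟩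
  sign (length (y ∷ b)) ℤ.* sgn (a ++ y ∷ b ++ x ∷ e)       ∎
  where open ≡-Reasoning

sgn-exchange : ∀ a p q e → All (λ x → All (x ≢_) q) p →
               sgn (a ++ p ++ q ++ e) ≡ sign (length p * length q) ℤ.* sgn (a ++ q ++ p ++ e)
sgn-exchange a []      q e _ = sym (ℤₚ.*-identityˡ _)
sgn-exchange a (x ∷ p) q e (r ∷ rs) = begin
  sgn (a ++ x ∷ p ++ q ++ e)                   ≡⟨ cong sgn (++-assoc a [ x ] (p ++ q ++ e)) ⟨
  sgn ((a ++ [ x ]) ++ p ++ q ++ e)            ≡⟨ sgn-exchange (a ++ [ x ]) p q e rs ⟩
  k ℤ.* sgn ((a ++ [ x ]) ++ q ++ p ++ e)      ≡⟨ cong (λ w → k ℤ.* sgn w) (++-assoc a [ x ] (q ++ p ++ e)) ⟩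
  k ℤ.* sgn (a ++ x ∷ q ++ p ++ e)             ≡⟨ cong (k ℤ.*_) (sgn-move a x q (p ++ e) r) ⟩
  k ℤ.* (sign (length q) ℤ.* s)                   ≡⟨ ℤₚ.*-assoc k (sign (length q)) s ⟨
  k ℤ.* sign (length q) ℤ.* s                     ≡⟨ cong (ℤ._* s) (ℤₚ.*-comm k (sign (length q))) ⟩
  sign (length q) ℤ.* k ℤ.* s                     ≡⟨ cong (ℤ._* s) (sign-+ (length q) (length p * length q)) ⟨
  sign (length q + length p * length q) ℤ.* s     ∎
  where
  open ≡-Reasoning
  k = sign (length p * length q)
  s = sgn (a ++ q ++ x ∷ p ++ e)

-- A cut of a word of odd length leaves one piece of even length, so exchanging the pieces takes an
-- even number of adjacent swaps.
sgn-rot : ∀ a e {u v} → Rot u v → Unique u → sign (length u) ≡ -1ℤ → sgn (a ++ u ++ e) ≡ sgn (a ++ v ++ e)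
sgn-rot a e (p , q , refl , refl) un odd = begin
  sgn (a ++ (p ++ q) ++ e)  ≡⟨ cong (λ w → sgn (a ++ w)) (++-assoc p q e) ⟩
  sgn (a ++ p ++ q ++ e)    ≡⟨ sgn-exchange a p q e (++-Unique⁻ p un) ⟩
  sign (length p * length q) ℤ.* sgn (a ++ q ++ p ++ e)
    ≡⟨ cong (ℤ._* sgn (a ++ q ++ p ++ e)) (sign-*-odd-sum (length p) (length q) (trans (cong sign (sym (length-++ p))) odd)) ⟩
  1ℤ ℤ.* sgn (a ++ q ++ p ++ e) ≡⟨ ℤₚ.*-identityˡ _ ⟩
  sgn (a ++ q ++ p ++ e)    ≡⟨ cong (λ w → sgn (a ++ w)) (++-assoc q p e) ⟨
  sgn (a ++ (q ++ p) ++ e)  ∎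
  where open ≡-Reasoning

-- Move x next to y, swap the two, and move y back.
sgn-transpose : ∀ a x b y e → Unique (x ∷ b ++ [ y ]) → sgn (a ++ x ∷ b ++ y ∷ e) ≡ ℤ.- sgn (a ++ y ∷ b ++ x ∷ e)
sgn-transpose a x b y e (r ∷ rs) = begin
  sgn (a ++ x ∷ b ++ y ∷ e)                   ≡⟨ sgn-move a x b (y ∷ e) (Allₚ.++⁻ˡ b r) ⟩
  k ℤ.* sgn (a ++ b ++ x ∷ y ∷ e)             ≡⟨ cong (λ w → k ℤ.* sgn w) (++-assoc a b _) ⟨
  k ℤ.* sgn ((a ++ b) ++ x ∷ y ∷ e)           ≡⟨ cong (k ℤ.*_) (sgn-swap (a ++ b) x y e (All.lookup (Allₚ.++⁻ʳ b r) (here refl))) ⟩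
  k ℤ.* ℤ.- sgn ((a ++ b) ++ y ∷ x ∷ e)       ≡⟨ ℤₚ.neg-distribʳ-* k _ ⟨
  ℤ.- (k ℤ.* sgn ((a ++ b) ++ y ∷ x ∷ e))     ≡⟨ cong (λ w → ℤ.- (k ℤ.* sgn w)) (++-assoc a b _) ⟩
  ℤ.- (k ℤ.* sgn (a ++ b ++ y ∷ x ∷ e))       ≡⟨ cong ℤ.-_ (sgn-move a y b (x ∷ e) y≢b) ⟨
  ℤ.- sgn (a ++ y ∷ b ++ x ∷ e)               ∎
  where
  open ≡-Reasoning
  k = sign (length b)
  y≢b : All (y ≢_) b
  y≢b = All.map (λ { (z≢y ∷ []) → z≢y ∘ sym }) (++-Unique⁻ b rs)

sgn-sorted : ∀ s → Sorted s → sgn s ≡ 1ℤ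
sgn-sorted [] _ = refl
sgn-sorted (x ∷ s) (r ∷ rs) = trans (cong (λ k → sign (k + inversions s)) (no-smaller s r)) (sgn-sorted s rs)
  where
  no-smaller : ∀ s → All (x <_) s → ltCount x s ≡ 0
  no-smaller []      _ = refl
  no-smaller (y ∷ s) (x<y ∷ r) with <ᵇ-≢ x y (<⇒≢ x<y)
  ... | inj₁ (_ , e) = trans (cong (λ b → (if b then 1 else 0) + ltCount x s) e) (no-smaller s r)
  ... | inj₂ (e , _) with trans (sym e) (T⇒≡true (<⇒<ᵇ x<y))
    where
    T⇒≡true : ∀ {b} → Bool.T b → b ≡ true
    T⇒≡true {true} _ = refl
  ...   | ()

-- Rotating cyclically increasing windows

rot1 : ∀ {A : Set} (x : A) xs → Rot (x ∷ xs) (xs ++ [ x ])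
rot1 x xs = [ x ] , xs , refl , refl

⊆-++ˡ : ∀ {A : Set} (xs ys : List A) → xs ⊆ xs ++ ys
⊆-++ˡ xs ys = HSub.++ʳ ys ⊆-refl

⊆-++ʳ : ∀ {A : Set} (xs ys : List A) → ys ⊆ xs ++ ys
⊆-++ʳ xs ys = HSub.++ˡ xs ⊆-refl

Unique-⊆ : ∀ {A : Set} {xs ys : List A} → xs ⊆ ys → Unique ys → Unique xs
Unique-⊆ = AllPairs-⊆

Unique-∉ : ∀ {A : Set} {x : A} {xs} → Unique (x ∷ xs) → x ∉ xs
Unique-∉ (r ∷ _) x∈ = All.lookup r x∈ refl

length-∷ʳ : ∀ {A : Set} (xs : List A) x → length (xs ++ [ x ]) ≡ suc (length xs)
length-∷ʳ xs x = trans (length-++ xs) (+-comm (length xs) 1)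

module Windows (d : ℕ) where

  c : ℕ
  c = suc (suc d)

  -- In contrast to `Move`, no alphabet is fixed, so the relation also makes sense on prefixes and
  -- suffixes of a permutation, where the induction needs it.
  Step : List ℕ → List ℕ → Set
  Step w w′ = ∃₂ λ a b → ∃₂ λ u v →
    w ≡ a ++ u ++ b × w′ ≡ a ++ v ++ b × length u ≡ c × CI u × Rot u v

  infix 4 _≈_
  _≈_ : List ℕ → List ℕ → Set
  _≈_ = EqClosure Step

  module ≈-Reasoning = SetoidReasoning (EqC.setoid Step)

  ≈-trans : ∀ {w₁ w₂ w₃} → w₁ ≈ w₂ → w₂ ≈ w₃ → w₁ ≈ w₃
  ≈-trans = EqC.transitive Step

  ≈-sym : ∀ {w₁ w₂} → w₁ ≈ w₂ → w₂ ≈ w₁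
  ≈-sym = EqC.symmetric Step

  ≈-reflexive : ∀ {w₁ w₂} → w₁ ≡ w₂ → w₁ ≈ w₂
  ≈-reflexive refl = EqC.reflexive Step

  NA : List ℕ → Set
  NA w = ∃₂ λ a b → ∃ λ u → w ≡ a ++ u ++ b × length u ≡ c × CI u

  ≈-++ˡ : ∀ a {w w′} → w ≈ w′ → a ++ w ≈ a ++ w′
  ≈-++ˡ a = EqC.gmap (a ++_) λ { (a′ , b , u , v , refl , refl , p) →
    a ++ a′ , b , u , v , sym (++-assoc a a′ _) , sym (++-assoc a a′ _) , p }

  ≈-++ʳ : ∀ b {w w′} → w ≈ w′ → w ++ b ≈ w′ ++ b
  ≈-++ʳ b = EqC.gmap (_++ b) λ { (a , b′ , u , v , refl , refl , p) →
    a , b′ ++ b , u , v , assoc₃ a u b′ , assoc₃ a v b′ , p }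
    where
    assoc₃ : ∀ x y z → (x ++ y ++ z) ++ b ≡ x ++ y ++ z ++ b
    assoc₃ x y z = trans (++-assoc x (y ++ z) b) (cong (x ++_) (++-assoc y z b))

  ≈-window : ∀ {u v} → length u ≡ c → CI u → Rot u v → u ≈ v
  ≈-window {u} {v} len ci r =
    EqC.return ([] , [] , u , v , sym (++-identityʳ u) , sym (++-identityʳ v) , len , ci , r)

  -- The permutation accompanies the sign because transitivity needs distinct letters in the
  -- intermediate word.
  ≈⇒↭×sgn : sign c ≡ -1ℤ → ∀ {w w′} → w ≈ w′ → w ↭ w′ × (Unique w → sgn w ≡ sgn w′)
  ≈⇒↭×sgn odd = EqC.fold eqv λ { (a , b , u , v , refl , refl , len , ci , r) →
      Permₚ.++⁺ˡ a (Permₚ.++⁺ʳ b (rot-↭ r)) ,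
      λ un → sgn-rot a b r
               (Unique-⊆ (HSub.++ˡ a (HSub.++ʳ b ⊆-refl)) un) (trans (cong sign len) odd) }
    where
    eqv : IsEquivalence (λ w w′ → w ↭ w′ × (Unique w → sgn w ≡ sgn w′))
    eqv = record
      { refl  = ↭-refl , λ _ → refl
      ; sym   = λ (σ , f) → ↭-sym σ , λ un → sym (f (Unique-↭ (↭-sym σ) un))
      ; trans = λ (σ , f) (τ , g) → ↭-trans σ τ , λ un → trans (f un) (g (Unique-↭ σ un))
      }

  ≈⇒↭ : ∀ {w w′} → w ≈ w′ → w ↭ w′
  ≈⇒↭ = EqC.fold (record { refl = ↭-refl ; sym = ↭-sym ; trans = ↭-trans })
    λ { (a , b , u , v , refl , refl , len , ci , r) → Permₚ.++⁺ˡ a (Permₚ.++⁺ʳ b (rot-↭ r)) }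

  ≈-length : ∀ {w w′} → w ≈ w′ → length w ≡ length w′
  ≈-length = Permₚ.↭-length ∘ ≈⇒↭

  NA-∷ : ∀ x {w} → NA w → NA (x ∷ w)
  NA-∷ x (a , b , u , refl , p) = x ∷ a , b , u , refl , p

  NA-∷ʳ : ∀ x {w} → NA w → NA (w ++ [ x ])
  NA-∷ʳ x (a , b , u , refl , p) =
    a , b ++ [ x ] , u , trans (++-assoc a (u ++ b) _) (cong (a ++_) (++-assoc u b _)) , p

  NA-sorted : ∀ {s} → Sorted s → c ≤ length s → NA s
  NA-sorted {s} ss c≤ = [] , drop c s , take c s , sym (take++drop≡id c s) ,
    trans (length-take c s) (m≤n⇒m⊓n≡m c≤) ,
    CI-⊆ (subst (take c s ⊆_) (take++drop≡id c s) (⊆-++ˡ (take c s) (drop c s))) (s , ss , rot-refl)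

  -- Only a window at the very front is in the way. It is rotated until the next letter `y` can be
  -- appended; dropping its first letter then leaves a window one place further right.
  slideˡ : ∀ {w} → NA w → suc c ≤ length w → Unique w → ∃₂ λ f w′ → w ≈ f ∷ w′ × NA w′
  slideˡ (x ∷ a , b , u , refl , p) _ _ = x , a ++ u ++ b , ≈-reflexive refl , (a , b , u , refl , p)
  slideˡ ([] , [] , u , refl , len , _) c< _ =
    contradiction (trans (cong length (++-identityʳ u)) len) (>⇒≢ c<)
  slideˡ ([] , y ∷ b , u , refl , len , ci) _ un
    with CI-insertʳ {x = y} ci (Unique-∉ (Unique-⊆ (refl ∷ ⊆-++ˡ u b) (Unique-↭ (Permₚ.shift y u b) un)))
  ... | [] , r , _ = contradiction (trans (sym len) (Permₚ.↭-length (rot-↭ r))) λ ()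
  ... | f ∷ v , r , ci′ = f , v ++ y ∷ b , ≈-++ʳ (y ∷ b) (≈-window len ci r) ,
        [] , b , v ++ [ y ] , sym (++-assoc v [ y ] b) ,
        trans (length-∷ʳ v y) (trans (sym (Permₚ.↭-length (rot-↭ r))) len) , CI-⊆ (f ∷ʳ ⊆-refl) ci′

  slideʳ : ∀ {w} → NA w → suc c ≤ length w → Unique w → ∃₂ λ w′ z → w ≈ w′ ++ [ z ] × NA w′
  slideʳ (a , b , u , eq , p) c< un with initLast b
  slideʳ (a , _ , u , refl , p) c< un | b ∷ʳ′ z =
    a ++ u ++ b , z ,
    ≈-reflexive (sym (trans (++-assoc a (u ++ b) _) (cong (a ++_) (++-assoc u b _)))) , a , b , u , refl , p
  slideʳ (a , _ , u , eq , p) c< un | [] with initLast a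
  slideʳ (_ , _ , u , refl , len , _) c< _ | [] | [] =
    contradiction (trans (cong length (++-identityʳ u)) len) (>⇒≢ c<)
  slideʳ (_ , _ , u , refl , len , ci) _ un | [] | a ∷ʳ′ y
    with CI-insertˡ {x = y} ci (Unique-∉ (Unique-⊆ (HSub.++⁺ (⊆-++ʳ a [ y ]) (⊆-++ˡ u [])) un))
  ... | v , r , ci′ with initLast v
  ...   | [] = contradiction (trans (sym len) (Permₚ.↭-length (rot-↭ r))) λ ()
  ...   | v′ ∷ʳ′ z =
          a ++ y ∷ v′ , z ,
          (begin
            (a ++ [ y ]) ++ u ++ []         ≡⟨ ++-assoc a [ y ] _ ⟩
            a ++ y ∷ u ++ []                ≡⟨ cong (λ t → a ++ y ∷ t) (++-identityʳ u) ⟩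
            a ++ y ∷ u                      ≈⟨ ≈-++ˡ a (≈-++ˡ [ y ] (≈-window len ci r)) ⟩
            a ++ y ∷ v′ ++ [ z ]            ≡⟨ ++-assoc a (y ∷ v′) _ ⟨
            (a ++ y ∷ v′) ++ [ z ]          ∎) ,
          a , [] , y ∷ v′ , cong (a ++_) (sym (++-identityʳ (y ∷ v′))) ,
          trans (sym (length-∷ʳ v′ z)) (trans (sym (Permₚ.↭-length (rot-↭ r))) len) ,
          CI-⊆ (refl ∷ ⊆-++ˡ v′ [ z ]) ci′
    where open ≈-Reasoning

  -- Words of length c + 1

  rot² : ∀ x y X → CI (x ∷ y ∷ X) → length X ≡ suc d → x ∷ y ∷ X ≈ X ++ x ∷ y ∷ []
  rot² x y X ci len = begin
    x ∷ y ∷ X              ≈⟨ ≈-++ˡ [ x ] (≈-window (cong suc len) (CI-⊆ (x ∷ʳ ⊆-refl) ci) (rot1 y X)) ⟩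
    (x ∷ X) ++ [ y ]       ≈⟨ ≈-++ʳ [ y ] (≈-window (cong suc len) (CI-⊆ (refl ∷ y ∷ʳ ⊆-refl) ci) (rot1 x X)) ⟩
    (X ++ [ x ]) ++ [ y ]  ≡⟨ ++-assoc X [ x ] [ y ] ⟩
    X ++ x ∷ y ∷ []        ∎
    where open ≈-Reasoning

  -- Letters of `p` cross `q` in pairs. If `p` has odd length, one letter is left over, and the word
  -- reached is the target rotated by one place more.
  rot-two-classes : ∀ p q → CI (p ++ q) → length (p ++ q) ≡ suc c →
    (p ++ q ≈ q ++ p) ⊎ (∃₂ λ z Z → q ++ p ≡ z ∷ Z × p ++ q ≈ Z ++ [ z ])
  rot-two-classes [] q _ _ = inj₁ (≈-reflexive (sym (++-identityʳ q)))
  rot-two-classes (x ∷ []) (y ∷ q) ci len = inj₂ (y , q ++ [ x ] , refl , (begin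
    x ∷ y ∷ q             ≈⟨ rot² x y q ci (suc-injective (suc-injective len)) ⟩
    q ++ x ∷ y ∷ []       ≡⟨ ++-assoc q [ x ] [ y ] ⟨
    (q ++ [ x ]) ++ [ y ] ∎))
    where open ≈-Reasoning
  rot-two-classes (x ∷ y ∷ p) q ci len
    with rot-two-classes p (q ++ x ∷ y ∷ [])
           (subst CI (++-assoc p q _) (CI-rot ci (x ∷ y ∷ [] , p ++ q , refl , refl)))
           (trans (cong length (sym (++-assoc p q _))) (trans (length-++ (p ++ q)) (trans (+-comm (length (p ++ q)) 2) len)))
       | ≈-trans (rot² x y (p ++ q) ci (suc-injective (suc-injective len))) (≈-reflexive (++-assoc p q _))
  ... | inj₁ e | s = inj₁ (≈-trans s (≈-trans e (≈-reflexive (++-assoc q _ p))))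
  ... | inj₂ (z , Z , eq , e) | s = inj₂ (z , Z , trans (sym (++-assoc q _ p)) eq , ≈-trans s e)

  -- Words of length c + 2

  -- `rot²` applies to the first and to the last c + 1 letters. In between, a move brings the pair
  -- `x`, `y` back to the left, so that the second application carries it past `t` as well.
  rot²′ : ∀ x y X → CI (x ∷ y ∷ X) → length X ≡ c → x ∷ y ∷ X ≈ X ++ x ∷ y ∷ []
  rot²′ x y (z ∷ X) ci len with initLast X
  rot²′ x y (z ∷ .[]) ci () | []
  rot²′ x y (z ∷ .(R ++ [ t ])) ci len | R ∷ʳ′ t = begin
    (x ∷ y ∷ z ∷ R) ++ [ t ]         ≈⟨ ≈-++ʳ [ t ] (rot² x y (z ∷ R) (CI-⊆ (⊆-++ˡ (x ∷ y ∷ z ∷ R) [ t ]) ci) (cong suc lenR)) ⟩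
    z ∷ (R ++ x ∷ y ∷ []) ++ [ t ]   ≈⟨ ≈-++ˡ [ z ] (≈-++ʳ [ t ] (≈-sym (≈-window (cong (suc ∘ suc) lenR) ciR (x ∷ y ∷ [] , R , refl , refl)))) ⟩
    z ∷ x ∷ y ∷ R ++ [ t ]           ≈⟨ ≈-++ˡ [ z ] (rot² x y (R ++ [ t ])
                                          (CI-⊆ (refl ∷ refl ∷ z ∷ʳ ⊆-refl) ci) (trans (length-∷ʳ R t) (cong suc lenR))) ⟩
    z ∷ (R ++ [ t ]) ++ x ∷ y ∷ []   ∎
    where
    open ≈-Reasoning
    lenR : length R ≡ d
    lenR = suc-injective (suc-injective (trans (cong suc (sym (length-∷ʳ R t))) len))
    ciR : CI (x ∷ y ∷ R)
    ciR = CI-⊆ (refl ∷ refl ∷ z ∷ʳ ⊆-++ˡ R [ t ]) ci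

  -- The representative of the other sign: in length c + 2 the second letter passes the c letters
  -- after it, an odd number.
  twist : List ℕ → List ℕ
  twist (x ∷ y ∷ X) = x ∷ X ++ [ y ]
  twist X           = X

  -- The scheme of `rot²′` read from the other end: `rot²` on the last c + 1 letters, a move on the
  -- middle window, `rot²` on the first c + 1 letters.
  twist-rot² : ∀ x y X → CI (x ∷ y ∷ X) → length X ≡ c → twist (x ∷ y ∷ X) ≈ twist (X ++ x ∷ y ∷ [])
  twist-rot² x₀ x₁ (x₂ ∷ x₃ ∷ R) ci len = begin
    x₀ ∷ x₂ ∷ x₃ ∷ R ++ [ x₁ ]               ≈⟨ ≈-++ˡ [ x₀ ] (rot² x₂ x₃ (R ++ [ x₁ ]) ci₁ (trans (length-∷ʳ R x₁) (cong suc lenR))) ⟩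
    x₀ ∷ (R ++ [ x₁ ]) ++ x₂ ∷ x₃ ∷ []       ≡⟨ cong (x₀ ∷_) (trans (++-assoc R _ _) (sym (++-assoc R (x₁ ∷ x₂ ∷ []) [ x₃ ]))) ⟩
    x₀ ∷ (R ++ x₁ ∷ x₂ ∷ []) ++ [ x₃ ]       ≈⟨ ≈-++ˡ [ x₀ ] (≈-++ʳ [ x₃ ] (≈-sym
                                                  (≈-window (cong (suc ∘ suc) lenR) (CI-⊆ (x₀ ∷ʳ ⊆-refl) ci₂) (x₁ ∷ x₂ ∷ [] , R , refl , refl)))) ⟩
    (x₀ ∷ x₁ ∷ x₂ ∷ R) ++ [ x₃ ]             ≈⟨ ≈-++ʳ [ x₃ ] (rot² x₀ x₁ (x₂ ∷ R) ci₂ (cong suc lenR)) ⟩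
    x₂ ∷ (R ++ x₀ ∷ x₁ ∷ []) ++ [ x₃ ]       ∎
    where
    open ≈-Reasoning
    lenR : length R ≡ d
    lenR = suc-injective (suc-injective len)
    ci₁ : CI (x₂ ∷ x₃ ∷ R ++ [ x₁ ])
    ci₁ = CI-rot (CI-⊆ (x₀ ∷ʳ ⊆-refl) ci) (rot1 x₁ (x₂ ∷ x₃ ∷ R))
    ci₂ : CI (x₀ ∷ x₁ ∷ x₂ ∷ R)
    ci₂ = CI-⊆ (refl ∷ refl ∷ refl ∷ x₃ ∷ʳ ⊆-refl) ci

  -- The length 2 + c is odd, so one piece of any cut has even length and crosses the other in
  -- pairs, forwards or backwards. The relation is left abstract to serve both `≈` and equivalence
  -- after `twist`.
  module OddRotations
    {_~_ : List ℕ → List ℕ → Set} (eqv : IsEquivalence _~_)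
    (~-rot² : ∀ x y X → CI (x ∷ y ∷ X) → length X ≡ c → (x ∷ y ∷ X) ~ (X ++ x ∷ y ∷ []))
    (odd : sign c ≡ -1ℤ) where

    open IsEquivalence eqv using () renaming (refl to ~-refl; sym to ~-sym; trans to ~-trans)

    ~-rot-even : ∀ p q → sign (length p) ≡ 1ℤ → CI (p ++ q) → length (p ++ q) ≡ 2 + c → (p ++ q) ~ (q ++ p)
    ~-rot-even [] q _ _ _ = subst (q ~_) (sym (++-identityʳ q)) ~-refl
    ~-rot-even (x ∷ []) q () _ _
    ~-rot-even (x ∷ y ∷ p) q even ci len = ~-trans
      (~-rot² x y (p ++ q) ci (suc-injective (suc-injective len)))
      (subst₂ _~_ (sym (++-assoc p q _)) (++-assoc q _ p)
        (~-rot-even p (q ++ x ∷ y ∷ []) (trans (sym (ℤₚ.neg-involutive _)) even)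
          (subst CI (++-assoc p q _) (CI-rot ci (x ∷ y ∷ [] , p ++ q , refl , refl)))
          (trans (cong length (sym (++-assoc p q _))) (trans (length-++ (p ++ q)) (trans (+-comm (length (p ++ q)) 2) len)))))

    ~-rot : ∀ {X Z} → Rot X Z → CI X → length X ≡ 2 + c → X ~ Z
    ~-rot r@(p , q , refl , refl) ci len with sign-dichotomy (length p) | sign-dichotomy (length q)
    ... | inj₁ e | _      = ~-rot-even p q e ci len
    ... | inj₂ _ | inj₁ e = ~-sym (~-rot-even q p e (CI-rot ci r) (trans (Permₚ.↭-length (rot-↭ (rot-sym r))) len))
    ... | inj₂ e | inj₂ f with trans (sym (trans (cong sign len) (trans (ℤₚ.neg-involutive _) odd)))
                                 (trans (cong sign (length-++ p)) (trans (sign-+ (length p) (length q)) (cong₂ ℤ._*_ e f)))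
    ...   | ()

  -- Canonical representatives

  -- For a sorted word of length e + (2 + c) the twist is confined to the last c + 2 letters, so the
  -- first e letters stay in place and can be peeled off one by one.
  canon : Bool → ℕ → List ℕ → List ℕ
  canon false _       L       = L
  canon true  zero    L       = twist L
  canon true  (suc e) []      = []
  canon true  (suc e) (l ∷ L) = l ∷ canon true e L

  canon-suc : ∀ j e l L → l ∷ canon j e L ≡ canon j (suc e) (l ∷ L)
  canon-suc false e l L = refl
  canon-suc true  e l L = refl

  -- Whichever representative the induction hypothesis yields, the least letter is in front and a
  -- window survives behind it, so that the hypothesis can be applied again to what follows.
  canon-∷ : ∀ j e l L → Sorted (l ∷ L) → length (l ∷ L) ≡ e + (2 + c) →
            ∃ λ w → canon j e (l ∷ L) ≡ l ∷ w × NA w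
  canon-∷ false e l L (_ ∷ ss) len = L , refl , NA-sorted ss
    (≤-pred (≤-trans (n≤1+n _) (≤-trans (m≤n+m (2 + c) e) (≤-reflexive (sym len)))))
  canon-∷ true zero l (y ∷ X) (_ ∷ _ ∷ ss) len =
    X ++ [ y ] , refl , NA-∷ʳ y (NA-sorted ss (≤-reflexive (sym (suc-injective (suc-injective len)))))
  canon-∷ true (suc e) l [] _ len = contradiction (suc-injective len) λ e′ → 1+n≢0 (trans (sym (+-suc e _)) (sym e′))
  canon-∷ true (suc e) l (l′ ∷ L) (_ ∷ ss) len with canon-∷ true e l′ L ss (suc-injective len)
  ... | w , eq , na = canon true e (l′ ∷ L) , refl , subst NA (sym eq) (NA-∷ l′ na)

  sgn-canon : sign c ≡ -1ℤ → ∀ e a L → Unique L → length L ≡ e + (2 + c) → sgn (a ++ canon true e L) ≡ ℤ.- sgn (a ++ L)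
  sgn-canon odd zero a (x ∷ y ∷ X) (_ ∷ r ∷ _) len = sym (begin
    ℤ.- sgn (a ++ x ∷ y ∷ X)                     ≡⟨ cong (ℤ.-_ ∘ sgn) (++-assoc a [ x ] _) ⟨
    ℤ.- sgn ((a ++ [ x ]) ++ y ∷ X)              ≡⟨ cong (λ t → ℤ.- sgn ((a ++ [ x ]) ++ y ∷ t)) (++-identityʳ X) ⟨
    ℤ.- sgn ((a ++ [ x ]) ++ y ∷ X ++ [])        ≡⟨ cong ℤ.-_ (sgn-move (a ++ [ x ]) y X [] r) ⟩
    ℤ.- (sign (length X) ℤ.* s)                     ≡⟨ cong (λ k → ℤ.- (sign k ℤ.* s)) (suc-injective (suc-injective len)) ⟩
    ℤ.- (sign c ℤ.* s)                              ≡⟨ cong (λ k → ℤ.- (k ℤ.* s)) odd ⟩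
    ℤ.- (-1ℤ ℤ.* s)                              ≡⟨ cong ℤ.-_ (ℤₚ.-1*i≡-i s) ⟩
    ℤ.- (ℤ.- s)                                  ≡⟨ ℤₚ.neg-involutive s ⟩
    s                                            ≡⟨ cong sgn (++-assoc a [ x ] _) ⟩
    sgn (a ++ x ∷ X ++ [ y ])                    ∎)
    where
    open ≡-Reasoning
    s = sgn ((a ++ [ x ]) ++ X ++ [ y ])
  sgn-canon odd (suc e) a (l ∷ L) (_ ∷ un) len =
    subst₂ (λ u v → sgn u ≡ ℤ.- sgn v) (++-assoc a [ l ] _) (++-assoc a [ l ] _)
      (sgn-canon odd e (a ++ [ l ]) L un (suc-injective len))

  Reaches-canon : ℕ → Set
  Reaches-canon e = ∀ w L → NA w → Unique w → length w ≡ e + (2 + c) → Sorted L → L ↭ w →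
                    ∃ λ j → w ≈ canon j e L

  -- Free a first letter `f`, make the remaining c + 1 letters cyclically increasing, and look for
  -- the rotation of them that fits behind `f`. By parity either that rotation or the one a single
  -- place further is reached, and this decides between the sorted word and its twist.
  reaches-canon-zero : sign c ≡ -1ℤ → Reaches-canon 0
  reaches-canon-zero odd w L na un len sL σ
    with slideˡ na (≤-trans (n≤1+n _) (≤-reflexive (sym len))) un
  ... | f , w₁ , e₁ , na₁ = let
      un₁ = Unique-↭ (≈⇒↭ e₁) un
      len₁ = suc-injective (trans (sym (Permₚ.↭-length (≈⇒↭ e₁))) len)
      Y , eY , ciY = full w₁ na₁ (AllPairs.tail un₁) len₁
      Y′ , r , ci′ = CI-insertˡ ciY (Unique-∉ (Unique-↭ (prep f (≈⇒↭ eY)) un₁))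
    in finish Y Y′ (≈-trans e₁ (≈-++ˡ [ f ] eY)) ciY r ci′ (trans (Permₚ.↭-length (↭-sym (≈⇒↭ eY))) len₁)
    where
    full : ∀ w → NA w → Unique w → length w ≡ suc c → ∃ λ Y → w ≈ Y × CI Y
    full w na un len with slideˡ na (≤-reflexive (sym len)) un
    ... | f , w₁ , e , a , b , u , refl , lenu , ci with a | b
    ...   | x ∷ a | b = contradiction (trans (sym len) (Permₚ.↭-length (≈⇒↭ e)))
              (<⇒≢ (s≤s (s≤s (≤-trans (≤-reflexive (sym lenu)) (HSub.length-mono-≤ (HSub.++ˡ a (⊆-++ˡ u b)))))))
    ...   | [] | x ∷ b = contradiction (trans (sym len) (Permₚ.↭-length (≈⇒↭ e)))
              (<⇒≢ (s≤s (≤-trans (≤-reflexive (cong suc (sym lenu)))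
                (≤-trans (≤-reflexive (+-comm 1 (length u))) (≤-trans (+-monoʳ-≤ (length u) (s≤s z≤n)) (≤-reflexive (sym (length-++ u))))))))
    -- The window occupies all c letters behind `f`, so it can be rotated until `f` fits in front of
    -- it.
    ...   | [] | [] with CI-insertˡ ci (Unique-∉ (Unique-⊆ (refl ∷ ⊆-++ˡ u []) (Unique-↭ (≈⇒↭ e) un)))
    ...     | v , r , ci′ = f ∷ v , ≈-trans e (≈-++ˡ [ f ] (≈-trans (≈-reflexive (++-identityʳ u)) (≈-window lenu ci r))) , ci′

    sorted-rot : ∀ {X} → CI X → X ↭ w → Rot X L
    sorted-rot (s , ss , r) τ =
      subst (Rot _) (AllPairs-↭⇒≡ <-asym ss sL (↭-trans (rot-↭ r) (↭-trans τ (↭-sym σ)))) (rot-sym r)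

    open OddRotations

    finish : ∀ {f} Y Y′ → w ≈ f ∷ Y → CI Y → Rot Y Y′ → CI (f ∷ Y′) → length Y ≡ suc c → ∃ λ j → w ≈ canon j 0 L
    finish {f} .(p ++ q) .(q ++ p) e ciY r@(p , q , refl , refl) ci len′ with rot-two-classes p q ciY len′
    ... | inj₁ e′ = false , ≈-trans e₂ (~-rot (EqC.isEquivalence Step) rot²′ odd (sorted-rot ci (↭-sym (≈⇒↭ e₂))) ci
            (trans (Permₚ.↭-length (↭-sym (≈⇒↭ e₂))) len))
      where
      e₂ : w ≈ f ∷ q ++ p
      e₂ = ≈-trans e (≈-++ˡ [ f ] e′)
    -- The word reached, `f ∷ Z ++ [ z ]`, is `twist (f ∷ z ∷ Z)`.
    ... | inj₂ (z , Z , eq , e′) = true , ≈-trans (≈-trans e (≈-++ˡ [ f ] e′))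
            (~-rot {λ X Z → twist X ≈ twist Z} twist-eqv twist-rot² odd
              (sorted-rot (subst (λ t → CI (f ∷ t)) eq ci) τ) (subst (λ t → CI (f ∷ t)) eq ci)
              (trans (Permₚ.↭-length τ) len))
      where
      twist-eqv : IsEquivalence (λ X Z → twist X ≈ twist Z)
      twist-eqv = record { refl = EqC.reflexive Step ; sym = ≈-sym ; trans = ≈-trans }
      τ : f ∷ z ∷ Z ↭ w
      τ = subst (λ t → f ∷ t ↭ w) eq (↭-trans (prep f (rot-↭ (rot-sym r))) (↭-sym (≈⇒↭ e)))

  -- Bring some letter f to the front by the induction hypothesis applied to a suffix, then the
  -- least letter l to the front by applying it to a prefix, then sort what follows l.
  reaches-canon-suc : ∀ e → Reaches-canon e → Reaches-canon (suc e)
  reaches-canon-suc e IH w L na un len sL σ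
    with slideˡ na (≤-trans (n≤1+n _) (≤-trans (m≤n+m (2 + c) (suc e)) (≤-reflexive (sym len)))) un
  ... | f , w₁ , e₁ , na₁
    with ∈-∃++ (Permₚ.∈-resp-↭ (↭-sym (↭-trans σ (≈⇒↭ e₁))) (here refl))
  -- The freed letter is already the least one, so it remains to sort what follows.
  ... | [] , Q , refl =
    let j , e₂ = IH w₁ Q na₁ (AllPairs.tail (Unique-↭ (≈⇒↭ e₁) un))
                   (suc-injective (trans (≈-length (≈-sym e₁)) len)) (AllPairs.tail sL)
                   (Permₚ.drop-∷ (↭-trans σ (≈⇒↭ e₁)))
    in j , ≈-trans e₁ (≈-trans (≈-++ˡ [ f ] e₂) (≈-reflexive (canon-suc j e f Q)))
  ... | l ∷ P , Q , refl =
    let sL′ = AllPairs-⊆ (HSub.++⁺ (⊆-refl {x = l ∷ P}) (f ∷ʳ ⊆-refl)) sL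
        σ₁  = Permₚ.drop-mid (l ∷ P) [] (↭-trans σ (≈⇒↭ e₁))
        len₁ = suc-injective (trans (≈-length (≈-sym e₁)) len)
        j , e₂ = IH w₁ (l ∷ P ++ Q) na₁ (AllPairs.tail (Unique-↭ (≈⇒↭ e₁) un)) len₁ sL′ σ₁
        w₂ , eq₂ , na₂ = canon-∷ j e l (P ++ Q) sL′ (trans (Permₚ.↭-length σ₁) len₁)
        e₃ : w ≈ f ∷ l ∷ w₂
        e₃ = ≈-trans e₁ (≈-++ˡ [ f ] (≈-trans e₂ (≈-reflexive eq₂)))
        un₃ = Unique-↭ (≈⇒↭ e₃) un
        len₂ : length w₂ ≡ e + suc c
        len₂ = suc-injective (trans (suc-injective (trans (≈-length (≈-sym e₃)) len)) (+-suc e (suc c)))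
        -- The window is moved off the last letter `z`, so that the prefix without `z` is again a
        -- non-avoider.
        w₃ , z , e₄ , na₃ = slideʳ na₂ (≤-trans (m≤n+m (suc c) e) (≤-reflexive (sym len₂)))
                              (AllPairs.tail (AllPairs.tail un₃))
    in bring l P Q f w₃ z sL σ (≈-trans e₃ (≈-++ˡ (f ∷ l ∷ []) e₄)) na₃
    where
    bring : ∀ l P Q f w₃ z → Sorted (l ∷ P ++ f ∷ Q) → l ∷ P ++ f ∷ Q ↭ w → w ≈ f ∷ l ∷ w₃ ++ [ z ] → NA w₃ →
            ∃ λ j → w ≈ canon j (suc e) (l ∷ P ++ f ∷ Q)
    bring l P Q f w₃ z sL σ e₅ na₃
      with Permₚ.drop-mid [] [ f ] (↭-trans σ (≈⇒↭ e₅))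
    ... | τ with ∈-∃++ (Permₚ.∈-resp-↭ (↭-sym τ) (∈-++⁺ʳ (f ∷ w₃) (here refl)))
    ... | P₁ , Q₁ , eq =
      let L₁ = P ++ f ∷ Q
          sL₁ = subst (λ t → Sorted (l ∷ t)) eq sL
          sL₂ = AllPairs-⊆ (HSub.++⁺ (⊆-refl {x = l ∷ P₁}) (z ∷ʳ ⊆-refl)) sL₁
          un₅ = Unique-↭ (≈⇒↭ e₅) un
          len₅ : length (f ∷ l ∷ w₃) ≡ e + (2 + c)
          len₅ = suc-injective (trans (sym (length-∷ʳ (f ∷ l ∷ w₃) z)) (trans (≈-length (≈-sym e₅)) len))
          τ₁ : P₁ ++ Q₁ ↭ f ∷ w₃
          τ₁ = subst (P₁ ++ Q₁ ↭_) (++-identityʳ (f ∷ w₃)) (Permₚ.drop-mid P₁ (f ∷ w₃) (subst (_↭ f ∷ w₃ ++ [ z ]) eq τ))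
          τ₂ : l ∷ P₁ ++ Q₁ ↭ f ∷ l ∷ w₃
          τ₂ = ↭-trans (prep l τ₁) (↭-swap l f ↭-refl)
          j , e₆ = IH (f ∷ l ∷ w₃) (l ∷ P₁ ++ Q₁) (NA-∷ f (NA-∷ l na₃)) (Unique-⊆ (⊆-++ˡ (f ∷ l ∷ w₃) [ z ]) un₅) len₅ sL₂ τ₂
          w₄ , eq₄ , na₄ = canon-∷ j e l (P₁ ++ Q₁) sL₂ (trans (Permₚ.↭-length τ₂) len₅)
          e₇ : w ≈ l ∷ w₄ ++ [ z ]
          e₇ = ≈-trans e₅ (≈-++ʳ [ z ] (≈-trans e₆ (≈-reflexive eq₄)))
          j′ , e₈ = IH (w₄ ++ [ z ]) L₁ (NA-∷ʳ z na₄) (AllPairs.tail (Unique-↭ (≈⇒↭ e₇) un))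
                      (suc-injective (trans (≈-length (≈-sym e₇)) len)) (AllPairs.tail sL)
                      (Permₚ.drop-∷ (↭-trans σ (≈⇒↭ e₇)))
      in j′ , ≈-trans e₇ (≈-trans (≈-++ˡ [ l ] e₈) (≈-reflexive (canon-suc j′ e l L₁)))

  reaches-canon : sign c ≡ -1ℤ → ∀ e → Reaches-canon e
  reaches-canon odd zero    = reaches-canon-zero odd
  reaches-canon odd (suc e) = reaches-canon-suc e (reaches-canon odd e)

  -- The two representatives have opposite signs, so words of equal sign reach the same one.
  NA-connected : sign c ≡ -1ℤ → ∀ e L → Sorted L → length L ≡ e + (2 + c) → ∀ {w w′} →
                 NA w → NA w′ → L ↭ w → L ↭ w′ → sgn w ≡ sgn w′ → w ≈ w′
  NA-connected odd e L sL len {w} {w′} na na′ σ σ′ eq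
    with reaches-canon odd e w L na (Unique-↭ σ unL) (trans (Permₚ.↭-length (↭-sym σ)) len) sL σ
       | reaches-canon odd e w′ L na′ (Unique-↭ σ′ unL) (trans (Permₚ.↭-length (↭-sym σ′)) len) sL σ′
    where
    unL : Unique L
    unL = AllPairs.map <⇒≢ sL
  ... | j , e₁ | j′ , e₂ = go j j′ e₁ e₂
    where
    unL : Unique L
    unL = AllPairs.map <⇒≢ sL
    sgn-eq : ∀ {j j′} → w ≈ canon j e L → w′ ≈ canon j′ e L → sgn (canon j e L) ≡ sgn (canon j′ e L)
    sgn-eq e₁ e₂ = trans (sym (proj₂ (≈⇒↭×sgn odd e₁) (Unique-↭ σ unL)))
                     (trans eq (proj₂ (≈⇒↭×sgn odd e₂) (Unique-↭ σ′ unL)))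
    absurd : sgn (canon true e L) ≢ sgn L
    absurd p with trans (sym (cong ℤ.-_ (sgn-sorted L sL))) (trans (sym (sgn-canon odd e [] L unL len)) (trans p (sgn-sorted L sL)))
    ... | ()
    go : ∀ j j′ → w ≈ canon j e L → w′ ≈ canon j′ e L → w ≈ w′
    go false false e₁ e₂ = ≈-trans e₁ (≈-sym e₂)
    go true  true  e₁ e₂ = ≈-trans e₁ (≈-sym e₂)
    go false true  e₁ e₂ = contradiction (sym (sgn-eq {false} {true} e₁ e₂)) absurd
    go true  false e₁ e₂ = contradiction (sgn-eq {true} {false} e₁ e₂) absurd

-- Order permutations

≤ᵇ-true : ∀ {x y} → x ≤ y → (x ≤ᵇ y) ≡ true
≤ᵇ-true {x} {y} x≤y with x ≤ᵇ y | ≤⇒≤ᵇ x≤y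
... | true | _ = refl

≤ᵇ-false : ∀ {x y} → y < x → (x ≤ᵇ y) ≡ false
≤ᵇ-false {x} {y} y<x with x ≤ᵇ y in eq
... | false = refl
... | true  = contradiction (≤ᵇ⇒≤ x y (subst Bool.T (sym eq) _)) (<⇒≱ y<x)

countLe-≤ : ∀ {x y} → x ≤ y → ∀ u → countLe x u ≤ countLe y u
countLe-≤ x≤y [] = z≤n
countLe-≤ {x} {y} x≤y (z ∷ u) with z ≤ᵇ x in eq
... | false = ≤-trans (countLe-≤ x≤y u) (m≤n+m _ _)
... | true rewrite ≤ᵇ-true (≤-trans (≤ᵇ⇒≤ z x (subst Bool.T (sym eq) _)) x≤y) = s≤s (countLe-≤ x≤y u)

countLe-++ : ∀ x a b → countLe x (a ++ b) ≡ countLe x a + countLe x b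
countLe-++ x []      b = refl
countLe-++ x (y ∷ a) b = trans (cong (_ +_) (countLe-++ x a b)) (sym (+-assoc (if y ≤ᵇ x then 1 else 0) _ _))

countLe-rot : ∀ {u v} → Rot u v → ∀ x → countLe x u ≡ countLe x v
countLe-rot (p , q , refl , refl) x =
  trans (countLe-++ x p q) (trans (+-comm (countLe x p) _) (sym (countLe-++ x q p)))

countLe-all : ∀ {x} a → All (_≤ x) a → countLe x a ≡ length a
countLe-all []      _        = refl
countLe-all (y ∷ a) (p ∷ ps) rewrite ≤ᵇ-true p = cong suc (countLe-all a ps)

countLe-none : ∀ {x} a → All (x <_) a → countLe x a ≡ 0
countLe-none []      _        = refl
countLe-none (y ∷ a) (p ∷ ps) rewrite ≤ᵇ-false p = countLe-none a ps

applyUpTo-cong : ∀ {A : Set} {f g : ℕ → A} → (∀ i → f i ≡ g i) → ∀ n → applyUpTo f n ≡ applyUpTo g n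
applyUpTo-cong eq zero    = refl
applyUpTo-cong eq (suc n) = cong₂ _∷_ (eq 0) (applyUpTo-cong (eq ∘ suc) n)

-- The prefix `a` collects the letters already passed: they are exactly the smaller ones, so the
-- next rank is one more than their number.
ranks-sorted : ∀ a s → Sorted (a ++ s) →
  map (λ x → countLe x (a ++ s)) s ≡ applyUpTo (λ i → suc (length a + i)) (length s)
ranks-sorted a [] _ = refl
ranks-sorted a (x ∷ s) ss = cong₂ _∷_ rank-x (begin
  map (λ y → countLe y (a ++ x ∷ s)) s                        ≡⟨ map-cong (λ y → cong (countLe y) (++-assoc a [ x ] s)) s ⟨
  map (λ y → countLe y ((a ++ [ x ]) ++ s)) s                 ≡⟨ ranks-sorted (a ++ [ x ]) s (subst Sorted (sym (++-assoc a [ x ] s)) ss) ⟩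
  applyUpTo (λ i → suc (length (a ++ [ x ]) + i)) (length s)
    ≡⟨ applyUpTo-cong (λ i → cong suc (trans (cong (_+ i) (length-∷ʳ a x)) (sym (+-suc (length a) i)))) (length s) ⟩
  applyUpTo (λ i → suc (length a + suc i)) (length s)         ∎)
  where
  open ≡-Reasoning
  before : ∀ a → Sorted (a ++ x ∷ s) → All (_≤ x) a
  before []      _        = []
  before (y ∷ a) (r ∷ rs) = <⇒≤ (All.lookup (Allₚ.++⁻ʳ a r) (here refl)) ∷ before a rs
  after : ∀ a → Sorted (a ++ x ∷ s) → All (x <_) s
  after []      (r ∷ _)  = r
  after (y ∷ a) (_ ∷ rs) = after a rs
  rank-x : countLe x (a ++ x ∷ s) ≡ suc (length a + 0)
  rank-x = begin
    countLe x (a ++ x ∷ s)                ≡⟨ countLe-++ x a (x ∷ s) ⟩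
    countLe x a + countLe x (x ∷ s)       ≡⟨ cong₂ _+_ (countLe-all a (before a ss))
                                              (cong₂ _+_ (cong (λ b → if b then 1 else 0) (≤ᵇ-true (≤-refl {x}))) (countLe-none s (after a ss))) ⟩
    length a + 1                          ≡⟨ +-suc (length a) 0 ⟩
    suc (length a + 0)                    ∎

idWord-sorted : ∀ n → Sorted (idWord n)
idWord-sorted n = AllPairsₚ.applyUpTo⁺₁ suc n (λ i<j _ → s≤s i<j)

++-cancel-length : ∀ {A : Set} (p a : List A) {q b} → p ++ q ≡ a ++ b → length p ≡ length a → p ≡ a × q ≡ b
++-cancel-length []      []      eq _ = refl , eq
++-cancel-length (x ∷ p) (y ∷ a) eq l with ∷-injective eq
... | refl , eq′ with ++-cancel-length p a eq′ (suc-injective l)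
...   | refl , refl = refl , refl

map-++⁻ : ∀ {A B : Set} (f : A → B) u a {b} → map f u ≡ a ++ b →
          ∃₂ λ p q → u ≡ p ++ q × map f p ≡ a × map f q ≡ b
map-++⁻ f u       []      eq = [] , u , refl , refl , eq
map-++⁻ f (x ∷ u) (y ∷ a) eq with ∷-injective eq
... | refl , eq′ with map-++⁻ f u a eq′
...   | p , q , refl , refl , e = x ∷ p , q , refl , refl , e

-- The cut of the cyclic shift pulls back to a cut of `u`. Ranks grow weakly with the letter, so
-- strictly increasing ranks come from strictly increasing letters.
ordPerm∈M⇒CI : ∀ c u → ordPerm u ∈ M c → CI u
ordPerm∈M⇒CI c u m with ∈-map⁻ (cycShift c) m
... | k , _ , eq with map-++⁻ (λ x → countLe x u) u (drop k (idWord c)) eq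
...   | p , q , u≡ , e₁ , e₂ = q ++ p , AllPairs.map reflect (AllPairsₚ.map⁻ ranks) , q , p , refl , u≡
  where
  ranks : Sorted (map (λ x → countLe x u) (q ++ p))
  ranks = subst Sorted (sym (trans (map-++ _ q p) (trans (cong₂ _++_ e₂ e₁) (take++drop≡id k (idWord c))))) (idWord-sorted c)
  reflect : ∀ {x y} → countLe x u < countLe y u → x < y
  reflect lt = ≰⇒> λ y≤x → <⇒≱ lt (countLe-≤ y≤x u)

CI⇒ordPerm∈M : ∀ c u → 0 < c → length u ≡ c → CI u → ordPerm u ∈ M c
CI⇒ordPerm∈M c _ 0<c len (_ , ss , p , q , refl , refl) = go q refl
  where
  open ≡-Reasoning
  rank : ℕ → ℕ
  rank x = countLe x (q ++ p)
  ranks : map rank p ++ map rank q ≡ idWord c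
  ranks = begin
    map rank p ++ map rank q                   ≡⟨ map-++ rank p q ⟨
    map rank (p ++ q)                          ≡⟨ map-cong (countLe-rot (q , p , refl , refl)) (p ++ q) ⟩
    map (λ x → countLe x (p ++ q)) (p ++ q)    ≡⟨ ranks-sorted [] (p ++ q) ss ⟩
    idWord (length (p ++ q))                   ≡⟨ cong idWord (trans (Permₚ.↭-length (Permₚ.++-comm p q)) len) ⟩
    idWord c                                   ∎
  pieces : map rank p ≡ take (length p) (idWord c) × map rank q ≡ drop (length p) (idWord c)
  pieces = ++-cancel-length (map rank p) (take (length p) (idWord c)) (trans ranks (sym (take++drop≡id (length p) (idWord c))))
    (trans (length-map rank p) (sym (trans (length-take (length p) (idWord c))
      (m≤n⇒m⊓n≡m (≤-trans (m≤m+n (length p) (length q)) (≤-reflexive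
        (trans (sym (length-++ p)) (trans (Permₚ.↭-length (Permₚ.++-comm p q)) (trans len (sym (length-applyUpTo suc c)))))))))))
  go : ∀ q′ → q′ ≡ q → map rank (q ++ p) ∈ M c
  -- With `q` empty the cut would be at c, which `upTo c` excludes; the shift by 0 is the same word.
  go [] refl = subst (_∈ M c) eq (∈-map⁺ (cycShift c) (∈-upTo⁺ 0<c))
    where
    eq : cycShift c 0 ≡ map rank p
    eq = trans (++-identityʳ (idWord c)) (trans (sym ranks) (++-identityʳ (map rank p)))
  go (x ∷ q′) refl = subst (_∈ M c) eq (∈-map⁺ (cycShift c) (∈-upTo⁺ p<c))
    where
    p<c : length p < c
    p<c = ≤-trans (s≤s (m≤m+n (length p) (length q′))) (≤-reflexive
      (trans (sym (+-suc (length p) (length q′))) (trans (sym (length-++ p)) (trans (Permₚ.↭-length (Permₚ.++-comm p q)) len))))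
    eq : cycShift c (length p) ≡ map rank (q ++ p)
    eq = sym (trans (map-++ rank q p) (cong₂ _++_ (proj₂ pieces) (proj₁ pieces)))

-- The nontrivial classes

↭-cancelˡ : ∀ {A : Set} (a : List A) {u v} → a ++ u ↭ a ++ v → u ↭ v
↭-cancelˡ []      σ = σ
↭-cancelˡ (x ∷ a) σ = ↭-cancelˡ a (Permₚ.drop-∷ σ)

↭-cancelʳ : ∀ {A : Set} (b : List A) {u v} → u ++ b ↭ v ++ b → u ↭ v
↭-cancelʳ b {u} {v} σ = ↭-cancelˡ b (↭-trans (Permₚ.++-comm b u) (↭-trans σ (Permₚ.++-comm v b)))

-- A `Move` says of its two windows only that both are cyclic shifts up to order. As they hold the
-- same letters, they are rotations of one sorted word, which makes the move a `Step`.
CI-↭⇒Rot : ∀ {u v} → CI u → CI v → u ↭ v → Rot u v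
CI-↭⇒Rot (s , ss , r) (t , st , r′) σ =
  rot-trans (rot-sym r) (subst (λ z → Rot z _) (sym s≡t) r′)
  where
  s≡t : s ≡ t
  s≡t = AllPairs-↭⇒≡ <-asym ss st (↭-trans (rot-↭ r) (↭-trans σ (↭-sym (rot-↭ r′))))

IsPerm⇒Unique : ∀ {n w} → IsPerm n w → Unique w
IsPerm⇒Unique {n} σ = Unique-↭ (↭-sym σ) (AllPairs.map <⇒≢ (idWord-sorted n))

module Classes (d : ℕ) where
  open Windows d

  Move⇒Step : ∀ {n φ ψ} → Move c n φ ψ → Step φ ψ
  Move⇒Step (a , u , v , b , σ , τ , refl , refl , lu , lv , mu , mv) =
    a , b , u , v , refl , refl , lu , ordPerm∈M⇒CI c u mu ,
    CI-↭⇒Rot (ordPerm∈M⇒CI c u mu) (ordPerm∈M⇒CI c v mv) (↭-cancelʳ b (↭-cancelˡ a (↭-trans σ (↭-sym τ))))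

  Move⇒NA : ∀ {n φ ψ} → Move c n φ ψ → NA φ × NA ψ
  Move⇒NA (a , u , v , b , _ , _ , e , e′ , lu , lv , mu , mv) =
    (a , b , u , e , lu , ordPerm∈M⇒CI c u mu) , (a , b , v , e′ , lv , ordPerm∈M⇒CI c v mv)

  Step⇒Move : ∀ {n φ ψ} → IsPerm n φ → IsPerm n ψ → Step φ ψ → Move c n φ ψ
  Step⇒Move σ τ (a , b , u , v , e , e′ , len , ci , r) =
    a , u , v , b , σ , τ , e , e′ , len , lenv ,
    CI⇒ordPerm∈M c u (s≤s z≤n) len ci , CI⇒ordPerm∈M c v (s≤s z≤n) lenv (CI-rot ci r)
    where
    lenv : length v ≡ c
    lenv = trans (sym (Permₚ.↭-length (rot-↭ r))) len

  ≈⇒Equiv : ∀ {n φ ψ} → IsPerm n φ → φ ≈ ψ → Equiv c n φ ψ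
  ≈⇒Equiv σ ε = ε
  ≈⇒Equiv σ (fwd s ◅ ss) = fwd (Step⇒Move σ τ s) ◅ ≈⇒Equiv τ ss
    where τ = ↭-trans (↭-sym (≈⇒↭ (EqC.return s))) σ
  ≈⇒Equiv σ (bwd s ◅ ss) = bwd (Step⇒Move τ σ s) ◅ ≈⇒Equiv τ ss
    where τ = ↭-trans (≈⇒↭ (EqC.return s)) σ

  nontrivial⇒NA : ∀ {n φ ψ} → ψ ≢ φ → Equiv c n φ ψ → NA φ
  nontrivial⇒NA ψ≢φ ε = contradiction refl ψ≢φ
  nontrivial⇒NA _ (fwd m ◅ _) = proj₁ (Move⇒NA m)
  nontrivial⇒NA _ (bwd m ◅ _) = proj₂ (Move⇒NA m)

  Equiv-NA : ∀ {n φ ψ} → NA φ → Equiv c n φ ψ → NA ψ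
  Equiv-NA na ε = na
  Equiv-NA na (fwd m ◅ ms) = Equiv-NA (proj₂ (Move⇒NA m)) ms
  Equiv-NA na (bwd m ◅ ms) = Equiv-NA (proj₁ (Move⇒NA m)) ms

  class⁻ : sign c ≡ -1ℤ → ∀ {n φ ψ} → IsPerm n φ → NA φ → Equiv c n φ ψ → NA ψ × sgn ψ ≡ sgn φ
  class⁻ odd σ na eqv = Equiv-NA na eqv ,
    sym (proj₂ (≈⇒↭×sgn odd (EqC.map Move⇒Step eqv)) (IsPerm⇒Unique σ))

  class⁺ : sign c ≡ -1ℤ → ∀ e {φ ψ} → let n = e + (2 + c) in
    IsPerm n φ → IsPerm n ψ → NA φ → NA ψ → sgn ψ ≡ sgn φ → Equiv c n φ ψ
  class⁺ odd e σ τ na na′ eq = ≈⇒Equiv σ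
    (NA-connected odd e (idWord _) (idWord-sorted _) (length-applyUpTo suc _) na na′ (↭-sym σ) (↭-sym τ) (sym eq))

-- Signed sums

∑ : List A → (A → ℤ) → ℤ
∑ []       f = 0ℤ
∑ (x ∷ xs) f = f x ℤ.+ ∑ xs f

∑-++ : ∀ (xs ys : List A) f → ∑ (xs ++ ys) f ≡ ∑ xs f ℤ.+ ∑ ys f
∑-++ []       ys f = sym (ℤₚ.+-identityˡ _)
∑-++ (x ∷ xs) ys f = trans (cong (λ s → f x ℤ.+ s) (∑-++ xs ys f)) (sym (ℤₚ.+-assoc (f x) _ _))

∑-↭ : ∀ {xs ys : List A} f → xs ↭ ys → ∑ xs f ≡ ∑ ys f
∑-↭ f refl        = refl
∑-↭ f (prep x σ)  = cong (λ s → f x ℤ.+ s) (∑-↭ f σ)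
∑-↭ {ys = _ ∷ _ ∷ ys} f (swap x y σ) = begin
  f x ℤ.+ (f y ℤ.+ _)      ≡⟨ cong (λ s → f x ℤ.+ (f y ℤ.+ s)) (∑-↭ f σ) ⟩
  f x ℤ.+ (f y ℤ.+ ∑ ys f) ≡⟨ ℤₚ.+-assoc (f x) (f y) _ ⟨
  f x ℤ.+ f y ℤ.+ ∑ ys f   ≡⟨ cong (ℤ._+ ∑ ys f) (ℤₚ.+-comm (f x) (f y)) ⟩
  f y ℤ.+ f x ℤ.+ ∑ ys f   ≡⟨ ℤₚ.+-assoc (f y) (f x) _ ⟩
  f y ℤ.+ (f x ℤ.+ ∑ ys f) ∎
  where open ≡-Reasoning
∑-↭ f (_↭_.trans σ τ) = trans (∑-↭ f σ) (∑-↭ f τ)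

∑-cong : ∀ (xs : List A) {f g} → (∀ {x} → x ∈ xs → f x ≡ g x) → ∑ xs f ≡ ∑ xs g
∑-cong []       _  = refl
∑-cong (x ∷ xs) eq = cong₂ ℤ._+_ (eq (here refl)) (∑-cong xs (eq ∘ there))

∑-map : ∀ (h : A → B) xs f → ∑ (map h xs) f ≡ ∑ xs (f ∘ h)
∑-map h []       f = refl
∑-map h (x ∷ xs) f = cong (λ s → f (h x) ℤ.+ s) (∑-map h xs f)

∑-neg : ∀ (xs : List A) f → ∑ xs (λ x → ℤ.- f x) ≡ ℤ.- ∑ xs f
∑-neg []       f = refl
∑-neg (x ∷ xs) f = trans (cong (λ s → ℤ.- f x ℤ.+ s) (∑-neg xs f)) (sym (ℤₚ.neg-distrib-+ (f x) _))

∑-*ˡ : ∀ k (xs : List A) f → ∑ xs (λ x → k ℤ.* f x) ≡ k ℤ.* ∑ xs f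
∑-*ˡ k []       f = sym (ℤₚ.*-zeroʳ k)
∑-*ˡ k (x ∷ xs) f = trans (cong (λ s → k ℤ.* f x ℤ.+ s) (∑-*ˡ k xs f)) (sym (ℤₚ.*-distribˡ-+ k (f x) _))

∑-const : ∀ k (xs : List A) → ∑ xs (λ _ → k) ≡ ℤ.+ length xs ℤ.* k
∑-const k []       = sym (ℤₚ.*-zeroˡ k)
∑-const k (x ∷ xs) = trans (cong (λ s → k ℤ.+ s) (∑-const k xs)) (sym (ℤₚ.suc-* (ℤ.+ length xs) k))

Unique-map : ∀ (h : A → B) {xs} → (∀ {x y} → x ∈ xs → y ∈ xs → h x ≡ h y → x ≡ y) → Unique xs → Unique (map h xs)
Unique-map h {[]}     _   []       = []
Unique-map h {x ∷ xs} inj (r ∷ rs) =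
  Allₚ.map⁺ (All.tabulate λ y∈ eq → All.lookup r y∈ (inj (here refl) (there y∈) eq)) ∷
  Unique-map h (λ x∈ y∈ → inj (there x∈) (there y∈)) rs

pigeonhole : ∀ {xs ys : List A} → Unique xs → (∀ {x} → x ∈ xs → x ∈ ys) → length ys ≤ length xs → xs ↭ ys
pigeonhole {xs = []} {[]} _ _ _ = refl
pigeonhole {xs = x ∷ xs} (r ∷ rs) sub le with ∈-∃++ (sub (here refl))
... | a , b , refl = ↭-trans (prep x (pigeonhole rs sub′ le′)) (↭-sym (Permₚ.shift x a b))
  where
  le′ : length (a ++ b) ≤ length xs
  le′ = ≤-pred (≤-trans (≤-reflexive (sym (Permₚ.↭-length (Permₚ.shift x a b)))) le)
  sub′ : ∀ {y} → y ∈ xs → y ∈ a ++ b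
  sub′ y∈ with Permₚ.∈-resp-↭ (Permₚ.shift x a b) (sub (there y∈))
  ... | here refl = contradiction refl (All.lookup r y∈)
  ... | there y∈′ = y∈′

-- An injective self-map of a finite set permutes it, so the sum equals its own negative. The
-- hypothesis is injectivity because `valueShift`, applied twice, advances the marked value twice
-- instead of restoring it.
∑-vanish : ∀ {xs : List A} {f} (φ : A → A) → Unique xs → (∀ {x} → x ∈ xs → φ x ∈ xs) →
           (∀ {x y} → x ∈ xs → y ∈ xs → φ x ≡ φ y → x ≡ y) →
           (∀ {x} → x ∈ xs → f (φ x) ≡ ℤ.- f x) → ∑ xs f ≡ 0ℤ
∑-vanish {xs = xs} {f} φ un closed inj flip = i≡-i⇒i≡0 (begin
  ∑ xs f              ≡⟨ ∑-↭ f (pigeonhole (Unique-map φ inj un) into (≤-reflexive (sym (length-map φ xs)))) ⟨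
  ∑ (map φ xs) f      ≡⟨ ∑-map φ xs f ⟩
  ∑ xs (f ∘ φ)        ≡⟨ ∑-cong xs flip ⟩
  ∑ xs (ℤ.-_ ∘ f)     ≡⟨ ∑-neg xs f ⟩
  ℤ.- ∑ xs f          ∎)
  where
  open ≡-Reasoning
  i≡-i⇒i≡0 : ∀ {i} → i ≡ ℤ.- i → i ≡ 0ℤ
  i≡-i⇒i≡0 {ℤ.+ zero} _ = refl
  into : ∀ {y} → y ∈ map φ xs → y ∈ xs
  into y∈ with ∈-map⁻ φ y∈
  ... | x , x∈ , refl = closed x∈

-- [p ∨ q ∨ r] = [p ∨ q] + [r] − [q ∧ r] − [p ∧ ¬q ∧ r]
∑-sieve : ∀ {P Q R : Pred A 0ℓ} (P? : Decidable P) (Q? : Decidable Q) (R? : Decidable R) xs f →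
  (∀ {x} → x ∈ xs → P x ⊎ Q x ⊎ R x) →
  ∑ xs f ≡ ∑ (filter (λ x → P? x ⊎-dec Q? x) xs) f ℤ.+ ∑ (filter R? xs) f
         ℤ.- ∑ (filter (λ x → Q? x ×-dec R? x) xs) f
         ℤ.- ∑ (filter (λ x → P? x ×-dec ¬? (Q? x) ×-dec R? x) xs) f
∑-sieve P? Q? R? [] f _ = refl
∑-sieve P? Q? R? (x ∷ xs) f pqr with ∑-sieve P? Q? R? xs f (pqr ∘ there)
... | ih rewrite ih with P? x | Q? x | R? x
... | yes _ | yes _ | yes _ = lem (f x) _ _ _ _
  where
  lem : ∀ y a b c d → y ℤ.+ (a ℤ.+ b ℤ.- c ℤ.- d) ≡ y ℤ.+ a ℤ.+ (y ℤ.+ b) ℤ.- (y ℤ.+ c) ℤ.- d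
  lem = ℤSolver.solve-∀
... | yes _ | yes _ | no _ = lem (f x) _ _ _ _
  where
  lem : ∀ y a b c d → y ℤ.+ (a ℤ.+ b ℤ.- c ℤ.- d) ≡ y ℤ.+ a ℤ.+ b ℤ.- c ℤ.- d
  lem = ℤSolver.solve-∀
... | yes _ | no _ | yes _ = lem (f x) _ _ _ _
  where
  lem : ∀ y a b c d → y ℤ.+ (a ℤ.+ b ℤ.- c ℤ.- d) ≡ y ℤ.+ a ℤ.+ (y ℤ.+ b) ℤ.- c ℤ.- (y ℤ.+ d)
  lem = ℤSolver.solve-∀
... | yes _ | no _ | no _ = lem (f x) _ _ _ _
  where
  lem : ∀ y a b c d → y ℤ.+ (a ℤ.+ b ℤ.- c ℤ.- d) ≡ y ℤ.+ a ℤ.+ b ℤ.- c ℤ.- d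
  lem = ℤSolver.solve-∀
... | no _ | yes _ | yes _ = lem (f x) _ _ _ _
  where
  lem : ∀ y a b c d → y ℤ.+ (a ℤ.+ b ℤ.- c ℤ.- d) ≡ y ℤ.+ a ℤ.+ (y ℤ.+ b) ℤ.- (y ℤ.+ c) ℤ.- d
  lem = ℤSolver.solve-∀
... | no _ | yes _ | no _ = lem (f x) _ _ _ _
  where
  lem : ∀ y a b c d → y ℤ.+ (a ℤ.+ b ℤ.- c ℤ.- d) ≡ y ℤ.+ a ℤ.+ b ℤ.- c ℤ.- d
  lem = ℤSolver.solve-∀
... | no _ | no _ | yes _ = lem (f x) (∑ (filter (λ x → P? x ⊎-dec Q? x) xs) f) _ _ _
  where
  lem : ∀ y a b c d → y ℤ.+ (a ℤ.+ b ℤ.- c ℤ.- d) ≡ a ℤ.+ (y ℤ.+ b) ℤ.- c ℤ.- d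
  lem = ℤSolver.solve-∀
... | no ¬p | no ¬q | no ¬r with pqr (here refl)
...   | inj₁ p        = contradiction p ¬p
...   | inj₂ (inj₁ q) = contradiction q ¬q
...   | inj₂ (inj₂ r) = contradiction r ¬r

-- Signed enumeration of lattice paths

trues falses : List Bool → ℕ
trues []          = 0
trues (true  ∷ d) = suc (trues d)
trues (false ∷ d) = trues d
falses []          = 0
falses (true  ∷ d) = falses d
falses (false ∷ d) = suc (falses d)

-- the paths with t up-steps (true) that start at height h and reach height 0 exactly at their end
paths : ℕ → ℕ → List (List Bool)
paths zero    zero    = [ [] ]
paths zero    (suc t) = []
paths (suc h) zero    = map (false ∷_) (paths h zero)
paths (suc h) (suc t) = map (true ∷_) (paths (suc (suc h)) t) ++ map (false ∷_) (paths h (suc t))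

∈-paths-trues : ∀ h t {d} → d ∈ paths h t → trues d ≡ t
∈-paths-trues zero    zero    (here refl) = refl
∈-paths-trues (suc h) zero    d∈ with ∈-map⁻ (false ∷_) d∈
... | d , d∈′ , refl = ∈-paths-trues h zero d∈′
∈-paths-trues (suc h) (suc t) d∈ with ∈-++⁻ (map (true ∷_) (paths (suc (suc h)) t)) d∈
... | inj₁ d∈₁ with ∈-map⁻ (true ∷_) d∈₁
...   | d , d∈′ , refl = cong suc (∈-paths-trues (suc (suc h)) t d∈′)
∈-paths-trues (suc h) (suc t) d∈ | inj₂ d∈₂ with ∈-map⁻ (false ∷_) d∈₂
...   | d , d∈′ , refl = ∈-paths-trues h (suc t) d∈′

-- The sign of the unshuffle along the path: every letter at a `false` is overtaken by all letters
-- at later `true` steps.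
pathSign : List Bool → ℤ
pathSign []          = 1ℤ
pathSign (true  ∷ d) = pathSign d
pathSign (false ∷ d) = sign (trues d) ℤ.* pathSign d

S : ℕ → ℕ → ℤ
S h t = ∑ (paths h t) pathSign

∑-false∷ : ∀ h t → ∑ (map (false ∷_) (paths h t)) pathSign ≡ sign t ℤ.* S h t
∑-false∷ h t = trans (∑-map (false ∷_) (paths h t) pathSign) (trans
  (∑-cong (paths h t) λ d∈ → cong (λ k → sign k ℤ.* _) (∈-paths-trues h t d∈))
  (∑-*ˡ (sign t) (paths h t) pathSign))

S-zero : ∀ h → S h 0 ≡ 1ℤ
S-zero zero    = refl
S-zero (suc h) = trans (∑-false∷ h 0) (cong (1ℤ ℤ.*_) (S-zero h))

S-step : ∀ h t → S (suc h) (suc t) ≡ S (suc (suc h)) t ℤ.+ sign (suc t) ℤ.* S h (suc t)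
S-step h t = trans (∑-++ (map (true ∷_) (paths (suc (suc h)) t)) _ pathSign)
  (cong₂ ℤ._+_ (∑-map (true ∷_) (paths (suc (suc h)) t) pathSign) (∑-false∷ h (suc t)))

-- Over two steps the contributions of up-down and down-up cancel.
S-two-steps : ∀ h t → sign t ≡ 1ℤ → S (2 + h) (2 + t) ≡ S (4 + h) t ℤ.+ S h (2 + t)
S-two-steps h t even
  rewrite S-step (suc h) (suc t) | S-step (suc (suc h)) t | S-step h (suc t) | even =
  lem (S (4 + h) t) (S (2 + h) (suc t)) (S h (2 + t))
  where
  lem : ∀ a b c → a ℤ.+ -1ℤ ℤ.* b ℤ.+ 1ℤ ℤ.* (b ℤ.+ 1ℤ ℤ.* c) ≡ a ℤ.+ c
  lem = ℤSolver.solve-∀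

-- The unsigned number of the paths in `paths`, by the same recursion. Each step now stands for two
-- equal steps of a signed path.
ballot : ℕ → ℕ → ℕ
ballot zero    zero    = 1
ballot zero    (suc s) = 0
ballot (suc k) zero    = 1
ballot (suc k) (suc s) = ballot (suc (suc k)) s + ballot k (suc s)

S-ballot : ∀ k s → S (k + k) (s + s) ≡ ℤ.+ ballot k s
S-ballot zero    zero    = refl
S-ballot zero    (suc s) = refl
S-ballot (suc k) zero    = S-zero (suc k + suc k)
S-ballot (suc k) (suc s) = begin
  S (suc k + suc k) (suc s + suc s)                ≡⟨ cong₂ S (+-suc (suc k) k) (+-suc (suc s) s) ⟩
  S (2 + (k + k)) (2 + (s + s))                    ≡⟨ S-two-steps (k + k) (s + s) (sign-even s) ⟩
  S (4 + (k + k)) (s + s) ℤ.+ S (k + k) (2 + (s + s))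
    ≡⟨ cong₂ ℤ._+_ (cong (λ h → S h (s + s)) (four k)) (cong (S (k + k)) (sym (+-suc (suc s) s))) ⟩
  S (suc (suc k) + suc (suc k)) (s + s) ℤ.+ S (k + k) (suc s + suc s)
    ≡⟨ cong₂ ℤ._+_ (S-ballot (suc (suc k)) s) (S-ballot k (suc s)) ⟩
  ℤ.+ ballot (suc (suc k)) s ℤ.+ ℤ.+ ballot k (suc s)  ∎
  where
  open ≡-Reasoning
  four : ∀ k → 4 + (k + k) ≡ suc (suc k) + suc (suc k)
  four = solve-∀

-- Ballot numbers, binomial coefficients and Catalan numbers

pascal : ∀ n k → suc n C suc k ≡ n C k + n C suc k
pascal n k = sym (nCk+nC[k+1]≡[n+1]C[k+1] n k)

nC0 : ∀ n → n C 0 ≡ 1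
nC0 n = trans (nCk≡nC[n∸k] {k = 0} {n = n} z≤n) (nCn≡1 n)

-- The binomial coefficient with lower index k - 1; at k = 0 truncated subtraction would give 1
-- where 0 is wanted.
C⁻ : ℕ → ℕ → ℕ
C⁻ n zero    = 0
C⁻ n (suc k) = n C k

pascal⁻ : ∀ n k → suc n C k ≡ C⁻ n k + n C k
pascal⁻ n zero    = trans (nC0 (suc n)) (sym (nC0 n))
pascal⁻ n (suc k) = pascal n k

C-middle : ∀ s → (s + suc s) C s ≡ (s + suc s) C suc s
C-middle s = trans (nCk≡nC[n∸k] (m≤m+n s (suc s))) (cong ((s + suc s) C_) (m+n∸m≡n s (suc s)))

-- Pascal's rule turns the ballot recursion into the recursion of the difference of binomials. The
-- second hypothesis is phrased so as to cover the boundary: at k = 0 the ballot number vanishes and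
-- it becomes the equality of the two middle binomials.
ballot-reflection-suc : ∀ k s →
  ballot (2 + k) s + C⁻ (s + s + suc k) s ≡ (s + s + suc k) C s →
  ballot k (suc s) + (s + suc s + k) C s ≡ (s + suc s + k) C suc s →
  ballot (suc k) (suc s) + C⁻ (suc s + suc s + k) (suc s) ≡ (suc s + suc s + k) C suc s
ballot-reflection-suc k s first second = begin
  ballot (2 + k) s + ballot k (suc s) + suc N C s              ≡⟨ cong (λ z → ballot (2 + k) s + ballot k (suc s) + z) (pascal⁻ N s) ⟩
  ballot (2 + k) s + ballot k (suc s) + (C⁻ N s + N C s)       ≡⟨ reorder (ballot (2 + k) s) _ _ _ ⟩
  ballot (2 + k) s + C⁻ N s + (ballot k (suc s) + N C s)       ≡⟨ cong₂ _+_ first′ second ⟩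
  N C s + N C suc s                                             ≡⟨ pascal N s ⟨
  suc N C suc s                                                 ∎
  where
  open ≡-Reasoning
  N : ℕ
  N = s + suc s + k
  reorder : ∀ a b c d → a + b + (c + d) ≡ a + c + (b + d)
  reorder = solve-∀
  shift : ∀ s k → s + suc s + k ≡ s + s + suc k
  shift = solve-∀
  first′ : ballot (2 + k) s + C⁻ N s ≡ N C s
  first′ = subst (λ m → ballot (2 + k) s + C⁻ m s ≡ m C s) (sym (shift s k)) first

-- The reflection principle: ballot (k + 1) s = C(2s + k, s) − C(2s + k, s − 1).
ballot-reflection : ∀ k s → ballot (suc k) s + C⁻ (s + s + k) s ≡ (s + s + k) C s
ballot-reflection k zero = sym (nC0 k)
ballot-reflection zero (suc s) =
  ballot-reflection-suc 0 s (ballot-reflection 1 s) (subst (λ m → m C s ≡ m C suc s) (sym (+-identityʳ (s + suc s))) (C-middle s))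
ballot-reflection (suc k) (suc s) = ballot-reflection-suc (suc k) s (ballot-reflection (2 + k) s)
  (subst (λ m → ballot (suc k) (suc s) + m C s ≡ m C suc s) (shift s k) (ballot-reflection k (suc s)))
  where
  shift : ∀ s k → suc s + suc s + k ≡ s + suc s + suc k
  shift = solve-∀

absorption : ∀ n k → suc k * (suc n C suc k) ≡ suc n * (n C k)
absorption n zero = trans (+-identityʳ _) (trans (nC1≡n (suc n)) (trans (sym (*-identityʳ (suc n))) (cong (suc n *_) (sym (nC0 n)))))
absorption zero (suc k) = *-zeroʳ (suc (suc k))
absorption (suc n) (suc k) = begin
  suc (suc k) * (suc (suc n) C suc (suc k))            ≡⟨ cong (suc (suc k) *_) (pascal (suc n) (suc k)) ⟩
  suc (suc k) * (a + b)                                ≡⟨ expand k a b ⟩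
  a + (suc k * a + suc (suc k) * b)                    ≡⟨ cong (a +_) (cong₂ _+_ (absorption n k) (absorption n (suc k))) ⟩
  a + (suc n * (n C k) + suc n * (n C suc k))          ≡⟨ cong (a +_) (*-distribˡ-+ (suc n) (n C k) (n C suc k)) ⟨
  a + suc n * (n C k + n C suc k)                      ≡⟨ cong (λ z → a + suc n * z) (pascal n k) ⟨
  a + suc n * a                                        ∎
  where
  open ≡-Reasoning
  a = suc n C suc k
  b = suc n C suc (suc k)
  expand : ∀ k a b → suc (suc k) * (a + b) ≡ a + (suc k * a + suc (suc k) * b)
  expand = solve-∀

-- With u = C(2s, s) and v = C(2s, s + 1), reflection and symmetry give b + v = u, and absorption
-- gives (s + 1) v = s u. Hence (s + 1) b = u, and the division in `catalan` is exact.
ballot-catalan : ∀ s → ballot 1 s ≡ catalan s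
ballot-catalan s = sym (trans (/-congˡ {o = suc s} (trans (cong (_C s) (double s)) (trans (sym product) (*-comm (suc s) b)))) (m*n/n≡m b (suc s)))
  where
  open ≡-Reasoning
  double : ∀ s → 2 * s ≡ s + s
  double = solve-∀
  b u v : ℕ
  b = ballot 1 s
  u = (s + s) C s
  v = (s + s) C suc s
  C⁻-middle : ∀ s → C⁻ (s + s) s ≡ (s + s) C suc s
  C⁻-middle zero    = refl
  C⁻-middle (suc s) = trans (nCk≡nC[n∸k] {k = s} {n = suc s + suc s} (≤-trans (n≤1+n s) (m≤m+n (suc s) (suc s))))
    (cong ((suc s + suc s) C_) (trans (cong (_∸ s) (rearrange s)) (m+n∸m≡n s (2 + s))))
    where
    rearrange : ∀ s → suc s + suc s ≡ s + (2 + s)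
    rearrange = solve-∀
  b+v≡u : b + v ≡ u
  b+v≡u = trans (cong (b +_) (sym (C⁻-middle s)))
    (subst (λ m → b + C⁻ m s ≡ m C s) (+-identityʳ (s + s)) (ballot-reflection 0 s))
  sv : suc s * v ≡ s * u
  sv = +-cancelˡ-≡ (suc s * u) _ _ (begin
    suc s * u + suc s * v       ≡⟨ *-distribˡ-+ (suc s) u v ⟨
    suc s * (u + v)             ≡⟨ cong (suc s *_) (pascal (s + s) s) ⟨
    suc s * (suc (s + s) C suc s) ≡⟨ absorption (s + s) s ⟩
    suc (s + s) * u             ≡⟨ *-distribʳ-+ u (suc s) s ⟩
    suc s * u + s * u           ∎)
  product : suc s * b ≡ u
  product = +-cancelʳ-≡ (s * u) _ _ (begin
    suc s * b + s * u           ≡⟨ cong (suc s * b +_) sv ⟨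
    suc s * b + suc s * v       ≡⟨ *-distribˡ-+ (suc s) b v ⟨
    suc s * (b + v)             ≡⟨ cong (suc s *_) b+v≡u ⟩
    u + s * u                   ∎)

excursions : ℕ → List (List Bool)
excursions s = map (true ∷_) (paths 1 (suc (s + s)))

∑-excursions : ∀ s → ∑ (excursions s) pathSign ≡ ℤ.+ catalan s
∑-excursions s = begin
  ∑ (excursions s) pathSign                       ≡⟨ ∑-map (true ∷_) (paths 1 (suc (s + s))) pathSign ⟩
  S 1 (suc (s + s))                               ≡⟨ S-step 0 (s + s) ⟩
  -- The factor 0 is the signed count from height 0: a path that has come down to 0 with up-steps
  -- left cannot go on.
  S 2 (s + s) ℤ.+ sign (suc (s + s)) ℤ.* 0ℤ       ≡⟨ cong (λ z → S 2 (s + s) ℤ.+ z) (ℤₚ.*-zeroʳ (sign (suc (s + s)))) ⟩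
  S 2 (s + s) ℤ.+ 0ℤ                              ≡⟨ ℤₚ.+-identityʳ _ ⟩
  S 2 (s + s)                                     ≡⟨ S-ballot 1 s ⟩
  ℤ.+ ballot 1 s                                    ≡⟨ cong ℤ.+_ (ballot-catalan s) ⟩
  ℤ.+ catalan s                                     ∎
  where open ≡-Reasoning

-- Exchanging two values

transpose : ℕ → ℕ → ℕ → ℕ
transpose x y v with v ≟ x | v ≟ y
... | yes _ | _     = y
... | no _  | yes _ = x
... | no _  | no _  = v

transpose-ˡ : ∀ x y → transpose x y x ≡ y
transpose-ˡ x y with x ≟ x
... | yes _   = refl
... | no x≢x = contradiction refl x≢x

transpose-ʳ : ∀ x y → transpose x y y ≡ x
transpose-ʳ x y with y ≟ x | y ≟ y
... | yes eq | _      = eq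
... | no _   | yes _  = refl
... | no _   | no y≢y = contradiction refl y≢y

transpose-other : ∀ {x y v} → v ≢ x → v ≢ y → transpose x y v ≡ v
transpose-other {x} {y} {v} v≢x v≢y with v ≟ x | v ≟ y
... | yes e | _     = contradiction e v≢x
... | no _  | yes e = contradiction e v≢y
... | no _  | no _  = refl

transpose-involutive : ∀ x y v → transpose x y (transpose x y v) ≡ v
transpose-involutive x y v with v ≟ x | v ≟ y
... | yes refl | _        = transpose-ʳ x y
... | no _     | yes refl = transpose-ˡ x y
... | no v≢x   | no v≢y   = transpose-other v≢x v≢y

map-transpose-other : ∀ {x y} u → x ∉ u → y ∉ u → map (transpose x y) u ≡ u
map-transpose-other []      _  _  = refl
map-transpose-other (v ∷ u) x∉ y∉ = cong₂ _∷_ (transpose-other (x∉ ∘ here ∘ sym) (y∉ ∘ here ∘ sym))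
  (map-transpose-other u (x∉ ∘ there) (y∉ ∘ there))

map-transpose-involutive : ∀ x y u → map (transpose x y) (map (transpose x y) u) ≡ u
map-transpose-involutive x y u = trans (sym (map-∘ u)) (trans (map-cong (transpose-involutive x y) u) (map-id u))

Transposed : ℕ → ℕ → List ℕ → List ℕ → Set
Transposed x y w w′ = ∃₂ λ a b → ∃ λ e → w ≡ a ++ x ∷ b ++ y ∷ e × w′ ≡ a ++ y ∷ b ++ x ∷ e

map-transpose-ordered : ∀ {x y} a b e → Unique (a ++ x ∷ b ++ y ∷ e) →
  map (transpose x y) (a ++ x ∷ b ++ y ∷ e) ≡ a ++ y ∷ b ++ x ∷ e × map (transpose y x) (a ++ x ∷ b ++ y ∷ e) ≡ a ++ y ∷ b ++ x ∷ e
map-transpose-ordered {x} {y} a b e un =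
  eq x y (transpose-ˡ x y) (transpose-ʳ x y) rest ,
  eq y x (transpose-ʳ y x) (transpose-ˡ y x) (λ u p q → map-transpose-other u q p)
  where
  rest : ∀ u → x ∉ u → y ∉ u → map (transpose x y) u ≡ u
  rest u = map-transpose-other u
  σ₁ : a ++ x ∷ b ++ y ∷ e ↭ x ∷ a ++ b ++ y ∷ e
  σ₁ = Permₚ.shift x a _
  σ₂ : x ∷ a ++ b ++ y ∷ e ↭ x ∷ y ∷ a ++ b ++ e
  σ₂ = prep x (subst₂ _↭_ (++-assoc a b _) (cong (y ∷_) (++-assoc a b e)) (Permₚ.shift y (a ++ b) e))
  un′ : Unique (x ∷ y ∷ a ++ b ++ e)
  un′ = Unique-↭ (↭-trans σ₁ σ₂) un
  x∉ : x ∉ a ++ b ++ e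
  x∉ = Unique-∉ un′ ∘ there
  y∉ : y ∉ a ++ b ++ e
  y∉ = Unique-∉ (AllPairs.tail un′)
  eq : ∀ x′ y′ → transpose x′ y′ x ≡ y → transpose x′ y′ y ≡ x → (∀ u → x ∉ u → y ∉ u → map (transpose x′ y′) u ≡ u) →
       map (transpose x′ y′) (a ++ x ∷ b ++ y ∷ e) ≡ a ++ y ∷ b ++ x ∷ e
  eq x′ y′ ex ey r = trans (map-++ _ a _) (cong₂ _++_ (r a (x∉ ∘ ∈-++⁺ˡ) (y∉ ∘ ∈-++⁺ˡ))
    (cong₂ _∷_ ex (trans (map-++ _ b _) (cong₂ _++_ (r b (x∉ ∘ ∈-++⁺ʳ a ∘ ∈-++⁺ˡ) (y∉ ∘ ∈-++⁺ʳ a ∘ ∈-++⁺ˡ))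
      (cong₂ _∷_ ey (r e (x∉ ∘ ∈-++⁺ʳ a ∘ ∈-++⁺ʳ b) (y∉ ∘ ∈-++⁺ʳ a ∘ ∈-++⁺ʳ b)))))))

map-transpose : ∀ {x y w} → Unique w → x ∈ w → y ∈ w → x ≢ y →
  Transposed x y w (map (transpose x y) w) ⊎ Transposed y x w (map (transpose x y) w)
map-transpose {x} {y} un x∈ y∈ x≢y with ∈-∃++ x∈
... | a , r , refl with ∈-++⁻ a y∈
...   | inj₂ (here y≡x) = contradiction (sym y≡x) x≢y
...   | inj₂ (there y∈r) with ∈-∃++ y∈r
...     | b , e , refl = inj₁ (a , b , e , refl , proj₁ (map-transpose-ordered a b e un))
map-transpose {x} {y} un x∈ y∈ x≢y | a , r , refl | inj₁ y∈a with ∈-∃++ y∈a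
...     | a′ , b , refl = inj₂ (a′ , b , r , assoc ,
            trans (cong (map (transpose x y)) assoc) (proj₂ (map-transpose-ordered a′ b r (subst Unique assoc un))))
  where
  assoc : (a′ ++ y ∷ b) ++ x ∷ r ≡ a′ ++ y ∷ b ++ x ∷ r
  assoc = ++-assoc a′ (y ∷ b) (x ∷ r)

transposed-↭ : ∀ {x y w w′} → Transposed x y w w′ → w ↭ w′
transposed-↭ {x} {y} (a , b , e , refl , refl) = Permₚ.++⁺ˡ a
  (↭-trans (prep x (Permₚ.shift y b e)) (↭-trans (swap x y ↭-refl) (prep y (↭-sym (Permₚ.shift x b e)))))

transposed-sgn : ∀ {x y w w′} → Unique w → Transposed x y w w′ → sgn w ≡ ℤ.- sgn w′
transposed-sgn {x} {y} un (a , b , e , refl , refl) = sgn-transpose a x b y e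
  (Unique-⊆ (HSub.++ˡ a (refl ∷ subst (b ++ [ y ] ⊆_) (++-assoc b [ y ] e) (⊆-++ˡ (b ++ [ y ]) e))) un)

map-transpose-↭ : ∀ {x y w} → Unique w → x ∈ w → y ∈ w → x ≢ y → map (transpose x y) w ↭ w
map-transpose-↭ un x∈ y∈ x≢y with map-transpose un x∈ y∈ x≢y
... | inj₁ t = ↭-sym (transposed-↭ t)
... | inj₂ t = ↭-sym (transposed-↭ t)

map-transpose-sgn : ∀ {x y w} → Unique w → x ∈ w → y ∈ w → x ≢ y → sgn (map (transpose x y) w) ≡ ℤ.- sgn w
map-transpose-sgn {x} {y} {w} un x∈ y∈ x≢y with map-transpose un x∈ y∈ x≢y
... | inj₁ t = trans (sym (ℤₚ.neg-involutive _)) (cong ℤ.-_ (sym (transposed-sgn un t)))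
... | inj₂ t = trans (sym (ℤₚ.neg-involutive _)) (cong ℤ.-_ (sym (transposed-sgn un t)))

next : ℕ → ℕ → ℕ
next n x with x ≟ n
... | yes _ = 1
... | no _  = suc x

InRange : ℕ → ℕ → Set
InRange n x = 1 ≤ x × x ≤ n

next-inRange : ∀ {n x} → InRange n x → InRange n (next n x)
next-inRange {n} {x} (1≤x , x≤n) with x ≟ n
... | yes refl = ≤-refl , 1≤x
... | no x≢n  = s≤s z≤n , ≤∧≢⇒< x≤n x≢n

next-≢ : ∀ {n x} → 1 < n → x ≢ next n x
next-≢ {n} {x} 1<n eq with x ≟ n
... | yes refl = <⇒≢ 1<n (sym eq)
... | no _     = <⇒≢ (n<1+n x) eq

next-injective : ∀ {n x y} → InRange n x → InRange n y → next n x ≡ next n y → x ≡ y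
next-injective {n} {x} {y} (1≤x , _) (1≤y , _) eq with x ≟ n | y ≟ n
... | yes refl | yes refl = refl
... | yes _    | no _     = contradiction (suc-injective eq) (<⇒≢ 1≤y)
... | no _     | yes _    = contradiction (suc-injective (sym eq)) (<⇒≢ 1≤x)
... | no _     | no _     = suc-injective eq

-- As `x` is absent from `u`, the only letter that can change is the successor of `x`, and no value
-- lies between the two. For `x` below n the sorted word stays sorted; for `x` equal to n a letter 1
-- becomes n, which is a change by one rotation.
CI-map-transpose : ∀ {n x u} → CI u → x ∉ u → All (InRange n) u → CI (map (transpose x (next n x)) u)
CI-map-transpose {n} {x} {u} (s , ss , r) x∉u range with x ≟ n
... | no x≢n = map τ s , AllPairsₚ.map⁺ (monotone s ss x∉s) , rot-map τ r
  where
  τ = transpose x (suc x)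
  x∉s : x ∉ s
  x∉s = x∉u ∘ Permₚ.∈-resp-↭ (rot-↭ r)
  mono : ∀ {v w} → v ≢ x → w ≢ x → v < w → τ v < τ w
  mono {v} {w} v≢x w≢x v<w with v ≟ x | v ≟ suc x | w ≟ x | w ≟ suc x
  ... | yes e | _ | _ | _ = contradiction e v≢x
  ... | _ | _ | yes e | _ = contradiction e w≢x
  ... | no _ | yes refl | no _ | yes refl = contradiction v<w (<-irrefl refl)
  ... | no _ | yes refl | no _ | no _     = <-trans (n<1+n x) v<w
  ... | no _ | no _     | no _ | yes refl = ≤∧≢⇒< (≤-pred v<w) v≢x
  ... | no _ | no _     | no _ | no _     = v<w
  monotone : ∀ s → Sorted s → x ∉ s → AllPairs (λ v w → τ v < τ w) s
  monotone [] _ _ = []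
  monotone (v ∷ s) (r ∷ rs) x∉ =
    All.tabulate (λ w∈ → mono (x∉ ∘ here ∘ sym) (λ { refl → x∉ (there w∈) }) (All.lookup r w∈)) ∷ monotone s rs (x∉ ∘ there)
... | yes refl with s | ss
...   | [] | [] = [] , [] , rot-map _ r
...   | v ∷ s | r₁ ∷ rs with v ≟ 1
...     | no v≢1 = v ∷ s , r₁ ∷ rs , subst (λ t → Rot t (map (transpose n 1) u)) unchanged (rot-map _ r)
  where
  range-s : All (InRange n) (v ∷ s)
  range-s = Permₚ.All-resp-↭ (↭-sym (rot-↭ r)) range
  unchanged : map (transpose n 1) (v ∷ s) ≡ v ∷ s
  unchanged = map-transpose-other (v ∷ s) (x∉u ∘ Permₚ.∈-resp-↭ (rot-↭ r))
    λ { (here 1≡v) → v≢1 (sym 1≡v) ; (there 1∈) → <⇒≱ (All.lookup r₁ 1∈) (proj₁ (All.head range-s)) }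
-- The letter 1 led the sorted word; turned into n it has to close it.
...     | yes refl = s ++ [ n ] , AllPairsₚ.++⁺ rs ([] ∷ []) (All.map (_∷ []) below) ,
          rot-trans rotated (rot-map _ r)
  where
  n∉ : n ∉ 1 ∷ s
  n∉ = x∉u ∘ Permₚ.∈-resp-↭ (rot-↭ r)
  below : All (_< n) s
  below = All.tabulate λ v∈ → ≤∧≢⇒< (proj₂ (All.lookup (Permₚ.All-resp-↭ (↭-sym (rot-↭ r)) range) (there v∈))) (λ { refl → n∉ (there v∈) })
  rotated : Rot (s ++ [ n ]) (map (transpose n 1) (1 ∷ s))
  rotated = s , [ n ] , refl ,
    cong₂ _∷_ (transpose-ʳ n 1) (map-transpose-other s (n∉ ∘ there) (λ 1∈ → <-irrefl refl (All.lookup r₁ 1∈)))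

∈-IsPerm⇒InRange : ∀ {n w x} → IsPerm n w → x ∈ w → InRange n x
∈-IsPerm⇒InRange σ x∈ with ∈-applyUpTo⁻ suc (Permₚ.∈-resp-↭ σ x∈)
... | i , i<n , refl = s≤s z≤n , i<n

InRange⇒∈-IsPerm : ∀ {n w x} → IsPerm n w → InRange n x → x ∈ w
InRange⇒∈-IsPerm {x = suc x} σ (_ , x<n) = Permₚ.∈-resp-↭ (↭-sym σ) (∈-applyUpTo⁺ suc x<n)

IsPerm-length : ∀ {n w} → IsPerm n w → length w ≡ n
IsPerm-length {n} σ = trans (Permₚ.↭-length σ) (length-applyUpTo suc n)

-- The common features of the first and the last letter: the mark is read off at a fixed end and
-- therefore commutes with relabelling.
record Marker : Set where
  field
    mark     : List ℕ → ℕ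
    mark-∈   : ∀ {w} → 0 < length w → mark w ∈ w
    mark-map : ∀ f {w} → 0 < length w → mark (map f w) ≡ f (mark w)

first-marker : Marker
first-marker = record
  { mark     = λ { [] → 0 ; (x ∷ _) → x }
  ; mark-∈   = λ { {x ∷ _} _ → here refl }
  ; mark-map = λ { f {x ∷ _} _ → refl }
  }

lastLetter : List ℕ → ℕ
lastLetter []          = 0
lastLetter (x ∷ [])    = x
lastLetter (x ∷ y ∷ w) = lastLetter (y ∷ w)

lastLetter-∈ : ∀ w → 0 < length w → lastLetter w ∈ w
lastLetter-∈ (x ∷ [])    _ = here refl
lastLetter-∈ (x ∷ y ∷ w) _ = there (lastLetter-∈ (y ∷ w) (s≤s z≤n))

lastLetter-map : ∀ f w → 0 < length w → lastLetter (map f w) ≡ f (lastLetter w)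
lastLetter-map f (x ∷ [])    _ = refl
lastLetter-map f (x ∷ y ∷ w) _ = lastLetter-map f (y ∷ w) (s≤s z≤n)

lastLetter-++ : ∀ a b → 0 < length b → lastLetter (a ++ b) ∈ b
lastLetter-++ []          b       p = lastLetter-∈ b p
lastLetter-++ (x ∷ [])    (y ∷ b) p = lastLetter-++ [] (y ∷ b) p
lastLetter-++ (x ∷ z ∷ a) b       p = lastLetter-++ (z ∷ a) b p

last-marker : Marker
last-marker = record
  { mark     = lastLetter
  ; mark-∈   = λ {w} → lastLetter-∈ w
  ; mark-map = λ f {w} → lastLetter-map f w
  }

module ValueShift (m : Marker) (n : ℕ) (1<n : 1 < n) where
  open Marker m

  valueShift : List ℕ → List ℕ
  valueShift w = map (transpose (mark w) (next n (mark w))) w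

  private
    0<len : ∀ {w} → IsPerm n w → 0 < length w
    0<len σ = subst (0 <_) (sym (IsPerm-length σ)) (<-trans (s≤s z≤n) 1<n)

    range : ∀ {w} → IsPerm n w → InRange n (mark w)
    range σ = ∈-IsPerm⇒InRange σ (mark-∈ (0<len σ))

    next-∈ : ∀ {w} → IsPerm n w → next n (mark w) ∈ w
    next-∈ σ = InRange⇒∈-IsPerm σ (next-inRange (range σ))

  valueShift-IsPerm : ∀ {w} → IsPerm n w → IsPerm n (valueShift w)
  valueShift-IsPerm σ = ↭-trans (map-transpose-↭ (IsPerm⇒Unique σ) (mark-∈ (0<len σ)) (next-∈ σ) (next-≢ 1<n)) σ

  valueShift-sgn : ∀ {w} → IsPerm n w → sgn (valueShift w) ≡ ℤ.- sgn w
  valueShift-sgn σ = map-transpose-sgn (IsPerm⇒Unique σ) (mark-∈ (0<len σ)) (next-∈ σ) (next-≢ 1<n)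

  -- The mark of the image is the cyclic successor of the old mark, so the old mark can be read back
  -- and the transposition undone.
  valueShift-injective : ∀ {w w′} → IsPerm n w → IsPerm n w′ → valueShift w ≡ valueShift w′ → w ≡ w′
  valueShift-injective {w} {w′} σ σ′ eq = begin
    w                                  ≡⟨ map-transpose-involutive x (next n x) w ⟨
    map (transpose x (next n x)) (valueShift w)   ≡⟨ cong₂ (λ v → map (transpose v (next n v))) x≡x′ eq ⟩
    map (transpose x′ (next n x′)) (valueShift w′) ≡⟨ map-transpose-involutive x′ (next n x′) w′ ⟩
    w′                                 ∎
    where
    open ≡-Reasoning
    x x′ : ℕ
    x = mark w
    x′ = mark w′
    mark-shift : ∀ {w} → IsPerm n w → mark (valueShift w) ≡ next n (mark w)
    mark-shift {w} σ = trans (mark-map _ (0<len σ)) (transpose-ˡ (mark w) _)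
    x≡x′ : x ≡ x′
    x≡x′ = next-injective (range σ) (range σ′)
      (trans (sym (mark-shift σ)) (trans (cong mark eq) (mark-shift σ′)))

  ∑-filter-vanish : ∀ {P : Pred (List ℕ) 0ℓ} (P? : Decidable P) {T} → Unique T → (∀ {w} → w ∈ T → IsPerm n w) →
                    (∀ {w} → w ∈ T → P w → valueShift w ∈ T × P (valueShift w)) →
                    ∑ (filter P? T) sgn ≡ 0ℤ
  ∑-filter-vanish P? {T} un perm closed = ∑-vanish valueShift (Uniqueₚ.filter⁺ P? un)
    (λ w∈ → let w∈T , p = ∈-filter⁻ P? w∈ ; v∈T , q = closed w∈T p in ∈-filter⁺ P? v∈T q)
    (λ w∈ w′∈ → valueShift-injective (inT w∈) (inT w′∈))
    (λ w∈ → valueShift-sgn (inT w∈))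
    where
    inT : ∀ {w} → w ∈ filter P? T → IsPerm n w
    inT w∈ = perm (proj₁ (∈-filter⁻ P? w∈))

-- Inclusion-exclusion over the positions of the windows

CI? : Decidable CI
CI? []      = yes ([] , [] , rot-refl)
CI? (x ∷ u) = map′ (ordPerm∈M⇒CI (length (x ∷ u)) (x ∷ u)) (CI⇒ordPerm∈M (length (x ∷ u)) (x ∷ u) (s≤s z≤n) refl)
  (ordPerm (x ∷ u) ∈? M (length (x ∷ u)))
  where open DecMembership (≡-dec _≟_)

-- M′ = n − c and k = 2c − n is the overlap of the first and the last window.
module Sieve (M₀ k₀ : ℕ) where

  M₁ M′ k : ℕ
  M₁ = suc M₀
  M′ = suc M₁
  k  = suc k₀

  open Windows (M₀ + k)

  n : ℕ
  n = c + M′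

  window : ℕ → List ℕ → List ℕ
  window i w = take c (drop i w)

  Win : ℕ → List ℕ → Set
  Win i w = CI (window i w)

  window-split : ∀ i w → i ≤ M′ → length w ≡ n → ∃₂ λ a b →
    w ≡ a ++ window i w ++ b × length a ≡ i × length (window i w) ≡ c × length b ≡ M′ ∸ i
  window-split i w i≤M len = take i w , drop c (drop i w) ,
    trans (sym (take++drop≡id i w)) (cong (take i w ++_) (sym (take++drop≡id c (drop i w)))) ,
    trans (length-take i w) (m≤n⇒m⊓n≡m (≤-trans i≤M (≤-trans (m≤n+m M′ c) (≤-reflexive (sym len))))) ,
    trans (length-take c (drop i w)) (m≤n⇒m⊓n≡m (≤-trans (m≤m+n c (M′ ∸ i)) (≤-reflexive (sym len-drop)))) ,
    trans (length-drop c (drop i w)) (trans (cong (_∸ c) len-drop) (m+n∸m≡n c (M′ ∸ i)))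
    where
    len-drop : length (drop i w) ≡ c + (M′ ∸ i)
    len-drop = trans (length-drop i w) (trans (cong (_∸ i) len) (+-∸-assoc c i≤M))

  window-++ : ∀ a u b → length u ≡ c → window (length a) (a ++ u ++ b) ≡ u
  window-++ []      u b len = take-++ u b len
    where
    take-++ : ∀ u b {c} → length u ≡ c → take c (u ++ b) ≡ u
    take-++ []      b refl = refl
    take-++ (x ∷ u) b refl = cong (x ∷_) (take-++ u b refl)
  window-++ (x ∷ a) u b len = window-++ a u b len

  Win⇒NA : ∀ {i w} → i ≤ M′ → length w ≡ n → Win i w → NA w
  Win⇒NA {i} {w} i≤M len ci with window-split i w i≤M len
  ... | a , b , eq , _ , lenu , _ = a , b , window i w , eq , lenu , ci

  Inner : List ℕ → Set
  Inner w = ∃ λ i → i < M₁ × Win (suc i) w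

  NA⇒Win : ∀ {w} → length w ≡ n → NA w → Win 0 w ⊎ Inner w ⊎ Win M′ w
  NA⇒Win len (a , b , u , refl , lenu , ci) = cases (length a) refl
    where
    win : Win (length a) (a ++ u ++ b)
    win = subst CI (sym (window-++ a u b lenu)) ci
    bound : length a + length b ≡ M′
    bound = +-cancelˡ-≡ c _ _ (begin
      c + (length a + length b)          ≡⟨ cong (_+ (length a + length b)) lenu ⟨
      length u + (length a + length b)   ≡⟨ +-assoc (length u) (length a) (length b) ⟨
      length u + length a + length b     ≡⟨ cong (_+ length b) (+-comm (length u) (length a)) ⟩
      length a + length u + length b     ≡⟨ +-assoc (length a) (length u) (length b) ⟩
      length a + (length u + length b)   ≡⟨ cong (length a +_) (length-++ u) ⟨
      length a + length (u ++ b)         ≡⟨ length-++ a ⟨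
      length (a ++ u ++ b)               ≡⟨ len ⟩
      n                                  ∎)
      where open ≡-Reasoning
    cases : ∀ i → i ≡ length a → Win 0 (a ++ u ++ b) ⊎ Inner (a ++ u ++ b) ⊎ Win M′ (a ++ u ++ b)
    cases zero    eq = inj₁ (subst (λ j → Win j (a ++ u ++ b)) (sym eq) win)
    cases (suc i) eq with suc i ≟ M′
    ... | yes e = inj₂ (inj₂ (subst (λ j → Win j (a ++ u ++ b)) (trans (sym eq) e) win))
    ... | no ne = inj₂ (inj₁ (i , ≤-pred (≤∧≢⇒< (≤-trans (≤-reflexive eq) (≤-trans (m≤m+n _ (length b)) (≤-reflexive bound))) ne) ,
                    subst (λ j → Win j (a ++ u ++ b)) (sym eq) win))

  Win? : ∀ i → Decidable (Win i)
  Win? i w = CI? (window i w)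

  Inner? : Decidable Inner
  Inner? w = anyUpTo? (λ i → Win? (suc i) w) M₁

  1<n : 1 < n
  1<n = s≤s (s≤s z≤n)

  module Shift (m : Marker) where
    open Marker m
    open ValueShift m n 1<n public

    Win-shift : ∀ {i w} → IsPerm n w → mark w ∉ window i w → Win i w → Win i (valueShift w)
    Win-shift {i} {w} σ x∉ ci = subst CI (trans (sym (take-map c (drop i w))) (cong (take c) (sym (drop-map i w))))
      (CI-map-transpose ci x∉ (All.tabulate λ v∈ → ∈-IsPerm⇒InRange σ (window-∈ v∈)))
      where
      window-∈ : ∀ {v} → v ∈ window i w → v ∈ w
      window-∈ v∈ = subst (_ ∈_) (take++drop≡id i w) (∈-++⁺ʳ (take i w) (subst (_ ∈_) (take++drop≡id c (drop i w)) (∈-++⁺ˡ v∈)))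

  first∉window : ∀ {i w} → IsPerm n w → 0 < i → i ≤ M′ → Marker.mark first-marker w ∉ window i w
  first∉window {suc i} {[]} σ _ _ ()
  first∉window {suc i} {x ∷ w} σ _ i≤M x∈ with window-split (suc i) (x ∷ w) i≤M (IsPerm-length σ)
  ... | y ∷ a , b , eq , _ , _ with ∷-injective eq
  ...   | refl , eq′ = Unique-∉ (IsPerm⇒Unique σ) (subst (x ∈_) (sym eq′) (∈-++⁺ʳ a (∈-++⁺ˡ x∈)))

  last∉window : ∀ {i w} → IsPerm n w → i < M′ → lastLetter w ∉ window i w
  last∉window {i} {w} σ i<M x∈ with window-split i w (<⇒≤ i<M) (IsPerm-length σ)
  ... | a , b , eq , _ , _ , lenb =
    All.lookup (All.lookup (++-Unique⁻ (window i w) (Unique-⊆ (HSub.++ˡ a (⊆-refl)) (subst Unique eq (IsPerm⇒Unique σ)))) x∈)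
      (subst (λ v → lastLetter v ∈ b) (trans (++-assoc a (window i w) b) (sym eq))
        (lastLetter-++ (a ++ window i w) b (≤-trans (m<n⇒0<n∸m i<M) (≤-reflexive (sym lenb))))) refl

  Extremal : List ℕ → Set
  Extremal w = Win 0 w × ¬ Inner w × Win M′ w

  Extremal? : Decidable Extremal
  Extremal? w = Win? 0 w ×-dec ¬? (Inner? w) ×-dec Win? M′ w

  module _ (T : List (List ℕ)) (T-unique : Unique T)
           (T⁻ : ∀ {w} → w ∈ T → IsPerm n w × NA w) (T⁺ : ∀ {w} → IsPerm n w → NA w → w ∈ T) where

    -- Each cancelled event ignores one end of the word: `Win 0` or `Inner` does not see the last
    -- letter, while `Win M′`, alone or together with `Inner`, does not see the first. The value
    -- shift at the ignored end preserves the event.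
    ∑-extremal : ∑ T sgn ≡ ℤ.- ∑ (filter Extremal? T) sgn
    ∑-extremal = begin
      ∑ T sgn
        ≡⟨ ∑-sieve (Win? 0) Inner? (Win? M′) T sgn (λ w∈ → let σ , na = T⁻ w∈ in NA⇒Win (IsPerm-length σ) na) ⟩
      ∑ (filter (λ w → Win? 0 w ⊎-dec Inner? w) T) sgn ℤ.+ ∑ (filter (Win? M′) T) sgn
        ℤ.- ∑ (filter (λ w → Inner? w ×-dec Win? M′ w) T) sgn ℤ.- ∑ (filter Extremal? T) sgn
        ≡⟨ cong (ℤ._- ∑ (filter Extremal? T) sgn) (cong₂ ℤ._-_ (cong₂ ℤ._+_ vanish₁ vanish₂) vanish₃) ⟩
      0ℤ ℤ.- ∑ (filter Extremal? T) sgn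
        ≡⟨ ℤₚ.+-identityˡ _ ⟩
      ℤ.- ∑ (filter Extremal? T) sgn ∎
      where
      open ≡-Reasoning
      module Fst = Shift first-marker
      module Lst = Shift last-marker
      perm : ∀ {w} → w ∈ T → IsPerm n w
      perm = proj₁ ∘ T⁻
      collect : ∀ {i w} → i ≤ M′ → IsPerm n w → Win i w → w ∈ T
      collect i≤M σ win = T⁺ σ (Win⇒NA i≤M (IsPerm-length σ) win)
      vanish₁ : ∑ (filter (λ w → Win? 0 w ⊎-dec Inner? w) T) sgn ≡ 0ℤ
      vanish₁ = Lst.∑-filter-vanish _ T-unique perm closed
        where
        closed : ∀ {w} → w ∈ T → Win 0 w ⊎ Inner w → Lst.valueShift w ∈ T × (Win 0 (Lst.valueShift w) ⊎ Inner (Lst.valueShift w))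
        closed {w} w∈ (inj₁ p) =
          let σ  = perm w∈
              p′ = Lst.Win-shift {0} {w} σ (last∉window {0} {w} σ (s≤s z≤n)) p
          in collect z≤n (Lst.valueShift-IsPerm σ) p′ , inj₁ p′
        closed {w} w∈ (inj₂ (i , i<M , p)) =
          let σ  = perm w∈
              p′ = Lst.Win-shift {suc i} {w} σ (last∉window {suc i} {w} σ (s≤s i<M)) p
          in collect (≤-trans i<M (n≤1+n M₁)) (Lst.valueShift-IsPerm σ) p′ , inj₂ (i , i<M , p′)
      vanish₂ : ∑ (filter (Win? M′) T) sgn ≡ 0ℤ
      vanish₂ = Fst.∑-filter-vanish _ T-unique perm λ {w} w∈ p →
        let σ = perm w∈; p′ = Fst.Win-shift {M′} {w} σ (first∉window {M′} {w} σ (s≤s z≤n) ≤-refl) p in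
        collect ≤-refl (Fst.valueShift-IsPerm σ) p′ , p′
      vanish₃ : ∑ (filter (λ w → Inner? w ×-dec Win? M′ w) T) sgn ≡ 0ℤ
      vanish₃ = Fst.∑-filter-vanish _ T-unique perm λ { {w} w∈ ((i , i<M , q) , p) →
        let σ = perm w∈
            p′ = Fst.Win-shift {M′} {w} σ (first∉window {M′} {w} σ (s≤s z≤n) ≤-refl) p
            q′ = Fst.Win-shift {suc i} {w} σ (first∉window {suc i} {w} σ (s≤s z≤n) (≤-trans i<M (n≤1+n M₁))) q in
        collect ≤-refl (Fst.valueShift-IsPerm σ) p′ , (i , i<M , q′) , p′ }

-- Unshuffling along a path

selT selF : List Bool → List A → List A
selT (true  ∷ d) (y ∷ Y) = y ∷ selT d Y
selT (false ∷ d) (y ∷ Y) = selT d Y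
selT _           _       = []
selF (true  ∷ d) (y ∷ Y) = selF d Y
selF (false ∷ d) (y ∷ Y) = y ∷ selF d Y
selF _           _       = []

selT-⊆ : ∀ d (Y : List A) → selT d Y ⊆ Y
selT-⊆ []          Y       = minimum Y
selT-⊆ (true  ∷ d) []      = []
selT-⊆ (false ∷ d) []      = []
selT-⊆ (true  ∷ d) (y ∷ Y) = refl ∷ selT-⊆ d Y
selT-⊆ (false ∷ d) (y ∷ Y) = y ∷ʳ selT-⊆ d Y

selF-⊆ : ∀ d (Y : List A) → selF d Y ⊆ Y
selF-⊆ []          Y       = minimum Y
selF-⊆ (true  ∷ d) []      = []
selF-⊆ (false ∷ d) []      = []
selF-⊆ (false ∷ d) (y ∷ Y) = refl ∷ selF-⊆ d Y
selF-⊆ (true  ∷ d) (y ∷ Y) = y ∷ʳ selF-⊆ d Y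

length-selT : ∀ d (Y : List A) → length d ≡ length Y → length (selT d Y) ≡ trues d
length-selT []          []      _  = refl
length-selT (true  ∷ d) (y ∷ Y) eq = cong suc (length-selT d Y (suc-injective eq))
length-selT (false ∷ d) (y ∷ Y) eq = length-selT d Y (suc-injective eq)

length-selF : ∀ d (Y : List A) → length d ≡ length Y → length (selF d Y) ≡ falses d
length-selF []          []      _  = refl
length-selF (true  ∷ d) (y ∷ Y) eq = length-selF d Y (suc-injective eq)
length-selF (false ∷ d) (y ∷ Y) eq = cong suc (length-selF d Y (suc-injective eq))

selT-++ : ∀ d₁ {d₂} (Y₁ : List A) {Y₂} → length d₁ ≡ length Y₁ → selT (d₁ ++ d₂) (Y₁ ++ Y₂) ≡ selT d₁ Y₁ ++ selT d₂ Y₂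
selT-++ []           []       _  = refl
selT-++ (true  ∷ d₁) (y ∷ Y₁) eq = cong (y ∷_) (selT-++ d₁ Y₁ (suc-injective eq))
selT-++ (false ∷ d₁) (y ∷ Y₁) eq = selT-++ d₁ Y₁ (suc-injective eq)

selF-++ : ∀ d₁ {d₂} (Y₁ : List A) {Y₂} → length d₁ ≡ length Y₁ → selF (d₁ ++ d₂) (Y₁ ++ Y₂) ≡ selF d₁ Y₁ ++ selF d₂ Y₂
selF-++ []           []       _  = refl
selF-++ (true  ∷ d₁) (y ∷ Y₁) eq = selF-++ d₁ Y₁ (suc-injective eq)
selF-++ (false ∷ d₁) (y ∷ Y₁) eq = cong (y ∷_) (selF-++ d₁ Y₁ (suc-injective eq))

unshuffle-↭ : ∀ d (Y : List A) → length d ≡ length Y → selT d Y ++ selF d Y ↭ Y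
unshuffle-↭ []          []      _  = ↭-refl
unshuffle-↭ (true  ∷ d) (y ∷ Y) eq = prep y (unshuffle-↭ d Y (suc-injective eq))
unshuffle-↭ (false ∷ d) (y ∷ Y) eq = ↭-trans (Permₚ.shift y (selT d Y) _) (prep y (unshuffle-↭ d Y (suc-injective eq)))

selT-injective : ∀ d d′ {Y : List A} → Unique Y → length d ≡ length Y → length d′ ≡ length Y → selT d Y ≡ selT d′ Y → d ≡ d′
selT-injective []          []           {[]}    _        _  _  _  = refl
selT-injective (true  ∷ d) (true  ∷ d′) {y ∷ Y} (_ ∷ un) e  e′ eq =
  cong (true ∷_) (selT-injective d d′ un (suc-injective e) (suc-injective e′) (∷-injectiveʳ eq))
selT-injective (false ∷ d) (false ∷ d′) {y ∷ Y} (_ ∷ un) e  e′ eq =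
  cong (false ∷_) (selT-injective d d′ un (suc-injective e) (suc-injective e′) eq)
selT-injective (true  ∷ d) (false ∷ d′) {y ∷ Y} un       e  e′ eq =
  contradiction (Subₚ.Any-resp-⊆ (selT-⊆ d′ Y) (subst (y ∈_) eq (here refl))) (Unique-∉ un)
selT-injective (false ∷ d) (true  ∷ d′) {y ∷ Y} un       e  e′ eq =
  contradiction (Subₚ.Any-resp-⊆ (selT-⊆ d Y) (subst (y ∈_) (sym eq) (here refl))) (Unique-∉ un)

length-trues-falses : ∀ d → length d ≡ trues d + falses d
length-trues-falses []          = refl
length-trues-falses (true  ∷ d) = cong suc (length-trues-falses d)
length-trues-falses (false ∷ d) = trans (cong suc (length-trues-falses d)) (sym (+-suc (trues d) (falses d)))

trues-++ : ∀ d₁ d₂ → trues (d₁ ++ d₂) ≡ trues d₁ + trues d₂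
trues-++ []           d₂ = refl
trues-++ (true  ∷ d₁) d₂ = cong suc (trues-++ d₁ d₂)
trues-++ (false ∷ d₁) d₂ = trues-++ d₁ d₂

falses-++ : ∀ d₁ d₂ → falses (d₁ ++ d₂) ≡ falses d₁ + falses d₂
falses-++ []           d₂ = refl
falses-++ (true  ∷ d₁) d₂ = falses-++ d₁ d₂
falses-++ (false ∷ d₁) d₂ = cong suc (falses-++ d₁ d₂)

sign-square : ∀ m → sign m ℤ.* sign m ≡ 1ℤ
sign-square m = trans (sym (sign-+ m m)) (sign-even m)

unshuffle-sgn : ∀ a d Y → Unique Y → length d ≡ length Y →
                sgn (a ++ selT d Y ++ selF d Y) ≡ pathSign d ℤ.* sgn (a ++ Y)
unshuffle-sgn a []          []      _ _ = sym (ℤₚ.*-identityˡ _)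
unshuffle-sgn a (true  ∷ d) (y ∷ Y) (_ ∷ un) eq = begin
  sgn (a ++ y ∷ selT d Y ++ selF d Y)                ≡⟨ cong sgn (++-assoc a [ y ] _) ⟨
  sgn ((a ++ [ y ]) ++ selT d Y ++ selF d Y)         ≡⟨ unshuffle-sgn (a ++ [ y ]) d Y un (suc-injective eq) ⟩
  pathSign d ℤ.* sgn ((a ++ [ y ]) ++ Y)             ≡⟨ cong (λ w → pathSign d ℤ.* sgn w) (++-assoc a [ y ] Y) ⟩
  pathSign d ℤ.* sgn (a ++ y ∷ Y)                    ∎
  where open ≡-Reasoning
unshuffle-sgn a (false ∷ d) (y ∷ Y) (r ∷ un) eq = begin
  sgn (a ++ t ++ y ∷ f)                              ≡⟨ ℤₚ.*-identityˡ _ ⟨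
  -- `sgn-move` contributes its factor when `y` stands before `t`; writing 1 as a square supplies
  -- that factor and leaves the one demanded by `pathSign`.
  1ℤ ℤ.* sgn (a ++ t ++ y ∷ f)                       ≡⟨ cong (ℤ._* sgn (a ++ t ++ y ∷ f)) (sign-square (trues d)) ⟨
  σ ℤ.* σ ℤ.* sgn (a ++ t ++ y ∷ f)                  ≡⟨ ℤₚ.*-assoc σ σ _ ⟩
  σ ℤ.* (σ ℤ.* sgn (a ++ t ++ y ∷ f))                ≡⟨ cong (λ m → σ ℤ.* (sign m ℤ.* sgn (a ++ t ++ y ∷ f))) (length-selT d Y (suc-injective eq)) ⟨
  σ ℤ.* (sign (length t) ℤ.* sgn (a ++ t ++ y ∷ f))  ≡⟨ cong (σ ℤ.*_) (sgn-move a y t f (Subₚ.All-resp-⊆ (selT-⊆ d Y) r)) ⟨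
  σ ℤ.* sgn (a ++ y ∷ t ++ f)                        ≡⟨ cong (λ w → σ ℤ.* sgn w) (++-assoc a [ y ] _) ⟨
  σ ℤ.* sgn ((a ++ [ y ]) ++ t ++ f)                 ≡⟨ cong (σ ℤ.*_) (unshuffle-sgn (a ++ [ y ]) d Y un (suc-injective eq)) ⟩
  σ ℤ.* (pathSign d ℤ.* sgn ((a ++ [ y ]) ++ Y))     ≡⟨ ℤₚ.*-assoc σ (pathSign d) _ ⟨
  σ ℤ.* pathSign d ℤ.* sgn ((a ++ [ y ]) ++ Y)       ≡⟨ cong (λ w → σ ℤ.* pathSign d ℤ.* sgn w) (++-assoc a [ y ] Y) ⟩
  σ ℤ.* pathSign d ℤ.* sgn (a ++ y ∷ Y)              ∎
  where
  open ≡-Reasoning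
  t = selT d Y
  f = selF d Y
  σ = sign (trues d)

∈-paths-falses : ∀ h t {d} → d ∈ paths h t → falses d ≡ h + t
∈-paths-falses zero    zero    (here refl) = refl
∈-paths-falses (suc h) zero    d∈ with ∈-map⁻ (false ∷_) d∈
... | d , d∈′ , refl = cong suc (∈-paths-falses h zero d∈′)
∈-paths-falses (suc h) (suc t) d∈ with ∈-++⁻ (map (true ∷_) (paths (suc (suc h)) t)) d∈
... | inj₁ d∈₁ with ∈-map⁻ (true ∷_) d∈₁
...   | d , d∈′ , refl = trans (∈-paths-falses (suc (suc h)) t d∈′) (cong suc (sym (+-suc h t)))
∈-paths-falses (suc h) (suc t) d∈ | inj₂ d∈₂ with ∈-map⁻ (false ∷_) d∈₂
...   | d , d∈′ , refl = cong suc (∈-paths-falses h (suc t) d∈′)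

-- Steps change the height by one, so a path that avoids height 0 before its end stays positive up
-- to there. The proviso on `d₂` exempts the end itself.
∈-paths⁺ : ∀ h t d → trues d ≡ t → falses d ≡ h + t →
           (∀ d₁ d₂ → d ≡ d₁ ++ d₂ → d₂ ≢ [] → h + trues d₁ ≢ falses d₁) → d ∈ paths h t
∈-paths⁺ zero    zero    []          _  _  _ = here refl
∈-paths⁺ zero    (suc t) []          () _  _
∈-paths⁺ (suc h) t       []          _  () _
∈-paths⁺ zero    t       (x ∷ d)     _  _  positive = contradiction refl (positive [] (x ∷ d) refl λ ())
∈-paths⁺ (suc h) zero    (false ∷ d) e  e′ positive = ∈-map⁺ (false ∷_) (∈-paths⁺ h zero d e (suc-injective e′)
  λ { d₁ d₂ refl ne eq → positive (false ∷ d₁) d₂ refl ne (cong suc eq) })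
∈-paths⁺ (suc h) (suc t) (true  ∷ d) e  e′ positive = ∈-++⁺ˡ (∈-map⁺ (true ∷_) (∈-paths⁺ (suc (suc h)) t d (suc-injective e)
  (trans e′ (cong suc (+-suc h t)))
  λ { d₁ d₂ refl ne eq → positive (true ∷ d₁) d₂ refl ne (trans (cong suc (+-suc h (trues d₁))) eq) }))
∈-paths⁺ (suc h) (suc t) (false ∷ d) e  e′ positive = ∈-++⁺ʳ (map (true ∷_) (paths (suc (suc h)) t))
  (∈-map⁺ (false ∷_) (∈-paths⁺ h (suc t) d e (suc-injective e′)
  λ { d₁ d₂ refl ne eq → positive (false ∷ d₁) d₂ refl ne (cong suc eq) }))

∈-paths-after-false : ∀ h t {d} → d ∈ paths h t →
  (∀ d₁ d₂ → d ≡ d₁ ++ false ∷ d₂ → d₂ ≢ [] → suc (falses d₁) < h + trues d₁) →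
  ∀ d₁ d₂ → false ∷ d ≡ d₁ ++ false ∷ d₂ → d₂ ≢ [] → suc (falses d₁) < suc h + trues d₁
-- A down-step to height 0 is the last step, contrary to the proviso.
∈-paths-after-false zero zero (here refl) ih [] d₂ eq ne = contradiction (sym (∷-injectiveʳ eq)) ne
∈-paths-after-false (suc h) t d∈ ih []           d₂ eq ne = s≤s (s≤s z≤n)
∈-paths-after-false h       t d∈ ih (false ∷ d₁) d₂ eq ne = s≤s (ih d₁ d₂ (∷-injectiveʳ eq) ne)

-- Positivity can only be lost at a down-step, so it is recorded right after each one that is not
-- last. This is the form that `¬Inner` consumes.
∈-paths⁻ : ∀ h t {d} → d ∈ paths h t → ∀ d₁ d₂ → d ≡ d₁ ++ false ∷ d₂ → d₂ ≢ [] → suc (falses d₁) < h + trues d₁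
∈-paths⁻ zero zero (here refl) [] _ () _
∈-paths⁻ zero zero (here refl) (_ ∷ _) _ () _
∈-paths⁻ (suc h) zero d∈ with ∈-map⁻ (false ∷_) d∈
... | d , d∈′ , refl = ∈-paths-after-false h zero d∈′ (∈-paths⁻ h zero d∈′)
∈-paths⁻ (suc h) (suc t) d∈ with ∈-++⁻ (map (true ∷_) (paths (suc (suc h)) t)) d∈
∈-paths⁻ (suc h) (suc t) d∈ | inj₁ d∈₁ with ∈-map⁻ (true ∷_) d∈₁
... | d , d∈′ , refl = λ where
  (true ∷ d₁) d₂ eq ne → ≤-trans (∈-paths⁻ (suc (suc h)) t d∈′ d₁ d₂ (∷-injectiveʳ eq) ne)
                           (≤-reflexive (cong suc (sym (+-suc h (trues d₁)))))
∈-paths⁻ (suc h) (suc t) d∈ | inj₂ d∈₂ with ∈-map⁻ (false ∷_) d∈₂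
... | d , d∈′ , refl = ∈-paths-after-false h (suc t) d∈′ (∈-paths⁻ h (suc t) d∈′)

split-at-false : ∀ i d → i < falses d → ∃₂ λ d₁ d₂ → d ≡ d₁ ++ false ∷ d₂ × falses d₁ ≡ i
split-at-false i (true ∷ d) i< with split-at-false i d i<
... | d₁ , d₂ , refl , e = true ∷ d₁ , d₂ , refl , e
split-at-false zero    (false ∷ d) _ = [] , d , refl , refl
split-at-false (suc i) (false ∷ d) (s≤s i<) with split-at-false i d i<
... | d₁ , d₂ , refl , e = false ∷ d₁ , d₂ , refl , cong suc e

split-length : ∀ i (w : List A) {j} → length w ≡ i + j → ∃₂ λ a b → w ≡ a ++ b × length a ≡ i × length b ≡ j
split-length zero    w       eq = [] , w , refl , refl , eq
split-length (suc i) (x ∷ w) eq with split-length i w (suc-injective eq)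
... | a , b , refl , e , e′ = x ∷ a , b , refl , cong suc e , e′

-- The cyclic order that starts at b

module Keyed (f : A → ℕ) where

  KeySorted : List A → Set
  KeySorted = AllPairs (λ x y → f x < f y)

  Merge : List A → List A → Set
  Merge A D = ∃₂ λ d Y → KeySorted Y × selT d Y ≡ A × selF d Y ≡ D × length d ≡ length Y

  merge-true : ∀ {a A D} → All (λ y → f a < f y) A → All (λ y → f a < f y) D → Merge A D → Merge (a ∷ A) D
  merge-true {a} r t (d , Y , ks , refl , refl , len) = true ∷ d , a ∷ Y ,
    (Permₚ.All-resp-↭ (unshuffle-↭ d Y len) (Allₚ.++⁺ r t) ∷ ks) , refl , refl , cong suc len

  merge-false : ∀ {c A D} → All (λ y → f c < f y) A → All (λ y → f c < f y) D → Merge A D → Merge A (c ∷ D)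
  merge-false {c} r t (d , Y , ks , refl , refl , len) = false ∷ d , c ∷ Y ,
    (Permₚ.All-resp-↭ (unshuffle-↭ d Y len) (Allₚ.++⁺ r t) ∷ ks) , refl , refl , cong suc len

  merge-∷ : ∀ {a c A D} → All (λ y → f a < f y) A → All (λ y → f c < f y) D → f a ≢ f c →
            Merge A (c ∷ D) → Merge (a ∷ A) D → Merge (a ∷ A) (c ∷ D)
  merge-∷ {a} {c} r t ne m₁ m₂ with <-cmp (f a) (f c)
  ... | tri≈ _ eq _  = contradiction eq ne
  ... | tri< a<c _ _ = merge-true r (a<c ∷ All.map (<-trans a<c) t) m₁
  ... | tri> _ _ c<a = merge-false (c<a ∷ All.map (<-trans c<a) r) t m₂

  -- Merging two sorted lists while recording in a path which list supplied each letter; unshuffling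
  -- along the path undoes the merge. This recovers the path of an extremal word.
  merge-paths : ∀ A D → KeySorted A → KeySorted D → (∀ {a c} → a ∈ A → c ∈ D → f a ≢ f c) → Merge A D
  merge-paths [] [] _ _ _ = [] , [] , [] , refl , refl , refl
  merge-paths [] (c ∷ D) ks (r ∷ rs) ne = merge-false [] r (merge-paths [] D ks rs (λ ()))
  merge-paths (a ∷ A) [] (r ∷ rs) ks ne = merge-true r [] (merge-paths A [] rs ks (λ _ ()))
  merge-paths (a ∷ A) (c ∷ D) (r ∷ rs) (t ∷ ts) ne = merge-∷ r t (ne (here refl) (here refl))
    (merge-paths A (c ∷ D) rs (t ∷ ts) (ne ∘ there))
    (merge-paths (a ∷ A) D (r ∷ rs) ts (λ a∈ c∈ → ne a∈ (there c∈)))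

-- Letters below `b` are lifted by n beyond all the others, so the cyclic order of 1, ..., n read
-- from `b` becomes the order of the keys.
key : ℕ → ℕ → ℕ → ℕ
key n b v with v <? b
... | yes _ = v + n
... | no _  = v

key-≥ : ∀ {n b v} → b ≤ v → key n b v ≡ v
key-≥ {n} {b} {v} b≤v with v <? b
... | yes v<b = contradiction b≤v (<⇒≱ v<b)
... | no _    = refl

key-< : ∀ {n b v} → v < b → key n b v ≡ v + n
key-< {n} {b} {v} v<b with v <? b
... | yes _   = refl
... | no v≮b = contradiction v<b v≮b

key-injective : ∀ {n b x y} → InRange n x → InRange n y → key n b x ≡ key n b y → x ≡ y
key-injective {n} {b} {x} {y} (1≤x , x≤n) (1≤y , y≤n) eq with x <? b | y <? b
... | yes _ | yes _ = +-cancelʳ-≡ n x y eq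
... | no _  | no _  = eq
... | yes _ | no _  = contradiction (≤-trans (+-monoˡ-≤ n 1≤x) (≤-trans (≤-reflexive eq) y≤n)) (<-irrefl refl)
... | no _  | yes _ = contradiction (≤-trans (+-monoˡ-≤ n 1≤y) (≤-trans (≤-reflexive (sym eq)) x≤n)) (<-irrefl refl)

module _ (n b : ℕ) where
  open Keyed (key n b)

  KeySorted-≥ : ∀ s → All (b ≤_) s → Sorted s → KeySorted s
  KeySorted-≥ []      _        _        = []
  KeySorted-≥ (x ∷ s) (p ∷ ps) (r ∷ rs) =
    All.zipWith (λ (q , lt) → subst₂ _<_ (sym (key-≥ p)) (sym (key-≥ q)) lt) (ps , r) ∷ KeySorted-≥ s ps rs

  KeySorted-< : ∀ s → All (_< b) s → Sorted s → KeySorted s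
  KeySorted-< []      _        _        = []
  KeySorted-< (x ∷ s) (p ∷ ps) (r ∷ rs) =
    All.zipWith (λ (q , lt) → subst₂ _<_ (sym (key-< p)) (sym (key-< q)) (+-monoˡ-< n lt)) (ps , r) ∷ KeySorted-< s ps rs

  -- The sorted word is cut right before `b`: the piece from `b` on keeps its values, the other
  -- piece lies below `b` and is lifted behind it.
  CI⇒KeySorted : ∀ {Z} → CI (b ∷ Z) → All (InRange n) (b ∷ Z) → KeySorted (b ∷ Z)
  CI⇒KeySorted (_ , ss , p , [] , refl , eq) range with eq
  ... | refl with subst Sorted (++-identityʳ p) ss
  ...   | r ∷ rs = KeySorted-≥ _ (≤-refl ∷ All.map <⇒≤ r) (r ∷ rs)
  CI⇒KeySorted (_ , ss , p , q₀ ∷ q , refl , eq) range with ∷-injective eq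
  ... | refl , refl = AllPairsₚ.++⁺
      (KeySorted-≥ (b ∷ q) (≤-refl ∷ All.map <⇒≤ (AllPairs.head ssq)) ssq)
      (KeySorted-< p p<b (AllPairs-⊆ (⊆-++ˡ p (b ∷ q)) ss))
      (All.zipWith (λ (b≤x , rx) → All.zipWith (λ (y<b , ry) →
        subst₂ _<_ (sym (key-≥ b≤x)) (sym (key-< y<b)) (≤-<-trans (proj₂ rx) (+-monoˡ-≤ n (proj₁ ry)))) (p<b , Allₚ.++⁻ʳ (b ∷ q) range))
        ((≤-refl ∷ All.map <⇒≤ (AllPairs.head ssq)) , Allₚ.++⁻ˡ (b ∷ q) range))
    where
    ssq : Sorted (b ∷ q)
    ssq = AllPairs-⊆ (⊆-++ʳ p (b ∷ q)) ss
    before : ∀ p → Sorted (p ++ b ∷ q) → All (_< b) p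
    before []      _        = []
    before (x ∷ p) (r ∷ rs) = All.lookup (Allₚ.++⁻ʳ p r) (here refl) ∷ before p rs
    p<b : All (_< b) p
    p<b = before p ss

-- Rotations of the identity

drop-applyUpTo : ∀ (f : ℕ → ℕ) {i n} → i < n → ∃ λ r → drop i (applyUpTo f n) ≡ f i ∷ r
drop-applyUpTo f {zero}  {suc n} _ = _ , refl
drop-applyUpTo f {suc i} {suc n} (s≤s i<n) = drop-applyUpTo (f ∘ suc) i<n

cycShift-head : ∀ {i n} → i < n → ∃ λ r → cycShift n i ≡ suc i ∷ r
cycShift-head {i} {n} i<n with drop-applyUpTo suc i<n
... | r , eq = r ++ take i (idWord n) , cong (_++ take i (idWord n)) eq

∈-M⁻ : ∀ {n X} → X ∈ M n → ∃ λ i → i < n × X ≡ cycShift n i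
∈-M⁻ {n} X∈ with ∈-map⁻ (cycShift n) X∈
... | i , i∈ , eq = i , ∈-upTo⁻ i∈ , eq

∈-M-Rot : ∀ {n X} → X ∈ M n → Rot (idWord n) X
∈-M-Rot {n} X∈ with ∈-M⁻ X∈
... | i , _ , refl = take i (idWord n) , drop i (idWord n) , sym (take++drop≡id i (idWord n)) , refl

∈-M-CI : ∀ {n X} → X ∈ M n → CI X
∈-M-CI {n} X∈ = idWord n , idWord-sorted n , ∈-M-Rot X∈

∈-M-IsPerm : ∀ {n X} → X ∈ M n → IsPerm n X
∈-M-IsPerm X∈ = ↭-sym (rot-↭ (∈-M-Rot X∈))

∈-M-head : ∀ {n b X X′} → b ∷ X ∈ M n → b ∷ X′ ∈ M n → X ≡ X′
∈-M-head X∈ X′∈ with ∈-M⁻ X∈ | ∈-M⁻ X′∈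
... | i , i<n , eq | j , j<n , eq′ with cycShift-head i<n | cycShift-head j<n
...   | r , e | r′ , e′ with ∷-injectiveˡ (trans eq e) | ∷-injectiveˡ (trans eq′ e′)
...     | refl | refl = ∷-injectiveʳ (trans eq (sym eq′))

InRange⇒∈-M : ∀ {n b} → InRange n b → ∃ λ X → b ∷ X ∈ M n
InRange⇒∈-M {n} {suc i} (_ , i<n) with cycShift-head i<n
... | r , eq = r , subst (_∈ M n) eq (∈-map⁺ (cycShift n) (∈-upTo⁺ i<n))

M-Unique : ∀ n → Unique (M n)
M-Unique n = Unique-map (cycShift n) injective (Uniqueₚ.upTo⁺ n)
  where
  injective : ∀ {i j} → i ∈ upTo n → j ∈ upTo n → cycShift n i ≡ cycShift n j → i ≡ j
  injective i∈ j∈ eq with cycShift-head (∈-upTo⁻ i∈) | cycShift-head (∈-upTo⁻ j∈)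
  ... | _ , e | _ , e′ = suc-injective (∷-injectiveˡ (trans (sym e) (trans eq e′)))

-- Words whose first and last windows only are cyclically increasing

∑-cartesianProduct : ∀ {X Y : Set} (xs : List X) (ys : List Y) (g : Y → ℤ) →
                     ∑ (cartesianProduct xs ys) (g ∘ proj₂) ≡ ℤ.+ length xs ℤ.* ∑ ys g
∑-cartesianProduct []       ys g = sym (ℤₚ.*-zeroˡ (∑ ys g))
∑-cartesianProduct (x ∷ xs) ys g = trans (∑-++ (map (x ,_) ys) (cartesianProduct xs ys) (g ∘ proj₂))
  (trans (cong₂ ℤ._+_ (∑-map (x ,_) ys (g ∘ proj₂)) (∑-cartesianProduct xs ys g)) (sym (ℤₚ.suc-* (ℤ.+ length xs) (∑ ys g))))

paths-Unique : ∀ h t → Unique (paths h t)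
paths-Unique zero    zero    = [] ∷ []
paths-Unique zero    (suc t) = []
paths-Unique (suc h) zero    = Uniqueₚ.map⁺ ∷-injectiveʳ (paths-Unique h zero)
paths-Unique (suc h) (suc t) = Uniqueₚ.++⁺ (Uniqueₚ.map⁺ ∷-injectiveʳ (paths-Unique (suc (suc h)) t))
  (Uniqueₚ.map⁺ ∷-injectiveʳ (paths-Unique h (suc t))) λ (p , q) → disjoint (∈-map⁻ (true ∷_) p) (∈-map⁻ (false ∷_) q)
  where
  disjoint : ∀ {v P Q} → (∃ λ d → d ∈ P × v ≡ true ∷ d) → ¬ (∃ λ d → d ∈ Q × v ≡ false ∷ d)
  disjoint (_ , _ , refl) (_ , _ , ())

module ExtremalWords (s k₀ : ℕ) (k-odd : sign (suc k₀) ≡ -1ℤ) where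

  open Sieve (s + s) k₀
  open Windows (s + s + k) using (c; NA)

  -- The shape of an extremal word: `B` is the overlap of the first and the last window, and the
  -- path sends each letter of `Y` either in front of `B` or behind it.
  assemble : List Bool → List ℕ → List ℕ → List ℕ
  assemble d B Y = selT d Y ++ B ++ selF d Y

  word : List Bool → List ℕ → List ℕ
  word d X = assemble d (take k X) (drop k X)

  word-++ : ∀ d B Y → length B ≡ k → word d (B ++ Y) ≡ assemble d B Y
  word-++ d B Y len = cong₂ (assemble d) (proj₁ eqs) (proj₂ eqs)
    where
    eqs : take k (B ++ Y) ≡ B × drop k (B ++ Y) ≡ Y
    eqs = ++-cancel-length (take k (B ++ Y)) B (take++drop≡id k (B ++ Y))
      (trans (length-take k (B ++ Y)) (trans (m≤n⇒m⊓n≡m (≤-trans (≤-reflexive (sym len))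
        (≤-trans (m≤m+n (length B) (length Y)) (≤-reflexive (sym (length-++ B)))))) (sym len)))

  n-split : n ≡ k + (M′ + M′)
  n-split = lem k (s + s)
    where
    lem : ∀ k m → suc (suc (m + k)) + suc (suc m) ≡ k + (suc (suc m) + suc (suc m))
    lem = solve-∀

  ∈-M-split : ∀ {X} → X ∈ M n → ∃₂ λ b B → ∃ λ Y → X ≡ b ∷ B ++ Y × length (b ∷ B) ≡ k × length Y ≡ M′ + M′
  ∈-M-split {X} X∈ with split-length k X (trans (IsPerm-length (∈-M-IsPerm X∈)) n-split)
  ... | b ∷ B , Y , eq , e , e′ = b , B , Y , eq , e , e′

  excursion-counts : ∀ {d} → d ∈ excursions s → trues d ≡ M′ × falses d ≡ M′
  excursion-counts d∈ with ∈-map⁻ (true ∷_) d∈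
  ... | d , d∈′ , refl = cong suc (∈-paths-trues 1 M₁ d∈′) , ∈-paths-falses 1 M₁ d∈′

  excursion-length : ∀ {d} → d ∈ excursions s → length d ≡ M′ + M′
  excursion-length {d} d∈ = trans (length-trues-falses d) (cong₂ _+_ (proj₁ (excursion-counts d∈)) (proj₂ (excursion-counts d∈)))

  -- Moving the window past `A₁` drops `A₁` and gains `C₁`, which is why their lengths agree.
  -- Rotated to start with `B`, the window reads `B ++ C₁ ++ A₂`, so it is cyclically increasing
  -- once `C₁` precedes `A₂` in `Y`.
  assemble-Win : ∀ {A₁ A₂ B C₁ C₂ Y} → CI (B ++ Y) → C₁ ++ A₂ ⊆ Y → length B ≡ k →
                 length A₁ ≡ length C₁ → length (A₁ ++ A₂) ≡ M′ → Win (length A₁) ((A₁ ++ A₂) ++ B ++ C₁ ++ C₂)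
  assemble-Win {A₁} {A₂} {B} {C₁} {C₂} ci τ lenB eq lenA = subst CI (sym (begin
      window (length A₁) ((A₁ ++ A₂) ++ B ++ C₁ ++ C₂)   ≡⟨ cong (window (length A₁)) assoc ⟩
      window (length A₁) (A₁ ++ (A₂ ++ B ++ C₁) ++ C₂)   ≡⟨ window-++ A₁ (A₂ ++ B ++ C₁) C₂ len ⟩
      A₂ ++ B ++ C₁                                      ∎))
    (CI-rot (CI-⊆ (HSub.++⁺ (⊆-refl {x = B}) τ) ci) (B ++ C₁ , A₂ , sym (++-assoc B C₁ A₂) , refl))
    where
    open ≡-Reasoning
    assoc : (A₁ ++ A₂) ++ B ++ C₁ ++ C₂ ≡ A₁ ++ (A₂ ++ B ++ C₁) ++ C₂
    assoc = trans (++-assoc A₁ A₂ _) (cong (A₁ ++_) (sym (trans (++-assoc A₂ (B ++ C₁) C₂) (cong (A₂ ++_) (++-assoc B C₁ C₂)))))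
    len : length (A₂ ++ B ++ C₁) ≡ c
    len = begin
      length (A₂ ++ B ++ C₁)                ≡⟨ length-++ A₂ ⟩
      length A₂ + length (B ++ C₁)          ≡⟨ cong (length A₂ +_) (length-++ B) ⟩
      length A₂ + (length B + length C₁)    ≡⟨ cong (length A₂ +_) (+-comm (length B) _) ⟩
      length A₂ + (length C₁ + length B)    ≡⟨ +-assoc (length A₂) _ _ ⟨
      length A₂ + length C₁ + length B      ≡⟨ cong (_+ length B) (+-comm (length A₂) _) ⟩
      length C₁ + length A₂ + length B      ≡⟨ cong₂ (λ x y → x + length A₂ + y) (sym eq) lenB ⟩
      length A₁ + length A₂ + k             ≡⟨ cong (_+ k) (trans (sym (length-++ A₁)) lenA) ⟩
      c                                     ∎

  module Assembled {d b B Y} (X∈ : b ∷ B ++ Y ∈ M n) (lenB : length (b ∷ B) ≡ k) (lenY : length Y ≡ M′ + M′)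
                   (d∈ : d ∈ excursions s) where

    private
      X : List ℕ
      X = b ∷ B ++ Y
      ciX : CI X
      ciX = ∈-M-CI X∈
      unX : Unique X
      unX = IsPerm⇒Unique (∈-M-IsPerm X∈)
      lend : length d ≡ length Y
      lend = trans (excursion-length d∈) (sym lenY)
      lenA : length (selT d Y) ≡ M′
      lenA = trans (length-selT d Y lend) (proj₁ (excursion-counts d∈))
      lenC : length (selF d Y) ≡ M′
      lenC = trans (length-selF d Y lend) (proj₂ (excursion-counts d∈))
      w : List ℕ
      w = assemble d (b ∷ B) Y

    assemble-IsPerm : IsPerm n w
    assemble-IsPerm = ↭-trans (Permₚ.shifts (selT d Y) (b ∷ B))
      (↭-trans (Permₚ.++⁺ˡ (b ∷ B) (unshuffle-↭ d Y lend)) (∈-M-IsPerm X∈))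

    Win-first : Win 0 w
    Win-first = assemble-Win {[]} {selT d Y} {b ∷ B} {[]} {selF d Y} ciX (selT-⊆ d Y) lenB refl lenA

    Win-last : Win M′ w
    Win-last = subst (λ i → Win i w) lenA
      (subst₂ (λ u v → Win (length (selT d Y)) (u ++ (b ∷ B) ++ v)) (++-identityʳ (selT d Y)) (++-identityʳ (selF d Y))
        (assemble-Win {selT d Y} {[]} {b ∷ B} {selF d Y} {[]} ciX (subst (_⊆ Y) (sym (++-identityʳ (selF d Y))) (selF-⊆ d Y))
          lenB (trans lenA (sym lenC)) (trans (cong length (++-identityʳ (selT d Y))) lenA)))

    -- Read from b on, the (i + 2)-nd letter a of the first part precedes the (i + 1)-st letter y of the last part.
    ¬Inner : ¬ Inner w
    ¬Inner (i , i<M₁ , win) with ∈-map⁻ (true ∷_) d∈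
    ... | d′ , d′∈ , refl with split-at-false i d′ (subst (i <_) (sym (∈-paths-falses 1 M₁ d′∈)) (≤-trans i<M₁ (n≤1+n M₁)))
    ...   | d₁ , d₂ , refl , e with split-length (suc (length d₁)) Y {suc (length d₂)} (trans (sym lend) (cong suc (length-++ d₁)))
    ...     | Y₁ , y ∷ Y₂ , refl , lenY₁ , lenY₂ with split-length (suc i) (selT (true ∷ d₁) Y₁) {suc (trues d₁ ∸ suc i)}
                (trans (length-selT (true ∷ d₁) Y₁ (sym lenY₁)) (cong suc (sym (trans (+-suc i _) (m+[n∸m]≡n i<t)))))
      where
      -- The down-step in question has number i + 1, whereas the last one has number M₁ + 1 and i <
      -- M₁.
      d₂≢[] : d₂ ≢ []
      d₂≢[] refl = <⇒≢ i<M₁ (suc-injective (begin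
        suc i                          ≡⟨ cong suc e ⟨
        suc (falses d₁)                ≡⟨ +-comm (falses d₁) 1 ⟨
        falses d₁ + 1                  ≡⟨ falses-++ d₁ (false ∷ []) ⟨
        falses (d₁ ++ false ∷ [])      ≡⟨ ∈-paths-falses 1 M₁ d′∈ ⟩
        suc M₁                         ∎))
        where open ≡-Reasoning
      -- The height is still positive after this down-step. Counting the initial up-step, at least i
      -- + 2 letters have gone to the first part by then, so `a` exists.
      i<t : suc i ≤ trues d₁
      i<t = ≤-pred (subst (λ m → suc m < 1 + trues d₁) e (∈-paths⁻ 1 M₁ d′∈ d₁ d₂ refl d₂≢[]))
    ...       | P , a ∷ Q , eqA , lenP , _ = <-asym (chain ksX) (chain ksW)
      where
      open Keyed (key n b)
      D₁ = true ∷ d₁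
      A₂ = selT (false ∷ d₂) (y ∷ Y₂)
      C₁ = selF D₁ Y₁
      C₂ = selF d₂ Y₂
      win′ : CI ((a ∷ Q ++ A₂) ++ (b ∷ B) ++ C₁ ++ [ y ])
      win′ = subst CI (trans (cong₂ window (sym lenP) weq) (window-++ P _ C₂ len)) win
        where
        open ≡-Reasoning
        weq : w ≡ P ++ ((a ∷ Q ++ A₂) ++ (b ∷ B) ++ C₁ ++ [ y ]) ++ C₂
        weq = begin
          w ≡⟨ cong₂ (λ u v → u ++ (b ∷ B) ++ v) (trans (selT-++ D₁ Y₁ (sym lenY₁)) (cong (_++ A₂) eqA)) (selF-++ D₁ Y₁ (sym lenY₁)) ⟩
          ((P ++ a ∷ Q) ++ A₂) ++ (b ∷ B) ++ C₁ ++ y ∷ C₂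
            ≡⟨ cong₂ (λ u v → u ++ (b ∷ B) ++ v) (++-assoc P (a ∷ Q) A₂) (sym (++-assoc C₁ [ y ] C₂)) ⟩
          (P ++ a ∷ Q ++ A₂) ++ (b ∷ B) ++ (C₁ ++ [ y ]) ++ C₂
            ≡⟨ ++-assoc P (a ∷ Q ++ A₂) _ ⟩
          P ++ (a ∷ Q ++ A₂) ++ (b ∷ B) ++ (C₁ ++ [ y ]) ++ C₂
            ≡⟨ cong (λ t → P ++ (a ∷ Q ++ A₂) ++ t) (sym (++-assoc (b ∷ B) (C₁ ++ [ y ]) C₂)) ⟩
          P ++ (a ∷ Q ++ A₂) ++ ((b ∷ B) ++ C₁ ++ [ y ]) ++ C₂
            ≡⟨ cong (P ++_) (sym (++-assoc (a ∷ Q ++ A₂) ((b ∷ B) ++ C₁ ++ [ y ]) C₂)) ⟩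
          P ++ ((a ∷ Q ++ A₂) ++ (b ∷ B) ++ C₁ ++ [ y ]) ++ C₂ ∎
        lenC₁ : length (C₁ ++ [ y ]) ≡ length P
        lenC₁ = trans (length-∷ʳ C₁ y) (trans (cong suc (trans (length-selF D₁ Y₁ (sym lenY₁)) e)) (sym lenP))
        len : length ((a ∷ Q ++ A₂) ++ (b ∷ B) ++ C₁ ++ [ y ]) ≡ c
        len = begin
          length ((a ∷ Q ++ A₂) ++ (b ∷ B) ++ C₁ ++ [ y ])   ≡⟨ Permₚ.↭-length (Permₚ.shifts (a ∷ Q ++ A₂) (b ∷ B)) ⟩
          length ((b ∷ B) ++ (a ∷ Q ++ A₂) ++ C₁ ++ [ y ])   ≡⟨ length-++ (b ∷ B) ⟩
          length (b ∷ B) + length ((a ∷ Q ++ A₂) ++ C₁ ++ [ y ])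
            ≡⟨ cong₂ _+_ lenB (trans (length-++ (a ∷ Q ++ A₂)) 
                 (trans (cong (length (a ∷ Q ++ A₂) +_) lenC₁) (trans (+-comm _ (length P)) (sym (length-++ P))))) ⟩
          k + length (P ++ a ∷ Q ++ A₂)
            ≡⟨ cong (λ t → k + length t) (trans (sym (++-assoc P (a ∷ Q) A₂))
                 (sym (trans (selT-++ D₁ Y₁ (sym lenY₁)) (cong (_++ A₂) eqA)))) ⟩
          k + length (selT (true ∷ d₁ ++ false ∷ d₂) (Y₁ ++ y ∷ Y₂)) ≡⟨ cong (k +_) lenA ⟩
          k + M′                                             ≡⟨ +-comm k M′ ⟩
          c                                                  ∎
      range : ∀ {v} → v ∈ X → InRange n v
      range = ∈-IsPerm⇒InRange (∈-M-IsPerm X∈)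
      a∈Y₁ : a ∈ Y₁
      a∈Y₁ = Subₚ.Any-resp-⊆ (selT-⊆ D₁ Y₁) (subst (a ∈_) (sym eqA) (∈-++⁺ʳ P (here refl)))
      a⊆ : b ∷ a ∷ y ∷ [] ⊆ X
      a⊆ = refl ∷ HSub.++ˡ B (HSub.++⁺ (from∈ a∈Y₁) (refl ∷ minimum Y₂))
      rb : InRange n b
      rb = range (here refl)
      ra : InRange n a
      ra = range (Subₚ.Any-resp-⊆ a⊆ (there (here refl)))
      ry : InRange n y
      ry = range (Subₚ.Any-resp-⊆ a⊆ (there (there (here refl))))
      ksX : KeySorted (b ∷ a ∷ y ∷ [])
      ksX = CI⇒KeySorted n b (CI-⊆ a⊆ ciX) (rb ∷ ra ∷ ry ∷ [])
      -- The inner window starts with `a` and ends with `y`; read cyclically from `b` it meets `y`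
      -- before `a`, against their order in the rotation of the identity.
      ksW : KeySorted (b ∷ y ∷ a ∷ [])
      ksW = CI⇒KeySorted n b (CI-rot (CI-⊆ (refl ∷ HSub.++ˡ (Q ++ A₂) (refl ∷ HSub.++ˡ B (HSub.++ˡ C₁ (refl ∷ [])))) win′)
              ([ a ] , b ∷ y ∷ [] , refl , refl)) (rb ∷ ry ∷ ra ∷ [])
      chain : ∀ {u v} → KeySorted (b ∷ u ∷ v ∷ []) → key n b u < key n b v
      chain (_ ∷ (lt ∷ []) ∷ _) = lt

    -- The part in front of `B` has even length, so carrying it behind `B` costs no sign. What is
    -- left is the unshuffle of a rotation of the identity, which is even because n is odd.
    assemble-sgn : sgn w ≡ pathSign d
    assemble-sgn = begin
      sgn (selT d Y ++ (b ∷ B) ++ selF d Y)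
        ≡⟨ sgn-exchange [] (selT d Y) (b ∷ B) (selF d Y)
             (++-Unique⁻ (selT d Y) (Unique-⊆ (HSub.++⁺ (⊆-refl {x = selT d Y}) (⊆-++ˡ (b ∷ B) (selF d Y))) (IsPerm⇒Unique assemble-IsPerm))) ⟩
      sign (length (selT d Y) * length (b ∷ B)) ℤ.* sgn ((b ∷ B) ++ selT d Y ++ selF d Y)
        ≡⟨ cong (ℤ._* sgn ((b ∷ B) ++ selT d Y ++ selF d Y)) (sign-*-evenˡ (length (selT d Y)) (length (b ∷ B)) (trans (cong sign lenA) M′-even)) ⟩
      1ℤ ℤ.* sgn ((b ∷ B) ++ selT d Y ++ selF d Y)
        ≡⟨ ℤₚ.*-identityˡ _ ⟩
      sgn ((b ∷ B) ++ selT d Y ++ selF d Y)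
        ≡⟨ unshuffle-sgn (b ∷ B) d Y (Unique-⊆ (⊆-++ʳ (b ∷ B) Y) unX) lend ⟩
      pathSign d ℤ.* sgn X
        ≡⟨ cong (pathSign d ℤ.*_) sgnX ⟩
      pathSign d ℤ.* 1ℤ
        ≡⟨ ℤₚ.*-identityʳ _ ⟩
      pathSign d ∎
      where
      open ≡-Reasoning
      M′-even : sign M′ ≡ 1ℤ
      M′-even = trans (ℤₚ.neg-involutive _) (sign-even s)
      n-odd : sign n ≡ -1ℤ
      n-odd = trans (cong sign n-split) (trans (sign-+ k (M′ + M′)) (cong₂ ℤ._*_ k-odd (sign-even M′)))
      sgnX : sgn X ≡ 1ℤ
      sgnX = begin
        sgn X              ≡⟨ cong sgn (++-identityʳ X) ⟨
        sgn (X ++ [])      ≡⟨ sgn-rot [] [] (∈-M-Rot X∈) (IsPerm⇒Unique {n} ↭-refl) (trans (cong sign (length-applyUpTo suc n)) n-odd) ⟨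
        sgn (idWord n ++ []) ≡⟨ cong sgn (++-identityʳ (idWord n)) ⟩
        sgn (idWord n)     ≡⟨ sgn-sorted (idWord n) (idWord-sorted n) ⟩
        1ℤ                 ∎

    assemble-Extremal : Extremal w
    assemble-Extremal = Win-first , ¬Inner , Win-last

  -- The part in front has the fixed length `M′`, so the letter after it is known. That letter
  -- determines the rotation of the identity, and the letters in front then determine the path.
  assemble-injective : ∀ {d d′ b b′ B B′ Y Y′} → b ∷ B ++ Y ∈ M n → b′ ∷ B′ ++ Y′ ∈ M n →
    length (b ∷ B) ≡ k → length (b′ ∷ B′) ≡ k → length Y ≡ M′ + M′ → length Y′ ≡ M′ + M′ →
    d ∈ excursions s → d′ ∈ excursions s →
    assemble d (b ∷ B) Y ≡ assemble d′ (b′ ∷ B′) Y′ → _≡_ {A = List ℕ} (b ∷ B ++ Y) (b′ ∷ B′ ++ Y′) × d ≡ d′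
  assemble-injective {d} {d′} {b} {b′} {B} {B′} {Y} {Y′} X∈ X′∈ lenB lenB′ lenY lenY′ d∈ d′∈ eq
    with ++-cancel-length (selT d Y) (selT d′ Y′) eq (trans (lenA d∈ lenY) (sym (lenA d′∈ lenY′)))
    where
    lenA : ∀ {d Y} → d ∈ excursions s → length Y ≡ M′ + M′ → length (selT d Y) ≡ M′
    lenA {d} {Y} d∈ lenY = trans (length-selT d Y (trans (excursion-length d∈) (sym lenY))) (proj₁ (excursion-counts d∈))
  ... | eqA , eqBC with ∷-injectiveˡ eqBC
  ...   | refl with ∈-M-head X∈ X′∈
  ...     | eqX with ++-cancel-length (b ∷ B) (b′ ∷ B′) (cong (b ∷_) eqX) (trans lenB (sym lenB′))
  ...       | refl , refl = refl ,
    selT-injective d d′ (Unique-⊆ (⊆-++ʳ (b ∷ B) Y) (IsPerm⇒Unique (∈-M-IsPerm X∈)))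
      (trans (excursion-length d∈) (sym lenY)) (trans (excursion-length d′∈) (sym lenY)) eqA

  -- At an early return to height 0 equally many letters have gone to the front and to the back, and
  -- those sent back so far precede in `Y` all that are still to go to the front. By `assemble-Win`
  -- the window at that position would be cyclically increasing.
  ¬Inner⇒excursion : ∀ {b B} Y d → CI (b ∷ B ++ Y) → length (b ∷ B) ≡ k → length d ≡ length Y → trues d ≡ M′ → falses d ≡ M′ →
                     ¬ Inner (assemble d (b ∷ B) Y) → d ∈ excursions s
  ¬Inner⇒excursion _ [] _ _ _ () _ _
  ¬Inner⇒excursion {b} {B} (y ∷ Y) (false ∷ d) ciBY lenB lend td fd ¬in
    with split-length 1 (selT d Y) (trans (length-selT d Y (suc-injective lend)) td)
  -- If the path starts downwards, the first letter `y` of `Y` is the first behind `B`, and the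
  -- window at position 1 trades `a` for `y`.
  ... | a ∷ [] , A₂ , eqA , _ , _ = contradiction (0 , s≤s z≤n ,
            subst (λ t → Win 1 (t ++ (b ∷ B) ++ y ∷ selF d Y)) (sym eqA)
              (assemble-Win {[ a ]} {A₂} {b ∷ B} {[ y ]} {selF d Y} ciBY
                (refl ∷ ⊆-trans (⊆-trans (⊆-++ʳ [ a ] A₂) (subst (_⊆ selT d Y) eqA ⊆-refl)) (selT-⊆ d Y)) lenB refl
                (trans (cong length (sym eqA)) (trans (length-selT d Y (suc-injective lend)) td)))) ¬in
  ¬Inner⇒excursion {b} {B} Y (true ∷ d) ciBY lenB lend td fd ¬in = ∈-map⁺ (true ∷_) (∈-paths⁺ 1 M₁ d (suc-injective td) fd return-absurd)
    where
    return-absurd : ∀ d₁ d₂ → d ≡ d₁ ++ d₂ → d₂ ≢ [] → 1 + trues d₁ ≢ falses d₁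
    return-absurd d₁ d₂ refl ne eq with split-length (suc (length d₁)) Y (trans (sym lend) (cong suc (length-++ d₁)))
    ... | Y₁ , Y₂ , eqY , lenY₁ , lenY₂ = ¬in (trues d₁ , t<M₁ ,
          subst (λ i → Win i (assemble (true ∷ d₁ ++ d₂) (b ∷ B) Y)) (length-selT (true ∷ d₁) Y₁ (sym lenY₁))
            (subst₂ (λ u v → Win (length A₁) (u ++ (b ∷ B) ++ v))
              (trans (sym (selT-++ (true ∷ d₁) Y₁ (sym lenY₁))) (cong (selT (true ∷ d₁ ++ d₂)) (sym eqY)))
              (trans (sym (selF-++ (true ∷ d₁) Y₁ (sym lenY₁))) (cong (selF (true ∷ d₁ ++ d₂)) (sym eqY)))
              (assemble-Win {A₁} {A₂} {b ∷ B} {C₁} {C₂} ciBY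
                (subst (C₁ ++ A₂ ⊆_) (sym eqY) (HSub.++⁺ (selF-⊆ (true ∷ d₁) Y₁) (selT-⊆ d₂ Y₂))) lenB
                (trans (length-selT (true ∷ d₁) Y₁ (sym lenY₁)) (trans eq (sym (length-selF (true ∷ d₁) Y₁ (sym lenY₁)))))
                lenAA)))
      where
      A₁ = selT (true ∷ d₁) Y₁
      A₂ = selT d₂ Y₂
      C₁ = selF (true ∷ d₁) Y₁
      C₂ = selF d₂ Y₂
      lenAA : length (A₁ ++ A₂) ≡ M′
      lenAA = trans (cong length (trans (sym (selT-++ (true ∷ d₁) Y₁ (sym lenY₁))) (cong (selT (true ∷ d₁ ++ d₂)) (sym eqY))))
        (trans (length-selT (true ∷ d₁ ++ d₂) Y lend) td)
      t≤ : trues d₁ + trues d₂ ≡ M₁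
      t≤ = trans (sym (trues-++ d₁ d₂)) (suc-injective td)
      -- Otherwise all up-steps, and by the return to 0 all down-steps, would be spent, leaving `d₂`
      -- empty.
      t<M₁ : trues d₁ < M₁
      t<M₁ = ≤∧≢⇒< (≤-trans (m≤m+n (trues d₁) (trues d₂)) (≤-reflexive t≤)) λ t≡ →
        ne (empty (+-cancelˡ-≡ (trues d₁) _ _ (trans t≤ (trans (sym t≡) (sym (+-identityʳ _)))))
                  (+-cancelˡ-≡ (falses d₁) _ _ (trans (trans (sym (falses-++ d₁ d₂)) fd)
                     (trans (cong suc (sym t≡)) (trans eq (sym (+-identityʳ _)))))))
        where
        empty : ∀ {d} → trues d ≡ 0 → falses d ≡ 0 → d ≡ []
        empty {[]}        _  _ = refl
        empty {true ∷ d}  () _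
        empty {false ∷ d} _  ()

  -- Cut the word into `A`, the overlap and `D`. Read from the first letter `b` of the overlap, the
  -- first window orders the overlap followed by `A`, the last one the overlap followed by `D`.
  -- Merging `A` and `D` by key gives `Y` and the path.
  Extremal⇒assembled : ∀ {w} → IsPerm n w → Extremal w →
    ∃₂ λ d b → ∃₂ λ B Y → w ≡ assemble d (b ∷ B) Y × b ∷ B ++ Y ∈ M n × length (b ∷ B) ≡ k × length Y ≡ M′ + M′ × d ∈ excursions s
  Extremal⇒assembled {w} σ (win₀ , ¬inner , winM)
    with split-length M′ w (trans (IsPerm-length σ) (trans n-split (lem k M′)))
    where
    lem : ∀ k m → k + (m + m) ≡ m + (k + m)
    lem = solve-∀
  ... | A , w′ , refl , lenA , lenw′ with split-length k w′ lenw′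
  ...   | b ∷ B , D , refl , lenB , lenC = decompose
    where
    open Keyed (key n b)
    range : ∀ {v} → v ∈ A ++ (b ∷ B) ++ D → InRange n v
    range = ∈-IsPerm⇒InRange σ
    ciBA : CI (b ∷ B ++ A)
    ciBA = CI-rot (subst CI (trans (cong (window 0) (sym (++-assoc A (b ∷ B) D))) (window-++ [] (A ++ b ∷ B) D
      (trans (length-++ A) (cong₂ _+_ lenA lenB)))) win₀) (A , b ∷ B , refl , refl)
    ciBC : CI (b ∷ B ++ D)
    ciBC = subst CI (trans (cong₂ window (sym lenA) (cong (A ++_) (sym (++-identityʳ (b ∷ B ++ D)))))
      (window-++ A (b ∷ B ++ D) [] (trans (length-++ (b ∷ B)) (trans (cong₂ _+_ lenB lenC) (+-comm k M′))))) winM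
    rangeA : ∀ {v} → v ∈ A → InRange n v
    rangeA = range ∘ ∈-++⁺ˡ
    rangeC : ∀ {v} → v ∈ D → InRange n v
    rangeC = range ∘ ∈-++⁺ʳ A ∘ ∈-++⁺ʳ (b ∷ B)
    rangeB : ∀ {v} → v ∈ b ∷ B → InRange n v
    rangeB = range ∘ ∈-++⁺ʳ A ∘ ∈-++⁺ˡ
    ksBA : KeySorted (b ∷ B ++ A)
    ksBA = CI⇒KeySorted n b ciBA (Allₚ.++⁺ (All.tabulate rangeB) (All.tabulate rangeA))
    ksBC : KeySorted (b ∷ B ++ D)
    ksBC = CI⇒KeySorted n b ciBC (Allₚ.++⁺ (All.tabulate rangeB) (All.tabulate rangeC))
    A#D : ∀ {a c} → a ∈ A → c ∈ D → key n b a ≢ key n b c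
    A#D a∈ c∈ eq = All.lookup (All.lookup (++-Unique⁻ A (IsPerm⇒Unique σ)) a∈) (∈-++⁺ʳ (b ∷ B) c∈)
      (key-injective {b = b} (rangeA a∈) (rangeC c∈) eq)
    cross : ∀ B {Z} → KeySorted (B ++ Z) → All (λ x → All (λ y → key n b x < key n b y) Z) B
    cross []      _        = []
    cross (x ∷ B) (r ∷ rs) = Allₚ.++⁻ʳ B r ∷ cross B rs
    decompose : ∃₂ λ d b′ → ∃₂ λ B′ Y → A ++ (b ∷ B) ++ D ≡ assemble d (b′ ∷ B′) Y × b′ ∷ B′ ++ Y ∈ M n ×
                length (b′ ∷ B′) ≡ k × length Y ≡ M′ + M′ × d ∈ excursions s
    decompose with merge-paths A D (AllPairs-⊆ (⊆-++ʳ (b ∷ B) A) ksBA) (AllPairs-⊆ (⊆-++ʳ (b ∷ B) D) ksBC) A#D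
    ... | d , Y , ksY , refl , refl , lend = d , b , B , Y , refl , subst (_∈ M n) (sym BY≡X) bX∈ , lenB , lenY ,
        ¬Inner⇒excursion Y d ciBY lenB lend trues-d falses-d ¬inner
      where
      trues-d : trues d ≡ M′
      trues-d = trans (sym (length-selT d Y lend)) lenA
      falses-d : falses d ≡ M′
      falses-d = trans (sym (length-selF d Y lend)) lenC
      lenY : length Y ≡ M′ + M′
      lenY = trans (sym lend) (trans (length-trues-falses d) (cong₂ _+_ trues-d falses-d))
      X : List ℕ
      X = proj₁ (InRange⇒∈-M (rangeB (here refl)))
      bX∈ : b ∷ X ∈ M n
      bX∈ = proj₂ (InRange⇒∈-M (rangeB (here refl)))
      ksBY : KeySorted (b ∷ B ++ Y)
      ksBY = AllPairsₚ.++⁺ (AllPairs-⊆ (⊆-++ˡ (b ∷ B) _) ksBA) ksY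
        (All.zipWith (λ (p , q) → Permₚ.All-resp-↭ (unshuffle-↭ d Y lend) (Allₚ.++⁺ p q)) (cross (b ∷ B) ksBA , cross (b ∷ B) ksBC))
      permBY : b ∷ B ++ Y ↭ idWord n
      permBY = ↭-trans (Permₚ.++⁺ˡ (b ∷ B) (↭-sym (unshuffle-↭ d Y lend))) (↭-trans (Permₚ.shifts (b ∷ B) (selT d Y)) σ)
      BY≡X : b ∷ B ++ Y ≡ b ∷ X
      -- Both words are sorted by the key of `b` and hold the same letters, so the merged word is
      -- the rotation of the identity that starts with `b`.
      BY≡X = AllPairs-↭⇒≡ <-asym ksBY
        (CI⇒KeySorted n b (∈-M-CI bX∈) (All.tabulate (∈-IsPerm⇒InRange (∈-M-IsPerm bX∈))))
        (↭-trans permBY (↭-sym (∈-M-IsPerm bX∈)))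
      ciBY : CI (b ∷ B ++ Y)
      ciBY = subst CI (sym BY≡X) (∈-M-CI bX∈)

  word-split : ∀ {d X} → X ∈ M n → ∃₂ λ b B → ∃ λ Y →
               X ≡ b ∷ B ++ Y × word d X ≡ assemble d (b ∷ B) Y × length (b ∷ B) ≡ k × length Y ≡ M′ + M′
  word-split {d} X∈ with ∈-M-split X∈
  ... | b , B , Y , refl , lenB , lenY = b , B , Y , refl , word-++ d (b ∷ B) Y lenB , lenB , lenY

  ∈-word : ∀ {d X} → X ∈ M n → d ∈ excursions s → IsPerm n (word d X) × Extremal (word d X) × sgn (word d X) ≡ pathSign d
  ∈-word {d} X∈ d∈ with word-split {d} X∈
  ... | b , B , Y , refl , eq , lenB , lenY =
    subst (λ w → IsPerm n w × Extremal w × sgn w ≡ pathSign d) (sym eq)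
      (assemble-IsPerm , assemble-Extremal , assemble-sgn)
    where open Assembled {d} {b} {B} {Y} X∈ lenB lenY d∈

  word-injective : ∀ {d d′ X X′} → X ∈ M n → X′ ∈ M n → d ∈ excursions s → d′ ∈ excursions s →
                   word d X ≡ word d′ X′ → X ≡ X′ × d ≡ d′
  word-injective {d} {d′} X∈ X′∈ d∈ d′∈ eq with word-split {d} X∈ | word-split {d′} X′∈
  ... | b , B , Y , refl , e , lenB , lenY | b′ , B′ , Y′ , refl , e′ , lenB′ , lenY′ =
    assemble-injective {d} {d′} {b} {b′} {B} {B′} {Y} {Y′} X∈ X′∈ lenB lenB′ lenY lenY′ d∈ d′∈ (trans (sym e) (trans eq e′))

  pairs : List (List ℕ × List Bool)
  pairs = cartesianProduct (M n) (excursions s)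

  extremalWord : List ℕ × List Bool → List ℕ
  extremalWord (X , d) = word d X

  extremalWords-Unique : Unique (map extremalWord pairs)
  extremalWords-Unique = Unique-map extremalWord
    (λ p∈ q∈ eq → let X∈ , d∈ = ∈-cartesianProduct⁻ (M n) (excursions s) p∈
                      X′∈ , d′∈ = ∈-cartesianProduct⁻ (M n) (excursions s) q∈
                      eX , ed = word-injective X∈ X′∈ d∈ d′∈ eq
                  in cong₂ _,_ eX ed)
    (Uniqueₚ.cartesianProduct⁺ (M-Unique n) (Uniqueₚ.map⁺ ∷-injectiveʳ (paths-Unique 1 M₁)))

  ∑-pairs : ∑ pairs (pathSign ∘ proj₂) ≡ ℤ.+ n ℤ.* ∑ (excursions s) pathSign
  ∑-pairs = trans (∑-cartesianProduct (M n) (excursions s) pathSign)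
    (cong (λ m → ℤ.+ m ℤ.* ∑ (excursions s) pathSign) (trans (length-map (cycShift n) (upTo n)) (length-applyUpTo id n)))

  ∑-Extremal : ∀ {T} → Unique T → (∀ {w} → w ∈ T → IsPerm n w) → (∀ {w} → IsPerm n w → NA w → w ∈ T) →
               ∑ (filter Extremal? T) sgn ≡ ℤ.+ (n * catalan s)
  ∑-Extremal {T} un T⁻ T⁺ = begin
    ∑ (filter Extremal? T) sgn              ≡⟨ ∑-↭ sgn same ⟩
    ∑ (map extremalWord pairs) sgn          ≡⟨ ∑-map extremalWord pairs sgn ⟩
    ∑ pairs (sgn ∘ extremalWord)
      ≡⟨ ∑-cong pairs (λ p∈ → let X∈ , d∈ = ∈-cartesianProduct⁻ (M n) (excursions s) p∈ in proj₂ (proj₂ (∈-word X∈ d∈))) ⟩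
    ∑ pairs (pathSign ∘ proj₂)              ≡⟨ ∑-pairs ⟩
    ℤ.+ n ℤ.* ∑ (excursions s) pathSign     ≡⟨ cong (ℤ.+ n ℤ.*_) (∑-excursions s) ⟩
    ℤ.+ n ℤ.* ℤ.+ catalan s                 ≡⟨ ℤₚ.pos-* n (catalan s) ⟨
    ℤ.+ (n * catalan s)                     ∎
    where
    open ≡-Reasoning
    to : ∀ {w} → w ∈ filter Extremal? T → w ∈ map extremalWord pairs
    to w∈ with ∈-filter⁻ Extremal? w∈
    ... | w∈T , ext with Extremal⇒assembled (T⁻ w∈T) ext
    ...   | d , b , B , Y , eq , X∈ , lenB , lenY , d∈ =
      subst (_∈ map extremalWord pairs) (trans (word-++ d (b ∷ B) Y lenB) (sym eq))
        (∈-map⁺ extremalWord (∈-cartesianProduct⁺ X∈ d∈))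
    from : ∀ {w} → w ∈ map extremalWord pairs → w ∈ filter Extremal? T
    from w∈ with ∈-map⁻ extremalWord w∈
    ... | (X , d) , p∈ , refl with ∈-cartesianProduct⁻ (M n) (excursions s) p∈
    ...   | X∈ , d∈ with ∈-word X∈ d∈
    ...     | σ , ext , _ = ∈-filter⁺ Extremal? (T⁺ σ (Win⇒NA {0} z≤n (IsPerm-length σ) (proj₁ ext))) ext
    same : filter Extremal? T ↭ map extremalWord pairs
    same = ∼bag⇒↭ (unique∧set⇒bag (Uniqueₚ.filter⁺ Extremal? un) extremalWords-Unique (mk⇔ to from))

-- From the signed count to the sizes of the two classes

class-difference : ∀ s k₀ → sign (suc k₀) ≡ -1ℤ →
  let c = suc (suc (s + s + suc k₀)); n = s + s + (2 + c) in
  (πo πe : List ℕ) →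
  IsPerm n πo → IsOdd πo → Σ (List ℕ) (λ σ → σ ≢ πo × Equiv c n πo σ) →
  IsPerm n πe → IsEven πe → Σ (List ℕ) (λ σ → σ ≢ πe × Equiv c n πe σ) →
  (Lo Le : List (List ℕ)) → Unique Lo → Unique Le →
  (∀ σ → σ ∈ Lo ⇔ (IsPerm n σ × Equiv c n πo σ)) →
  (∀ σ → σ ∈ Le ⇔ (IsPerm n σ × Equiv c n πe σ)) →
  length Lo ≡ length Le + n * catalan s
class-difference s k₀ k-odd πo πe permo oddo (σo , σo≢ , eqo) perme evene (σe , σe≢ , eqe) Lo Le unLo unLe memo meme =
  ℤₚ.+-injective (begin
    -- The signed sum over both classes is the size of the even class minus that of the odd one.
    ℤ.+ length Lo                                   ≡⟨ rearrange (ℤ.+ length Lo) (ℤ.+ length Le) ⟩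
    ℤ.+ length Le ℤ.- (ℤ.+ length Lo ℤ.* -1ℤ ℤ.+ ℤ.+ length Le ℤ.* 1ℤ)
      ≡⟨ cong (λ t → ℤ.+ length Le ℤ.- t) (begin
           ℤ.+ length Lo ℤ.* -1ℤ ℤ.+ ℤ.+ length Le ℤ.* 1ℤ
             ≡⟨ cong₂ ℤ._+_ (∑-constant Lo λ w∈ → proj₂ (proj₂ (Lo⁻ w∈)))
                            (∑-constant Le λ w∈ → proj₂ (proj₂ (Le⁻ w∈))) ⟨
           ∑ Lo sgn ℤ.+ ∑ Le sgn                            ≡⟨ ∑-++ Lo Le sgn ⟨
           ∑ T sgn                                          ≡⟨ ∑-extremal T T-Unique T⁻ T⁺ ⟩
           ℤ.- ∑ (filter Extremal? T) sgn                   ≡⟨ cong ℤ.-_ (∑-Extremal T-Unique (proj₁ ∘ T⁻) T⁺) ⟩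
           ℤ.- (ℤ.+ (n * catalan s))                        ∎) ⟩
    ℤ.+ length Le ℤ.- ℤ.- (ℤ.+ (n * catalan s))     ≡⟨ cong (λ t → ℤ.+ length Le ℤ.+ t) (ℤₚ.neg-involutive (ℤ.+ (n * catalan s))) ⟩
    ℤ.+ length Le ℤ.+ ℤ.+ (n * catalan s)           ≡⟨ cong (λ m → ℤ.+ (length Le + m * catalan s)) n≡N ⟩
    ℤ.+ (length Le + N * catalan s)                 ∎)
  where
  open ≡-Reasoning
  open ExtremalWords s k₀ k-odd
  open Sieve (s + s) k₀
  open Windows (s + s + suc k₀) using (c; NA)
  open Classes (s + s + suc k₀)
  N : ℕ
  N = s + s + (2 + c)
  n≡N : n ≡ N
  n≡N = lem (s + s) c
    where
    lem : ∀ a b → b + suc (suc a) ≡ a + (2 + b)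
    lem = solve-∀
  rearrange : ∀ a b → a ≡ b ℤ.- (a ℤ.* -1ℤ ℤ.+ b ℤ.* 1ℤ)
  rearrange = ℤSolver.solve-∀
  c-odd : sign c ≡ -1ℤ
  c-odd = trans (ℤₚ.neg-involutive _) (trans (sign-+ (s + s) (suc k₀)) (cong₂ ℤ._*_ (sign-even s) k-odd))
  NAo : NA πo
  NAo = nontrivial⇒NA σo≢ eqo
  NAe : NA πe
  NAe = nontrivial⇒NA σe≢ eqe
  sgno : sgn πo ≡ -1ℤ
  sgno = proj₂ (sign-%2 (inversions πo)) oddo
  sgne : sgn πe ≡ 1ℤ
  sgne = proj₁ (sign-%2 (inversions πe)) evene
  Lo⁻ : ∀ {w} → w ∈ Lo → IsPerm N w × NA w × sgn w ≡ -1ℤ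
  Lo⁻ {w} w∈ with Equivalence.to (memo w) w∈
  ... | σ , eq with class⁻ c-odd permo NAo eq
  ...   | na , sg = σ , na , trans sg sgno
  Le⁻ : ∀ {w} → w ∈ Le → IsPerm N w × NA w × sgn w ≡ 1ℤ
  Le⁻ {w} w∈ with Equivalence.to (meme w) w∈
  ... | σ , eq with class⁻ c-odd perme NAe eq
  ...   | na , sg = σ , na , trans sg sgne
  T : List (List ℕ)
  T = Lo ++ Le
  T-Unique : Unique T
  T-Unique = Uniqueₚ.++⁺ unLo unLe λ (p , q) → absurd (trans (sym (proj₂ (proj₂ (Lo⁻ p)))) (proj₂ (proj₂ (Le⁻ q))))
    where
    absurd : -1ℤ ≢ 1ℤ
    absurd ()
  T⁻ : ∀ {w} → w ∈ T → IsPerm n w × NA w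
  T⁻ {w} w∈ with ∈-++⁻ Lo w∈
  ... | inj₁ p = let σ , na , _ = Lo⁻ p in subst (λ m → IsPerm m w) (sym n≡N) σ , na
  ... | inj₂ q = let σ , na , _ = Le⁻ q in subst (λ m → IsPerm m w) (sym n≡N) σ , na
  -- Connectedness enters here: every non-avoider is equivalent to the given class member of its own
  -- sign.
  T⁺ : ∀ {w} → IsPerm n w → NA w → w ∈ T
  T⁺ {w} σ na with sign-dichotomy (inversions w)
  ... | inj₁ even = ∈-++⁺ʳ Lo (Equivalence.from (meme w) (σ′ , class⁺ c-odd (s + s) perme σ′ NAe na (trans even (sym sgne))))
    where σ′ = subst (λ m → IsPerm m w) n≡N σ
  ... | inj₂ odd  = ∈-++⁺ˡ (Equivalence.from (memo w) (σ′ , class⁺ c-odd (s + s) permo σ′ NAo na (trans odd (sym sgno))))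
    where σ′ = subst (λ m → IsPerm m w) n≡N σ
  ∑-constant : ∀ L {v} → (∀ {w} → w ∈ L → sgn w ≡ v) → ∑ L sgn ≡ ℤ.+ length L ℤ.* v
  ∑-constant L {v} eq = trans (∑-cong L eq) (∑-const v L)

-- Parities and the parameters of the count

sign⇒%2 : ∀ {n} → n % 2 ≡ 1 → sign n ≡ -1ℤ
sign⇒%2 {n} = proj₂ (sign-%2 n)

sign≡1⇒double : ∀ n → sign n ≡ 1ℤ → ∃ λ m → n ≡ m + m
sign≡1⇒double zero          _    = 0 , refl
sign≡1⇒double (suc zero)    ()
sign≡1⇒double (suc (suc n)) even with sign≡1⇒double n (trans (sym (ℤₚ.neg-involutive _)) even)
... | m , refl = suc m , cong suc (sym (+-suc m m))

-- The difference n - c is even and positive, hence of the form 2s + 2. The bound n < 2c makes the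
-- overlap c - (n - c) positive, and the overlap has the parity of c.
odd-parameters : ∀ c n → c % 2 ≡ 1 → c < n → n % 2 ≡ 1 → n < 2 * c →
  ∃₂ λ s k₀ → sign (suc k₀) ≡ -1ℤ × c ≡ suc (suc (s + s + suc k₀)) × n ≡ s + s + (2 + c)
odd-parameters c n codd c<n nodd n<2c with m≤n⇒∃[o]m+o≡n c<n
... | o , refl with sign≡1⇒double (suc o) even
  where
  even : sign (suc o) ≡ 1ℤ
  even = begin
    sign (suc o)                             ≡⟨ ℤₚ.neg-involutive _ ⟨
    ℤ.- (ℤ.- sign (suc o))                   ≡⟨ cong ℤ.-_ (ℤₚ.-1*i≡-i (sign (suc o))) ⟨
    ℤ.- (-1ℤ ℤ.* sign (suc o))               ≡⟨ cong (λ x → ℤ.- (x ℤ.* sign (suc o))) (sign⇒%2 {c} codd) ⟨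
    ℤ.- (sign c ℤ.* sign (suc o))            ≡⟨ cong ℤ.-_ (sign-+ c (suc o)) ⟨
    ℤ.- sign (c + suc o)                     ≡⟨ cong (λ m → ℤ.- sign m) (+-suc c o) ⟩
    ℤ.- sign (suc (c + o))                   ≡⟨ cong ℤ.-_ (sign⇒%2 {suc c + o} nodd) ⟩
    1ℤ                                       ∎
    where open ≡-Reasoning
... | zero , ()
... | suc s , eq with m≤n⇒∃[o]m+o≡n {suc (suc o)} {c} (+-cancelˡ-< c _ _ (subst₂ _<_ (sym (+-suc c o)) (cong (c +_) (+-identityʳ c)) n<2c))
...   | k₀ , eq′ = s , k₀ , kodd , c≡ , n≡
  where
  o≡ : suc o ≡ suc (suc (s + s))
  o≡ = trans eq (cong suc (+-suc s s))
  c≡ : c ≡ suc (suc (s + s + suc k₀))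
  c≡ = trans (sym eq′) (trans (cong (λ m → suc (m + k₀)) o≡) (cong (suc ∘ suc) (sym (+-suc (s + s) k₀))))
  n≡ : suc c + o ≡ s + s + (2 + c)
  n≡ = trans (cong (suc c +_) (suc-injective o≡)) (lem c (s + s))
    where
    lem : ∀ c m → suc c + suc m ≡ m + (2 + c)
    lem = solve-∀
  kodd : sign (suc k₀) ≡ -1ℤ
  kodd = begin
    sign (suc k₀)                            ≡⟨ ℤₚ.*-identityˡ _ ⟨
    1ℤ ℤ.* sign (suc k₀)                     ≡⟨ cong (ℤ._* sign (suc k₀)) (sign-even s) ⟨
    sign (s + s) ℤ.* sign (suc k₀)           ≡⟨ sign-+ (s + s) (suc k₀) ⟨
    sign (s + s + suc k₀)                    ≡⟨ ℤₚ.neg-involutive _ ⟨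
    sign (suc (suc (s + s + suc k₀)))        ≡⟨ cong sign c≡ ⟨
    sign c                                   ≡⟨ sign⇒%2 {c} codd ⟩
    -1ℤ                                      ∎
    where open ≡-Reasoning

mainTheorem10 : (c n : ℕ) → 1 < c → c % 2 ≡ 1 → c < n → n % 2 ≡ 1 → n < 2 * c →
    (πo πe : List ℕ) →
    IsPerm n πo → IsOdd πo → Σ (List ℕ) (λ σ → σ ≢ πo × Equiv c n πo σ) →
    IsPerm n πe → IsEven πe → Σ (List ℕ) (λ σ → σ ≢ πe × Equiv c n πe σ) →
    (Lo Le : List (List ℕ)) → Unique Lo → Unique Le →
    (∀ σ → σ ∈ Lo ⇔ (IsPerm n σ × Equiv c n πo σ)) →
    (∀ σ → σ ∈ Le ⇔ (IsPerm n σ × Equiv c n πe σ)) →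
    length Lo ≡ length Le + n * catalan ((n ∸ c ∸ 2) / 2)
mainTheorem10 c n _ codd c<n nodd n<2c with odd-parameters c n codd c<n nodd n<2c
... | s , k₀ , kodd , refl , refl = λ πo πe po oo no pe ee ne Lo Le uo ue mo me →
  trans (class-difference s k₀ kodd πo πe po oo no pe ee ne Lo Le uo ue mo me)
    (cong (λ m → length Le + n * catalan m) (sym half))
  where
  half : (s + s + (2 + c) ∸ c ∸ 2) / 2 ≡ s
  half = trans (cong (λ m → (m ∸ 2) / 2) (begin
    s + s + (2 + c) ∸ c   ≡⟨ cong (_∸ c) (+-assoc (s + s) 2 c) ⟨
    s + s + 2 + c ∸ c     ≡⟨ m+n∸n≡m (s + s + 2) c ⟩
    s + s + 2             ∎))
    (trans (cong (_/ 2) (trans (m+n∸n≡m (s + s) 2) (double s))) (m*n/n≡m s 2))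
    where
    open ≡-Reasoning
    double : ∀ s → s + s ≡ s * 2
    double = solve-∀
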